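{- Let $f_\nu(x)=(1+x)\,\mathrm{cosb}_\nu(x)^2=\sum_{m\ge0}a_mx^m/m!$ and $\ddot H_{n}(f_\nu)=\det(a_{2i+j})_{0\le i,j\le n-1}$. For every $N\ge1$, as an identity in $\mathbb Q(\nu)$, $$\ddot H_{2N}(f_\nu) =(-1)^N\,2^{\binom{2N}2}\, \prod_{i=0}^{2N-1}(2i)!\; \prod_{k=0}^{N-1}(\tfrac12)_k\,\bigl((\nu+\tfrac12)_k\bigr)^{2}\,(2\nu+\tfrac12)_k \; \prod_{i=0}^{2N-1} \frac{(\nu+\tfrac12)_i}{(\nu+1)_{N-1+i}\,(2\nu+1)_{N-1+i}}\,.$$ Moreover the rational function $\ddot H_{2N}(f_\nu)$ is regular at every $\nu\notin\{ -1,-2,\dots\}$, so the identity may be specialised at each such $\nu$ after the cancellations between the factors of the $(2\nu+1)_{N-1+i}$ and the half-integer numerator factors.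
   Context: $\mathrm{cosb}_\nu$ is the normalised Bessel function $\mathrm{cosb}_\nu(x)=\Gamma(\nu+1)(2/x)^\nu J_\nu(x)=\sum_{k\ge0}\frac{(-1)^k}{4^k\,k!\,(\nu+1)_k}x^{2k}$, viewed as a power series in $x$ with coefficients in $\mathbb Q(\nu)$. $(\gamma)_m=\gamma(\gamma+1)\cdots(\gamma+m-1)$ is the Pochhammer symbol; empty products equal $1$. -}

module Defs where

open import Algebra.Apartness.Bundles using (HeytingField; module HeytingCommutativeRing)
open import Algebra.Bundles using (CommutativeRing; Semiring)
open import Algebra.Morphism.Construct.Composition using (isRingHomomorphism)
open import Algebra.Morphism.Structures using (module RingMorphisms)
import Algebra.Apartness.Properties.HeytingCommutativeRing as HeytingProperties
import Algebra.Definitions.RawSemiring as RawSemiringDefs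
import Algebra.Properties.CommutativeSemigroup as SemigroupProperties
import Algebra.Properties.Ring as RingProperties
import Algebra.Solver.Ring.NaturalCoefficients.Default as SemiringSolver
open import Data.Fin.Base using (Fin; zero; suc; toℕ; punchIn)
import Data.Integer.Base as ℤ
open import Data.List.Base using (List; []; _∷_; map)
open import Data.Nat.Base as ℕ using (ℕ; zero; suc; _∸_; _!)
open import Data.Nat.Combinatorics using (_C_)
import Data.Nat.Properties as ℕₚ
open import Data.Product.Base using (_×_; _,_; proj₁; proj₂)
open import Data.Rational.Base as ℚ using (ℚ; ½)
import Data.Rational.Properties as ℚₚ
open import Data.Sum.Base using (_⊎_; inj₁; inj₂)
open import Level using (_⊔_; 0ℓ)
open import Relation.Binary.Bundles using (Setoid; DecSetoid)
open import Relation.Binary.Definitions using (Decidable)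
import Relation.Binary.Properties.DecSetoid as DecSetoidProperties
open import Relation.Binary.PropositionalEquality as ≡ using (_≡_)
import Relation.Binary.Reasoning.Setoid as SetoidReasoning
open import Relation.Nullary.Decidable using (Dec; yes; no; map′)
open import Relation.Nullary.Negation using (¬_; contradiction)

module Polynomials {c ℓ} (R : CommutativeRing c ℓ) where

  private
    module R = CommutativeRing R
  open R using (Carrier; _≈_; 0#; 1#)
  open RingProperties R.ring using (-0#≈0#)
  open SemigroupProperties R.+-commutativeSemigroup using (interchange; x∙yz≈y∙xz)

  -- Coefficients in order of increasing degree; trailing zeros are allowed.
  Poly : Set c
  Poly = List Carrier

  coeff : Poly → ℕ → Carrier
  coeff []      _       = 0#
  coeff (a ∷ p) zero    = a
  coeff (a ∷ p) (suc n) = coeff p n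

  infix 4 _≈ₚ_
  record _≈ₚ_ (p q : Poly) : Set ℓ where
    constructor coeffwise
    field coeff-≈ : ∀ n → coeff p n ≈ coeff q n
  open _≈ₚ_ public

  infixl 6 _+ₚ_
  infixl 7 _*ₚ_ _·_
  infix  8 -ₚ_

  _+ₚ_ : Poly → Poly → Poly
  []      +ₚ q       = q
  (a ∷ p) +ₚ []      = a ∷ p
  (a ∷ p) +ₚ (b ∷ q) = (a R.+ b) ∷ (p +ₚ q)

  -ₚ_ : Poly → Poly
  -ₚ_ = map (R.-_)

  _·_ : Carrier → Poly → Poly
  a · p = map (a R.*_) p

  _*ₚ_ : Poly → Poly → Poly
  []      *ₚ q = []
  (a ∷ p) *ₚ q = a · q +ₚ (0# ∷ p *ₚ q)

  constant : Carrier → Poly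
  constant a = a ∷ []

  0ₚ 1ₚ X : Poly
  0ₚ = []
  1ₚ = constant 1#
  X  = 0# ∷ 1# ∷ []

  coeff-+ : ∀ p q n → coeff (p +ₚ q) n ≈ coeff p n R.+ coeff q n
  coeff-+ []      q       n       = R.sym (R.+-identityˡ _)
  coeff-+ (a ∷ p) []      n       = R.sym (R.+-identityʳ _)
  coeff-+ (a ∷ p) (b ∷ q) zero    = R.refl
  coeff-+ (a ∷ p) (b ∷ q) (suc n) = coeff-+ p q n

  coeff-neg : ∀ p n → coeff (-ₚ p) n ≈ R.- coeff p n
  coeff-neg []      n       = R.sym -0#≈0#
  coeff-neg (a ∷ p) zero    = R.refl
  coeff-neg (a ∷ p) (suc n) = coeff-neg p n

  coeff-· : ∀ a p n → coeff (a · p) n ≈ a R.* coeff p n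
  coeff-· a []      n       = R.sym (R.zeroʳ a)
  coeff-· a (b ∷ p) zero    = R.refl
  coeff-· a (b ∷ p) (suc n) = coeff-· a p n

  ≈ₚ-setoid : Setoid c ℓ
  ≈ₚ-setoid = record
    { Carrier       = Poly
    ; _≈_           = _≈ₚ_
    ; isEquivalence = record
      { refl  = coeffwise λ _ → R.refl
      ; sym   = λ p≈q → coeffwise λ n → R.sym (coeff-≈ p≈q n)
      ; trans = λ p≈q q≈r → coeffwise λ n → R.trans (coeff-≈ p≈q n) (coeff-≈ q≈r n)
      }
    }

  open Setoid ≈ₚ-setoid public using () renaming
    (refl to ≈ₚ-refl; sym to ≈ₚ-sym; trans to ≈ₚ-trans)

  private
    module ≈R = SetoidReasoning R.setoid
    module ≈P = SetoidReasoning ≈ₚ-setoid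

  ∷-cong : ∀ {a b p q} → a ≈ b → p ≈ₚ q → a ∷ p ≈ₚ b ∷ q
  ∷-cong a≈b p≈q = coeffwise λ where
    zero    → a≈b
    (suc n) → coeff-≈ p≈q n

  0∷[]≈[] : 0# ∷ [] ≈ₚ []
  0∷[]≈[] = coeffwise λ where
    zero    → R.refl
    (suc _) → R.refl

  +ₚ-cong : ∀ {p p′ q q′} → p ≈ₚ p′ → q ≈ₚ q′ → p +ₚ q ≈ₚ p′ +ₚ q′
  +ₚ-cong {p} {p′} {q} {q′} p≈p′ q≈q′ = coeffwise λ n → let open ≈R in begin
    coeff (p +ₚ q) n           ≈⟨ coeff-+ p q n ⟩
    coeff p n R.+ coeff q n    ≈⟨ R.+-cong (coeff-≈ p≈p′ n) (coeff-≈ q≈q′ n) ⟩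
    coeff p′ n R.+ coeff q′ n  ≈⟨ coeff-+ p′ q′ n ⟨
    coeff (p′ +ₚ q′) n         ∎

  +ₚ-comm : ∀ p q → p +ₚ q ≈ₚ q +ₚ p
  +ₚ-comm p q = coeffwise λ n → let open ≈R in begin
    coeff (p +ₚ q) n         ≈⟨ coeff-+ p q n ⟩
    coeff p n R.+ coeff q n  ≈⟨ R.+-comm _ _ ⟩
    coeff q n R.+ coeff p n  ≈⟨ coeff-+ q p n ⟨
    coeff (q +ₚ p) n         ∎

  +ₚ-assoc : ∀ p q r → p +ₚ q +ₚ r ≈ₚ p +ₚ (q +ₚ r)
  +ₚ-assoc p q r = coeffwise λ n → let open ≈R in begin
    coeff (p +ₚ q +ₚ r) n                      ≈⟨ coeff-+ (p +ₚ q) r n ⟩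
    coeff (p +ₚ q) n R.+ coeff r n             ≈⟨ R.+-congʳ (coeff-+ p q n) ⟩
    coeff p n R.+ coeff q n R.+ coeff r n      ≈⟨ R.+-assoc _ _ _ ⟩
    coeff p n R.+ (coeff q n R.+ coeff r n)    ≈⟨ R.+-congˡ (coeff-+ q r n) ⟨
    coeff p n R.+ coeff (q +ₚ r) n             ≈⟨ coeff-+ p (q +ₚ r) n ⟨
    coeff (p +ₚ (q +ₚ r)) n                    ∎

  +ₚ-identityʳ : ∀ p → p +ₚ [] ≈ₚ p
  +ₚ-identityʳ p = +ₚ-comm p []

  -ₚ-cong : ∀ {p q} → p ≈ₚ q → -ₚ p ≈ₚ -ₚ q
  -ₚ-cong {p} {q} p≈q = coeffwise λ n → let open ≈R in begin
    coeff (-ₚ p) n  ≈⟨ coeff-neg p n ⟩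
    R.- coeff p n   ≈⟨ R.-‿cong (coeff-≈ p≈q n) ⟩
    R.- coeff q n   ≈⟨ coeff-neg q n ⟨
    coeff (-ₚ q) n  ∎

  +ₚ-inverseʳ : ∀ p → p +ₚ -ₚ p ≈ₚ []
  +ₚ-inverseʳ p = coeffwise λ n → let open ≈R in begin
    coeff (p +ₚ -ₚ p) n           ≈⟨ coeff-+ p (-ₚ p) n ⟩
    coeff p n R.+ coeff (-ₚ p) n  ≈⟨ R.+-congˡ (coeff-neg p n) ⟩
    coeff p n R.- coeff p n       ≈⟨ R.-‿inverseʳ _ ⟩
    0#                            ∎

  +ₚ-interchange : ∀ p q r s → (p +ₚ q) +ₚ (r +ₚ s) ≈ₚ (p +ₚ r) +ₚ (q +ₚ s)
  +ₚ-interchange p q r s = coeffwise λ n → let open ≈R in begin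
    coeff ((p +ₚ q) +ₚ (r +ₚ s)) n  ≈⟨ expand p q r s n ⟩
    _                               ≈⟨ interchange _ _ _ _ ⟩
    _                               ≈⟨ expand p r q s n ⟨
    coeff ((p +ₚ r) +ₚ (q +ₚ s)) n  ∎
    where
    expand : ∀ p q r s n → coeff ((p +ₚ q) +ₚ (r +ₚ s)) n ≈
             (coeff p n R.+ coeff q n) R.+ (coeff r n R.+ coeff s n)
    expand p q r s n = R.trans (coeff-+ (p +ₚ q) (r +ₚ s) n)
                               (R.+-cong (coeff-+ p q n) (coeff-+ r s n))

  ·-cong : ∀ {a b p q} → a ≈ b → p ≈ₚ q → a · p ≈ₚ b · q
  ·-cong {a} {b} {p} {q} a≈b p≈q = coeffwise λ n → let open ≈R in begin
    coeff (a · p) n    ≈⟨ coeff-· a p n ⟩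
    a R.* coeff p n    ≈⟨ R.*-cong a≈b (coeff-≈ p≈q n) ⟩
    b R.* coeff q n    ≈⟨ coeff-· b q n ⟨
    coeff (b · q) n    ∎

  ·-distrib-+ₚ : ∀ a p q → a · (p +ₚ q) ≈ₚ a · p +ₚ a · q
  ·-distrib-+ₚ a p q = coeffwise λ n → let open ≈R in begin
    coeff (a · (p +ₚ q)) n                   ≈⟨ coeff-· a (p +ₚ q) n ⟩
    a R.* coeff (p +ₚ q) n                   ≈⟨ R.*-congˡ (coeff-+ p q n) ⟩
    a R.* (coeff p n R.+ coeff q n)          ≈⟨ R.distribˡ _ _ _ ⟩
    a R.* coeff p n R.+ a R.* coeff q n      ≈⟨ R.+-cong (coeff-· a p n) (coeff-· a q n) ⟨
    coeff (a · p) n R.+ coeff (a · q) n      ≈⟨ coeff-+ (a · p) (a · q) n ⟨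
    coeff (a · p +ₚ a · q) n                 ∎

  +-distrib-· : ∀ a b p → (a R.+ b) · p ≈ₚ a · p +ₚ b · p
  +-distrib-· a b p = coeffwise λ n → let open ≈R in begin
    coeff ((a R.+ b) · p) n                  ≈⟨ coeff-· (a R.+ b) p n ⟩
    (a R.+ b) R.* coeff p n                  ≈⟨ R.distribʳ _ _ _ ⟩
    a R.* coeff p n R.+ b R.* coeff p n      ≈⟨ R.+-cong (coeff-· a p n) (coeff-· b p n) ⟨
    coeff (a · p) n R.+ coeff (b · p) n      ≈⟨ coeff-+ (a · p) (b · p) n ⟨
    coeff (a · p +ₚ b · p) n                 ∎

  ·-assoc : ∀ a b p → a · (b · p) ≈ₚ (a R.* b) · p
  ·-assoc a b p = coeffwise λ n → let open ≈R in begin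
    coeff (a · (b · p)) n      ≈⟨ coeff-· a (b · p) n ⟩
    a R.* coeff (b · p) n      ≈⟨ R.*-congˡ (coeff-· b p n) ⟩
    a R.* (b R.* coeff p n)    ≈⟨ R.*-assoc _ _ _ ⟨
    (a R.* b) R.* coeff p n    ≈⟨ coeff-· (a R.* b) p n ⟨
    coeff ((a R.* b) · p) n    ∎

  1·p≈p : ∀ p → 1# · p ≈ₚ p
  1·p≈p p = coeffwise λ n → R.trans (coeff-· 1# p n) (R.*-identityˡ _)

  0·p≈0 : ∀ p → 0# · p ≈ₚ []
  0·p≈0 p = coeffwise λ n → R.trans (coeff-· 0# p n) (R.zeroˡ _)

  0∷-+ₚ : ∀ p q → 0# ∷ (p +ₚ q) ≈ₚ (0# ∷ p) +ₚ (0# ∷ q)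
  0∷-+ₚ p q = ∷-cong (R.sym (R.+-identityˡ 0#)) ≈ₚ-refl

  0∷-· : ∀ a p → a · (0# ∷ p) ≈ₚ 0# ∷ a · p
  0∷-· a p = ∷-cong (R.zeroʳ a) ≈ₚ-refl

  *ₚ-zeroʳ : ∀ p → p *ₚ [] ≈ₚ []
  *ₚ-zeroʳ []      = ≈ₚ-refl
  *ₚ-zeroʳ (a ∷ p) = ≈ₚ-trans (∷-cong R.refl (*ₚ-zeroʳ p)) 0∷[]≈[]

  *ₚ-congˡ : ∀ p {q r} → q ≈ₚ r → p *ₚ q ≈ₚ p *ₚ r
  *ₚ-congˡ []      q≈r = ≈ₚ-refl
  *ₚ-congˡ (a ∷ p) q≈r =
    +ₚ-cong (·-cong R.refl q≈r) (∷-cong R.refl (*ₚ-congˡ p q≈r))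

  *ₚ-∷ : ∀ p b q → p *ₚ (b ∷ q) ≈ₚ b · p +ₚ (0# ∷ p *ₚ q)
  *ₚ-∷ []      b q = ≈ₚ-sym 0∷[]≈[]
  *ₚ-∷ (a ∷ p) b q = ∷-cong (R.+-congʳ (R.*-comm a b)) (begin
    a · q +ₚ p *ₚ (b ∷ q)                 ≈⟨ +ₚ-cong ≈ₚ-refl (*ₚ-∷ p b q) ⟩
    a · q +ₚ (b · p +ₚ (0# ∷ p *ₚ q))     ≈⟨ +ₚ-assoc (a · q) (b · p) _ ⟨
    a · q +ₚ b · p +ₚ (0# ∷ p *ₚ q)       ≈⟨ +ₚ-cong (+ₚ-comm (a · q) (b · p)) ≈ₚ-refl ⟩
    b · p +ₚ a · q +ₚ (0# ∷ p *ₚ q)       ≈⟨ +ₚ-assoc (b · p) (a · q) _ ⟩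
    b · p +ₚ (a · q +ₚ (0# ∷ p *ₚ q))     ∎)
    where open ≈P

  *ₚ-comm : ∀ p q → p *ₚ q ≈ₚ q *ₚ p
  *ₚ-comm []      q = ≈ₚ-sym (*ₚ-zeroʳ q)
  *ₚ-comm (a ∷ p) q = ≈ₚ-trans
    (+ₚ-cong ≈ₚ-refl (∷-cong R.refl (*ₚ-comm p q))) (≈ₚ-sym (*ₚ-∷ q a p))

  *ₚ-cong : ∀ {p p′ q q′} → p ≈ₚ p′ → q ≈ₚ q′ → p *ₚ q ≈ₚ p′ *ₚ q′
  *ₚ-cong {p} {p′} {q} {q′} p≈p′ q≈q′ = begin
    p *ₚ q    ≈⟨ *ₚ-congˡ p q≈q′ ⟩
    p *ₚ q′   ≈⟨ *ₚ-comm p q′ ⟩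
    q′ *ₚ p   ≈⟨ *ₚ-congˡ q′ p≈p′ ⟩
    q′ *ₚ p′  ≈⟨ *ₚ-comm q′ p′ ⟩
    p′ *ₚ q′  ∎
    where open ≈P

  *ₚ-distribˡ : ∀ p q r → p *ₚ (q +ₚ r) ≈ₚ p *ₚ q +ₚ p *ₚ r
  *ₚ-distribˡ []      q r = ≈ₚ-refl
  *ₚ-distribˡ (a ∷ p) q r = begin
    a · (q +ₚ r) +ₚ (0# ∷ p *ₚ (q +ₚ r))
      ≈⟨ +ₚ-cong (·-distrib-+ₚ a q r) (∷-cong R.refl (*ₚ-distribˡ p q r)) ⟩
    (a · q +ₚ a · r) +ₚ (0# ∷ (p *ₚ q +ₚ p *ₚ r))
      ≈⟨ +ₚ-cong ≈ₚ-refl (0∷-+ₚ (p *ₚ q) (p *ₚ r)) ⟩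
    (a · q +ₚ a · r) +ₚ ((0# ∷ p *ₚ q) +ₚ (0# ∷ p *ₚ r))
      ≈⟨ +ₚ-interchange (a · q) (a · r) _ _ ⟩
    (a · q +ₚ (0# ∷ p *ₚ q)) +ₚ (a · r +ₚ (0# ∷ p *ₚ r))
      ∎
    where open ≈P

  *ₚ-distribʳ : ∀ r p q → (p +ₚ q) *ₚ r ≈ₚ p *ₚ r +ₚ q *ₚ r
  *ₚ-distribʳ r p q = begin
    (p +ₚ q) *ₚ r         ≈⟨ *ₚ-comm (p +ₚ q) r ⟩
    r *ₚ (p +ₚ q)         ≈⟨ *ₚ-distribˡ r p q ⟩
    r *ₚ p +ₚ r *ₚ q      ≈⟨ +ₚ-cong (*ₚ-comm r p) (*ₚ-comm r q) ⟩
    p *ₚ r +ₚ q *ₚ r      ∎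
    where open ≈P

  ·-*ₚ-assoc : ∀ a p q → (a · p) *ₚ q ≈ₚ a · (p *ₚ q)
  ·-*ₚ-assoc a []      q = ≈ₚ-refl
  ·-*ₚ-assoc a (b ∷ p) q = begin
    (a R.* b) · q +ₚ (0# ∷ (a · p) *ₚ q)
      ≈⟨ +ₚ-cong (≈ₚ-sym (·-assoc a b q)) (∷-cong R.refl (·-*ₚ-assoc a p q)) ⟩
    a · (b · q) +ₚ (0# ∷ a · (p *ₚ q))
      ≈⟨ +ₚ-cong ≈ₚ-refl (0∷-· a (p *ₚ q)) ⟨
    a · (b · q) +ₚ a · (0# ∷ p *ₚ q)
      ≈⟨ ·-distrib-+ₚ a (b · q) _ ⟨
    a · (b · q +ₚ (0# ∷ p *ₚ q))
      ∎
    where open ≈P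

  0∷-*ₚ : ∀ p q → (0# ∷ p) *ₚ q ≈ₚ 0# ∷ p *ₚ q
  0∷-*ₚ p q = +ₚ-cong (0·p≈0 q) ≈ₚ-refl

  *ₚ-assoc : ∀ p q r → p *ₚ q *ₚ r ≈ₚ p *ₚ (q *ₚ r)
  *ₚ-assoc []      q r = ≈ₚ-refl
  *ₚ-assoc (a ∷ p) q r = begin
    (a · q +ₚ (0# ∷ p *ₚ q)) *ₚ r
      ≈⟨ *ₚ-distribʳ r (a · q) _ ⟩
    (a · q) *ₚ r +ₚ (0# ∷ p *ₚ q) *ₚ r
      ≈⟨ +ₚ-cong (·-*ₚ-assoc a q r) (0∷-*ₚ (p *ₚ q) r) ⟩
    a · (q *ₚ r) +ₚ (0# ∷ p *ₚ q *ₚ r)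
      ≈⟨ +ₚ-cong ≈ₚ-refl (∷-cong R.refl (*ₚ-assoc p q r)) ⟩
    a · (q *ₚ r) +ₚ (0# ∷ p *ₚ (q *ₚ r))
      ∎
    where open ≈P

  constant-*ₚ : ∀ a p → constant a *ₚ p ≈ₚ a · p
  constant-*ₚ a p = ≈ₚ-trans (+ₚ-cong ≈ₚ-refl 0∷[]≈[]) (+ₚ-identityʳ (a · p))

  *ₚ-identityˡ : ∀ p → 1ₚ *ₚ p ≈ₚ p
  *ₚ-identityˡ p = ≈ₚ-trans (constant-*ₚ 1# p) (1·p≈p p)

  commutativeRing : CommutativeRing c ℓ
  commutativeRing = record
    { Carrier = Poly ; _≈_ = _≈ₚ_
    ; _+_ = _+ₚ_ ; _*_ = _*ₚ_ ; -_ = -ₚ_ ; 0# = 0ₚ ; 1# = 1ₚ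
    ; isCommutativeRing = record
      { isRing = record
        { +-isAbelianGroup = record
          { isGroup = record
            { isMonoid = record
              { isSemigroup = record
                { isMagma = record
                  { isEquivalence = Setoid.isEquivalence ≈ₚ-setoid
                  ; ∙-cong = +ₚ-cong }
                ; assoc = +ₚ-assoc }
              ; identity = (λ _ → ≈ₚ-refl) , +ₚ-identityʳ }
            ; inverse = (λ p → ≈ₚ-trans (+ₚ-comm (-ₚ p) p) (+ₚ-inverseʳ p)) , +ₚ-inverseʳ
            ; ⁻¹-cong = -ₚ-cong }
          ; comm = +ₚ-comm }
        ; *-cong = *ₚ-cong
        ; *-assoc = *ₚ-assoc
        ; *-identity = *ₚ-identityˡ , λ p → ≈ₚ-trans (*ₚ-comm p 1ₚ) (*ₚ-identityˡ p)
        ; distrib = *ₚ-distribˡ , *ₚ-distribʳ }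
      ; *-comm = *ₚ-comm } }

  constant-isRingHomomorphism : RingMorphisms.IsRingHomomorphism
    R.rawRing (CommutativeRing.rawRing commutativeRing) constant
  constant-isRingHomomorphism = record
    { isSemiringHomomorphism = record
      { isNearSemiringHomomorphism = record
        { +-isMonoidHomomorphism = record
          { isMagmaHomomorphism = record
            { isRelHomomorphism = record { cong = λ a≈b → ∷-cong a≈b ≈ₚ-refl }
            ; homo = λ a b → ≈ₚ-refl }
          ; ε-homo = 0∷[]≈[] }
        ; *-homo = λ a b → ≈ₚ-sym (constant-*ₚ a (constant b)) }
      ; 1#-homo = ≈ₚ-refl }
    ; -‿homo = λ a → ≈ₚ-refl }

  X≉constant : ¬ 1# ≈ 0# → ∀ a → ¬ X ≈ₚ constant a
  X≉constant 1≉0 a e = 1≉0 (coeff-≈ e 1)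

  module _ (_≟_ : Decidable _≈_) where

    private
      uncons : ∀ {p q} → coeff p 0 ≈ coeff q 0 →
               (∀ n → coeff p (suc n) ≈ coeff q (suc n)) → p ≈ₚ q
      uncons h t = coeffwise λ where
        zero    → h
        (suc n) → t n

      ≟-[] : ∀ p → Dec (p ≈ₚ [])
      ≟-[] []      = yes ≈ₚ-refl
      ≟-[] (a ∷ p) with a ≟ 0# | ≟-[] p
      ... | yes a≈0 | yes p≈0 = yes (uncons a≈0 (coeff-≈ p≈0))
      ... | no  a≉0 | _       = no λ e → a≉0 (coeff-≈ e 0)
      ... | _       | no  p≉0 = no λ e → p≉0 (coeffwise λ n → coeff-≈ e (suc n))

    ≈ₚ-dec : Decidable _≈ₚ_
    ≈ₚ-dec p       []      = ≟-[] p
    ≈ₚ-dec []      (b ∷ q) = map′ ≈ₚ-sym ≈ₚ-sym (≟-[] (b ∷ q))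
    ≈ₚ-dec (a ∷ p) (b ∷ q) with a ≟ b | ≈ₚ-dec p q
    ... | yes a≈b | yes p≈q = yes (∷-cong a≈b p≈q)
    ... | no  a≉b | _       = no λ e → a≉b (coeff-≈ e 0)
    ... | _       | no  p≉q = no λ e → p≉q (coeffwise λ n → coeff-≈ e (suc n))

    module _ (noZeroDivisors : ∀ a b → a R.* b ≈ 0# → a ≈ 0# ⊎ b ≈ 0#) where

      private
        head≉0 : ∀ {a} p q → ¬ a ≈ 0# → (a ∷ p) *ₚ q ≈ₚ [] → q ≈ₚ []
        head≉0 p []      a≉0 _ = ≈ₚ-refl
        head≉0 {a} p (b ∷ q) a≉0 e = uncons b≈0 (coeff-≈ (head≉0 p q a≉0 e′))
          where
          b≈0 : b ≈ 0#
          b≈0 with noZeroDivisors a b (R.trans (R.sym (R.+-identityʳ _)) (coeff-≈ e 0))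
          ... | inj₁ a≈0 = contradiction a≈0 a≉0
          ... | inj₂ b≈0 = b≈0

          shifted : 0# ∷ (a ∷ p) *ₚ q ≈ₚ []
          shifted = begin
            0# ∷ (a ∷ p) *ₚ q                       ≈⟨ +ₚ-cong (0·p≈0 (a ∷ p)) ≈ₚ-refl ⟨
            0# · (a ∷ p) +ₚ (0# ∷ (a ∷ p) *ₚ q)     ≈⟨ +ₚ-cong {q = 0# ∷ (a ∷ p) *ₚ q} (·-cong {p = a ∷ p} b≈0 ≈ₚ-refl) ≈ₚ-refl ⟨
            b · (a ∷ p) +ₚ (0# ∷ (a ∷ p) *ₚ q)      ≈⟨ *ₚ-∷ (a ∷ p) b q ⟨
            (a ∷ p) *ₚ (b ∷ q)                      ≈⟨ e ⟩
            []                                      ∎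
            where open ≈P

          e′ : (a ∷ p) *ₚ q ≈ₚ []
          e′ = coeffwise λ n → coeff-≈ shifted (suc n)

      *ₚ-noZeroDivisors : ∀ p q → p *ₚ q ≈ₚ [] → p ≈ₚ [] ⊎ q ≈ₚ []
      *ₚ-noZeroDivisors []      q _ = inj₁ ≈ₚ-refl
      *ₚ-noZeroDivisors (a ∷ p) q e with a ≟ 0#
      ... | no  a≉0 = inj₂ (head≉0 p q a≉0 e)
      ... | yes a≈0 with *ₚ-noZeroDivisors p q (coeffwise λ n → coeff-≈ shifted (suc n))
        where
        shifted : 0# ∷ p *ₚ q ≈ₚ []
        shifted = begin
          0# ∷ p *ₚ q      ≈⟨ 0∷-*ₚ p q ⟨
          (0# ∷ p) *ₚ q    ≈⟨ *ₚ-cong {a ∷ p} {0# ∷ p} {q} {q} (∷-cong a≈0 ≈ₚ-refl) ≈ₚ-refl ⟨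
          (a ∷ p) *ₚ q     ≈⟨ e ⟩
          []               ∎
          where open ≈P
      ...   | inj₁ p≈0 = inj₁ (uncons a≈0 (coeff-≈ p≈0))
      ...   | inj₂ q≈0 = inj₂ q≈0

module Fractions
  {c ℓ} (D : CommutativeRing c ℓ)
  (_≟_ : Decidable (CommutativeRing._≈_ D))
  (1≉0 : ¬ CommutativeRing._≈_ D (CommutativeRing.1# D) (CommutativeRing.0# D))
  (noZeroDivisors : ∀ a b →
    CommutativeRing._≈_ D (CommutativeRing._*_ D a b) (CommutativeRing.0# D) →
    CommutativeRing._≈_ D a (CommutativeRing.0# D) ⊎ CommutativeRing._≈_ D b (CommutativeRing.0# D))
  where

  open CommutativeRing D

  record Fraction : Set (c ⊔ ℓ) where
    constructor _/_[_]
    field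
      num   : Carrier
      den   : Carrier
      den≉0 : ¬ den ≈ 0#
  open Fraction public

  infix 4 _≈ᶠ_
  record _≈ᶠ_ (x y : Fraction) : Set ℓ where
    constructor cross
    field cross-≈ : num x * den y ≈ num y * den x
  open _≈ᶠ_ public

  *-≉0 : ∀ {a b} → ¬ a ≈ 0# → ¬ b ≈ 0# → ¬ a * b ≈ 0#
  *-≉0 {a} {b} a≉0 b≉0 ab≈0 with noZeroDivisors a b ab≈0
  ... | inj₁ a≈0 = a≉0 a≈0
  ... | inj₂ b≈0 = b≉0 b≈0

  infixl 6 _+ᶠ_
  infixl 7 _*ᶠ_
  infix  8 -ᶠ_

  _+ᶠ_ _*ᶠ_ : Fraction → Fraction → Fraction
  x +ᶠ y = (num x * den y + num y * den x) / (den x * den y) [ *-≉0 (den≉0 x) (den≉0 y) ]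
  x *ᶠ y = (num x * num y) / (den x * den y) [ *-≉0 (den≉0 x) (den≉0 y) ]

  -ᶠ_ : Fraction → Fraction
  -ᶠ x = (- num x) / den x [ den≉0 x ]

  fromDomain : Carrier → Fraction
  fromDomain a = a / 1# [ 1≉0 ]

  0ᶠ 1ᶠ : Fraction
  0ᶠ = fromDomain 0#
  1ᶠ = fromDomain 1#

  private
    open RingProperties ring using (x∙y⁻¹≈ε⇒x≈y; -‿distribˡ-*; [y-z]x≈yx-zx)
    open SemiringSolver commutativeSemiring using (solve; _:+_; _:*_; _:=_)
    open SetoidReasoning setoid

    cancelʳ : ∀ {c} → ¬ c ≈ 0# → ∀ a b → a * c ≈ b * c → a ≈ b
    cancelʳ {c} c≉0 a b ac≈bc with noZeroDivisors (a - b) c (begin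
      (a - b) * c      ≈⟨ [y-z]x≈yx-zx c a b ⟩
      a * c - b * c    ≈⟨ +-congʳ ac≈bc ⟩
      b * c - b * c    ≈⟨ -‿inverseʳ _ ⟩
      0#               ∎)
    ... | inj₁ a-b≈0 = x∙y⁻¹≈ε⇒x≈y a b a-b≈0
    ... | inj₂ c≈0   = contradiction c≈0 c≉0

  ≈ᶠ-refl : ∀ {x} → x ≈ᶠ x
  ≈ᶠ-refl = cross refl

  ≈ᶠ-sym : ∀ {x y} → x ≈ᶠ y → y ≈ᶠ x
  ≈ᶠ-sym (cross e) = cross (sym e)

  ≈ᶠ-trans : ∀ {x y z} → x ≈ᶠ y → y ≈ᶠ z → x ≈ᶠ z
  ≈ᶠ-trans {a / a′ [ _ ]} {b / b′ [ b′≉0 ]} {c / c′ [ _ ]} (cross e) (cross f) =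
    cross (cancelʳ b′≉0 (a * c′) (c * a′) (begin
      a * c′ * b′   ≈⟨ solve 3 (λ a c′ b′ → a :* c′ :* b′ := a :* b′ :* c′) refl a c′ b′ ⟩
      a * b′ * c′   ≈⟨ *-congʳ e ⟩
      b * a′ * c′   ≈⟨ solve 3 (λ b a′ c′ → b :* a′ :* c′ := b :* c′ :* a′) refl b a′ c′ ⟩
      b * c′ * a′   ≈⟨ *-congʳ f ⟩
      c * b′ * a′   ≈⟨ solve 3 (λ c b′ a′ → c :* b′ :* a′ := c :* a′ :* b′) refl c b′ a′ ⟩
      c * a′ * b′   ∎))

  +ᶠ-cong : ∀ {x x′ y y′} → x ≈ᶠ x′ → y ≈ᶠ y′ → x +ᶠ y ≈ᶠ x′ +ᶠ y′
  +ᶠ-cong {a / b [ _ ]} {a′ / b′ [ _ ]} {c / d [ _ ]} {c′ / d′ [ _ ]} (cross e) (cross f) = cross (begin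
    (a * d + c * b) * (b′ * d′)
      ≈⟨ solve 6 (λ a b c d b′ d′ → (a :* d :+ c :* b) :* (b′ :* d′) :=
           (a :* b′) :* (d :* d′) :+ (c :* d′) :* (b :* b′)) refl a b c d b′ d′ ⟩
    (a * b′) * (d * d′) + (c * d′) * (b * b′)
      ≈⟨ +-cong (*-congʳ e) (*-congʳ f) ⟩
    (a′ * b) * (d * d′) + (c′ * d) * (b * b′)
      ≈⟨ solve 6 (λ a′ b c′ d b′ d′ → (a′ :* b) :* (d :* d′) :+ (c′ :* d) :* (b :* b′) :=
           (a′ :* d′ :+ c′ :* b′) :* (b :* d)) refl a′ b c′ d b′ d′ ⟩
    (a′ * d′ + c′ * b′) * (b * d) ∎)

  *ᶠ-cong : ∀ {x x′ y y′} → x ≈ᶠ x′ → y ≈ᶠ y′ → x *ᶠ y ≈ᶠ x′ *ᶠ y′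
  *ᶠ-cong {a / b [ _ ]} {a′ / b′ [ _ ]} {c / d [ _ ]} {c′ / d′ [ _ ]} (cross e) (cross f) = cross (begin
    (a * c) * (b′ * d′)   ≈⟨ solve 4 (λ a c b′ d′ → (a :* c) :* (b′ :* d′) := (a :* b′) :* (c :* d′)) refl a c b′ d′ ⟩
    (a * b′) * (c * d′)   ≈⟨ *-cong e f ⟩
    (a′ * b) * (c′ * d)   ≈⟨ solve 4 (λ a′ b c′ d → (a′ :* b) :* (c′ :* d) := (a′ :* c′) :* (b :* d)) refl a′ b c′ d ⟩
    (a′ * c′) * (b * d)   ∎)

  -ᶠ-cong : ∀ {x y} → x ≈ᶠ y → -ᶠ x ≈ᶠ -ᶠ y
  -ᶠ-cong {a / b [ _ ]} {c / d [ _ ]} (cross e) = cross (begin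
    - a * d     ≈⟨ -‿distribˡ-* a d ⟨
    - (a * d)   ≈⟨ -‿cong e ⟩
    - (c * b)   ≈⟨ -‿distribˡ-* c b ⟩
    - c * b     ∎)

  commutativeRing : CommutativeRing (c ⊔ ℓ) ℓ
  commutativeRing = record
    { Carrier = Fraction ; _≈_ = _≈ᶠ_
    ; _+_ = _+ᶠ_ ; _*_ = _*ᶠ_ ; -_ = -ᶠ_ ; 0# = 0ᶠ ; 1# = 1ᶠ
    ; isCommutativeRing = record
      { isRing = record
        { +-isAbelianGroup = record
          { isGroup = record
            { isMonoid = record
              { isSemigroup = record
                { isMagma = record
                  { isEquivalence = record { refl = ≈ᶠ-refl ; sym = ≈ᶠ-sym ; trans = ≈ᶠ-trans }
                  ; ∙-cong = +ᶠ-cong }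
                ; assoc = λ where
                    (a / a′ [ _ ]) (b / b′ [ _ ]) (c / c′ [ _ ]) → cross (solve 6
                      (λ a a′ b b′ c c′ →
                        ((a :* b′ :+ b :* a′) :* c′ :+ c :* (a′ :* b′)) :* (a′ :* (b′ :* c′)) :=
                        (a :* (b′ :* c′) :+ (b :* c′ :+ c :* b′) :* a′) :* (a′ :* b′ :* c′))
                      refl a a′ b b′ c c′) }
              ; identity = +ᶠ-identityˡ , λ x → ≈ᶠ-trans (+ᶠ-comm x 0ᶠ) (+ᶠ-identityˡ x) }
            ; inverse = (λ x → ≈ᶠ-trans (+ᶠ-comm (-ᶠ x) x) (+ᶠ-inverseʳ x)) , +ᶠ-inverseʳ
            ; ⁻¹-cong = -ᶠ-cong }
          ; comm = +ᶠ-comm }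
        ; *-cong = *ᶠ-cong
        ; *-assoc = λ x y z → cross
            (*-cong (*-assoc (num x) (num y) (num z)) (sym (*-assoc (den x) (den y) (den z))))
        ; *-identity = *ᶠ-identityˡ , λ x → ≈ᶠ-trans (*ᶠ-comm x 1ᶠ) (*ᶠ-identityˡ x)
        ; distrib = *ᶠ-distribˡ , λ x y z → ≈ᶠ-trans (*ᶠ-comm (y +ᶠ z) x)
            (≈ᶠ-trans (*ᶠ-distribˡ x y z) (+ᶠ-cong (*ᶠ-comm x y) (*ᶠ-comm x z))) }
      ; *-comm = *ᶠ-comm } }
    where
    +ᶠ-comm : ∀ x y → x +ᶠ y ≈ᶠ y +ᶠ x
    +ᶠ-comm x y = cross (*-cong (+-comm _ _) (*-comm (den y) (den x)))

    *ᶠ-comm : ∀ x y → x *ᶠ y ≈ᶠ y *ᶠ x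
    *ᶠ-comm x y = cross (*-cong (*-comm _ _) (*-comm (den y) (den x)))

    +ᶠ-identityˡ : ∀ x → 0ᶠ +ᶠ x ≈ᶠ x
    +ᶠ-identityˡ (a / b [ _ ]) = cross (begin
      (0# * b + a * 1#) * b   ≈⟨ *-congʳ (trans (+-cong (zeroˡ b) (*-identityʳ a)) (+-identityˡ a)) ⟩
      a * b                   ≈⟨ *-congˡ (*-identityˡ b) ⟨
      a * (1# * b)            ∎)

    *ᶠ-identityˡ : ∀ x → 1ᶠ *ᶠ x ≈ᶠ x
    *ᶠ-identityˡ (a / b [ _ ]) = cross (*-cong (*-identityˡ a) (sym (*-identityˡ b)))

    +ᶠ-inverseʳ : ∀ x → x +ᶠ -ᶠ x ≈ᶠ 0ᶠ
    +ᶠ-inverseʳ (a / b [ _ ]) = cross (begin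
      (a * b + - a * b) * 1#   ≈⟨ *-identityʳ _ ⟩
      a * b + - a * b          ≈⟨ distribʳ b a (- a) ⟨
      (a - a) * b              ≈⟨ *-congʳ (-‿inverseʳ a) ⟩
      0# * b                   ≈⟨ zeroˡ b ⟩
      0#                       ≈⟨ zeroˡ (b * b) ⟨
      0# * (b * b)             ∎)

    *ᶠ-distribˡ : ∀ x y z → x *ᶠ (y +ᶠ z) ≈ᶠ x *ᶠ y +ᶠ x *ᶠ z
    *ᶠ-distribˡ (a / a′ [ _ ]) (b / b′ [ _ ]) (c / c′ [ _ ]) = cross (solve 6
      (λ a a′ b b′ c c′ →
        (a :* (b :* c′ :+ c :* b′)) :* ((a′ :* b′) :* (a′ :* c′)) :=
        ((a :* b) :* (a′ :* c′) :+ (a :* c) :* (a′ :* b′)) :* (a′ :* (b′ :* c′)))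
      refl a a′ b b′ c c′)

  fromDomain-isRingHomomorphism : RingMorphisms.IsRingHomomorphism
    (CommutativeRing.rawRing D) (CommutativeRing.rawRing commutativeRing) fromDomain
  fromDomain-isRingHomomorphism = record
    { isSemiringHomomorphism = record
      { isNearSemiringHomomorphism = record
        { +-isMonoidHomomorphism = record
          { isMagmaHomomorphism = record
            { isRelHomomorphism = record { cong = λ a≈b → cross (*-congʳ a≈b) }
            ; homo = λ a b → cross (*-cong
                (sym (+-cong (*-identityʳ a) (*-identityʳ b))) (*-identityˡ 1#)) }
          ; ε-homo = ≈ᶠ-refl }
        ; *-homo = λ a b → cross (*-congˡ (*-identityˡ 1#)) }
      ; 1#-homo = ≈ᶠ-refl }
    ; -‿homo = λ a → ≈ᶠ-refl }

  fromDomain-injective : ∀ {a b} → fromDomain a ≈ᶠ fromDomain b → a ≈ b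
  fromDomain-injective {a} {b} (cross e) =
    trans (sym (*-identityʳ a)) (trans e (*-identityʳ b))

  private
    module F = CommutativeRing commutativeRing

    ≈ᶠ-decSetoid : DecSetoid (c ⊔ ℓ) ℓ
    ≈ᶠ-decSetoid = record
      { isDecEquivalence = record
        { isEquivalence = F.isEquivalence
        ; _≟_ = λ x y → map′ cross cross-≈ ((num x * den y) ≟ (num y * den x)) } }

    open DecSetoidProperties ≈ᶠ-decSetoid using (≉-isApartnessRelation; ≉-tight)
    open RingProperties F.ring using ()
      renaming (x∙y⁻¹≈ε⇒x≈y to x-y≈0⇒x≈y; x≈y⇒x∙y⁻¹≈ε to x≈y⇒x-y≈0)

    num≉0 : ∀ {x} → ¬ x ≈ᶠ 0ᶠ → ¬ num x ≈ 0#
    num≉0 {x} x≉0 num≈0 = x≉0 (cross (begin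
      num x * 1#   ≈⟨ *-identityʳ _ ⟩
      num x        ≈⟨ num≈0 ⟩
      0#           ≈⟨ zeroˡ (den x) ⟨
      0# * den x   ∎))

    1ᶠ≉0ᶠ : ¬ 1ᶠ ≈ᶠ 0ᶠ
    1ᶠ≉0ᶠ (cross e) = 1≉0 (trans (sym (*-identityʳ 1#)) (trans e (zeroˡ 1#)))

    inverseˡ : ∀ x (x≉0 : ¬ x ≈ᶠ 0ᶠ) → (den x / num x [ num≉0 x≉0 ]) *ᶠ x ≈ᶠ 1ᶠ
    inverseˡ (a / b [ _ ]) _ = cross
      (trans (*-identityʳ _) (trans (*-comm b a) (sym (*-identityˡ _))))

  heytingField : HeytingField (c ⊔ ℓ) ℓ ℓ
  heytingField = record
    { _#_ = λ x y → ¬ x ≈ᶠ y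
    ; isHeytingField = record
      { isHeytingCommutativeRing = record
        { isCommutativeRing = F.isCommutativeRing
        ; isApartnessRelation = ≉-isApartnessRelation
        ; #⇒invertible = λ {x} {y} x≉y →
            let d   = x F.- y
                d≉0 = λ d≈0 → x≉y (x-y≈0⇒x≈y x y d≈0)
                d⁻¹ = den d / num d [ num≉0 d≉0 ]
            in d⁻¹ , inverseˡ d d≉0 , F.trans (F.*-comm d d⁻¹) (inverseˡ d d≉0)
        ; invertible⇒# = λ {x} {y} (z , zd≈1 , _) x≈y → 1ᶠ≉0ᶠ
            (F.trans (F.sym zd≈1) (F.trans
              (F.*-congˡ {z} {x F.- y} {0ᶠ} (x≈y⇒x-y≈0 {x} {y} x≈y)) (F.zeroʳ z))) }
      ; tight = ≉-tight } }

module FieldDefs {c ℓ₁ ℓ₂} (K : HeytingField c ℓ₁ ℓ₂) where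

  open HeytingField K hiding (zero)
  open HeytingProperties heytingCommutativeRing public using (x#0y#0→xy#0; 1#0; #-congʳ; x-0≈x)

  commutativeRing : CommutativeRing c ℓ₁
  commutativeRing = HeytingCommutativeRing.commutativeRing heytingCommutativeRing

  open RawSemiringDefs (Semiring.rawSemiring (CommutativeRing.semiring commutativeRing)) public
    using (_^_; sum; product) renaming (_×_ to _×#_)

  fromℕ : ℕ → Carrier
  fromℕ n = n ×# 1#

  ∑< ∏< : ℕ → (ℕ → Carrier) → Carrier
  ∑< n f = sum     {n} λ i → f (toℕ i)
  ∏< n f = product {n} λ i → f (toℕ i)

  infixl 6 ∑<
  infixl 7 ∏<
  syntax ∑< n (λ i → x) = ∑[ i < n ] x
  syntax ∏< n (λ i → x) = ∏[ i < n ] x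

  ∏-#0 : ∀ n (f : ℕ → Carrier) → (∀ i → f i # 0#) → ∏< n f # 0#
  ∏-#0 zero    f f#0 = 1#0
  ∏-#0 (suc n) f f#0 = x#0y#0→xy#0 (f#0 0) (∏-#0 n (λ i → f (suc i)) (λ i → f#0 (suc i)))

  infixl 7 _/_[_]
  _/_[_] : (x y : Carrier) → y # 0# → Carrier
  x / y [ y#0 ] = x * proj₁ (#⇒invertible y#0)

  pochhammer : Carrier → ℕ → Carrier
  pochhammer γ m = ∏[ i < m ] (γ + fromℕ i)

  -- x ∉ {-1, -2, …}, with the apartness of the field as inequality.
  NotNegativeInteger : Carrier → Set ℓ₂
  NotNegativeInteger x = ∀ k → x # - fromℕ (suc k)

  pochhammer-#0 : ∀ {x} → NotNegativeInteger x → ∀ m → pochhammer (x + 1#) m # 0#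
  pochhammer-#0 {x} x∉ m = ∏-#0 m _ x+1+i#0
    where
    open RingProperties (CommutativeRing.ring commutativeRing) using (-‿involutive)

    x+1+i#0 : ∀ i → x + 1# + fromℕ i # 0#
    x+1+i#0 i with #⇒invertible (x∉ i)
    ... | u , u*e≈1 , e*u≈1 = invertible⇒#
      (u , trans (*-congˡ eq) u*e≈1 , trans (*-congʳ eq) e*u≈1)
      where
      eq : x + 1# + fromℕ i - 0# ≈ x - (- fromℕ (suc i))
      eq = trans (x-0≈x _) (trans (+-assoc x 1# _) (+-congˡ (sym (-‿involutive _))))

  Matrix : ℕ → Set c
  Matrix n = Fin n → Fin n → Carrier

  -- Laplace expansion along the first row.
  det : ∀ {n} → Matrix n → Carrier
  det {zero}  M = 1#
  det {suc n} M = sum λ j →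
    (- 1#) ^ toℕ j * (M zero j * det λ i k → M (suc i) (punchIn j k))

  -- Formal power series in x, given by their coefficients.
  Series : Set c
  Series = ℕ → Carrier

  infixl 7 _⊛_
  _⊛_ : Series → Series → Series
  (f ⊛ g) n = ∑[ i < suc n ] f i * g (n ∸ i)

  1+x : Series
  1+x 0             = 1#
  1+x 1             = 1#
  1+x (suc (suc _)) = 0#

  -- g(x) ↦ g(x²)
  atSquare : Series → Series
  atSquare g 0             = g 0
  atSquare g 1             = 0#
  atSquare g (suc (suc n)) = atSquare (λ k → g (suc k)) n

  -- The numbers a_m of an expansion ∑ a_m x^m / m!.
  egfCoefficient : Series → ℕ → Carrier
  egfCoefficient f m = fromℕ (m !) * f m

  Ḧ : ℕ → Series → Carrier
  Ḧ n f = det {n} λ i j → egfCoefficient f (2 ℕ.* toℕ i ℕ.+ toℕ j)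

-- A field over ℚ (hence of characteristic 0) with a chosen element, e.g. a
-- complex number ν; the generic point is the variable ν of ℚ(ν).
record Point {c ℓ₁ ℓ₂} (K : HeytingField c ℓ₁ ℓ₂) : Set (c ⊔ ℓ₁) where
  open HeytingField K using (Carrier)
  open RingMorphisms
    (CommutativeRing.rawRing ℚₚ.+-*-commutativeRing)
    (CommutativeRing.rawRing (FieldDefs.commutativeRing K))
    using (IsRingHomomorphism)
  field
    ι                    : ℚ → Carrier
    ι-isRingHomomorphism : IsRingHomomorphism ι
    ν                    : Carrier

module Bessel {c ℓ₁ ℓ₂} (K : HeytingField c ℓ₁ ℓ₂) (p : Point K)
              (ν∉ : FieldDefs.NotNegativeInteger K (Point.ν p)) where

  open HeytingField K
  open FieldDefs K
  open Point p

  -- ∑ (-1)^k / (4^k k! (ν+1)_k) x^{2k}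
  cosb : Series
  cosb = atSquare λ k →
    ι (((ℤ.-1ℤ ℤ.^ k) ℚ./ (4 ℕ.^ k ℕ.* k !)) {{nonZero k}})
      / pochhammer (ν + 1#) k [ pochhammer-#0 ν∉ k ]
    where
    nonZero : ∀ k → ℕ.NonZero (4 ℕ.^ k ℕ.* k !)
    nonZero k = ℕₚ.m*n≢0 _ _ {{ℕₚ.m^n≢0 4 k}} {{k ℕₚ.!≢0}}

  f : Series
  f = 1+x ⊛ (cosb ⊛ cosb)

module ClosedForm {c ℓ₁ ℓ₂} (K : HeytingField c ℓ₁ ℓ₂) (p : Point K)
  (ν∉  : FieldDefs.NotNegativeInteger K (Point.ν p))
  (2ν∉ : FieldDefs.NotNegativeInteger K
           (HeytingField._*_ K (FieldDefs.fromℕ K 2) (Point.ν p)))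
  where

  open HeytingField K
  open FieldDefs K
  open Point p

  2ν : Carrier
  2ν = fromℕ 2 * ν

  closedForm : ℕ → Carrier
  closedForm N =
      (- 1#) ^ N
    * fromℕ (2 ℕ.^ ((2 ℕ.* N) C 2))
    * (∏[ i < 2 ℕ.* N ] fromℕ ((2 ℕ.* i) !))
    * (∏[ k < N ] (pochhammer (ι ½) k * pochhammer (ν + ι ½) k ^ 2 * pochhammer (2ν + ι ½) k))
    * (∏[ i < 2 ℕ.* N ]
        (pochhammer (ν + ι ½) i
          / (pochhammer (ν + 1#) (N ∸ 1 ℕ.+ i) * pochhammer (2ν + 1#) (N ∸ 1 ℕ.+ i))
            [ x#0y#0→xy#0 (pochhammer-#0 ν∉ (N ∸ 1 ℕ.+ i)) (pochhammer-#0 2ν∉ (N ∸ 1 ℕ.+ i)) ]))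

-- Discharges the hypotheses of ClosedForm for the variable of ℚ(ν).
module NonRationalPoint {c ℓ₁ ℓ₂} (K : HeytingField c ℓ₁ ℓ₂) (p : Point K)
  (ν≉ι : ∀ a → ¬ HeytingField._≈_ K (Point.ν p) (Point.ι p a))
  where

  open HeytingField K
  open FieldDefs K
  open Point p
  open RingMorphisms.IsRingHomomorphism ι-isRingHomomorphism
    using (+-homo; *-homo; 0#-homo; 1#-homo; -‿homo; ⟦⟧-cong)

  private
    natural : ℕ → ℚ
    natural n = RawSemiringDefs._×_
      (Semiring.rawSemiring (CommutativeRing.semiring ℚₚ.+-*-commutativeRing)) n ℚ.1ℚ

    open SetoidReasoning (CommutativeRing.setoid commutativeRing)

  fromℕ≈ι : ∀ n → fromℕ n ≈ ι (natural n)
  fromℕ≈ι zero    = sym 0#-homo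
  fromℕ≈ι (suc n) = begin
    1# + fromℕ n              ≈⟨ +-cong (sym 1#-homo) (fromℕ≈ι n) ⟩
    ι ℚ.1ℚ + ι (natural n)    ≈⟨ +-homo ℚ.1ℚ (natural n) ⟨
    ι (natural (suc n))       ∎

  -fromℕ≈ι : ∀ n → - fromℕ n ≈ ι (ℚ.- natural n)
  -fromℕ≈ι n = trans (-‿cong (fromℕ≈ι n)) (sym (-‿homo (natural n)))

  ν≉-fromℕ : ∀ n → ¬ ν ≈ - fromℕ n
  ν≉-fromℕ n ν≈ = ν≉ι (ℚ.- natural n) (trans ν≈ (-fromℕ≈ι n))

  2ν≉-fromℕ : ∀ n → ¬ fromℕ 2 * ν ≈ - fromℕ n
  2ν≉-fromℕ n 2ν≈ = ν≉ι (½ ℚ.* ℚ.- natural n) (begin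
    ν                             ≈⟨ *-identityˡ ν ⟨
    1# * ν                        ≈⟨ *-congʳ 1#-homo ⟨
    ι (½ ℚ.* natural 2) * ν       ≈⟨ *-congʳ (*-homo ½ (natural 2)) ⟩
    ι ½ * ι (natural 2) * ν       ≈⟨ *-congʳ (*-congˡ (fromℕ≈ι 2)) ⟨
    ι ½ * fromℕ 2 * ν             ≈⟨ *-assoc (ι ½) (fromℕ 2) ν ⟩
    ι ½ * (fromℕ 2 * ν)           ≈⟨ *-congˡ (trans 2ν≈ (-fromℕ≈ι n)) ⟩
    ι ½ * ι (ℚ.- natural n)       ≈⟨ *-homo ½ (ℚ.- natural n) ⟨
    ι (½ ℚ.* ℚ.- natural n)       ∎)

module ℚ[ν] = Polynomials ℚₚ.+-*-commutativeRing

ℚ-noZeroDivisors : ∀ a b → a ℚ.* b ≡ ℚ.0ℚ → a ≡ ℚ.0ℚ ⊎ b ≡ ℚ.0ℚ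
ℚ-noZeroDivisors a b ab≡0 with a ℚₚ.≟ ℚ.0ℚ
... | yes a≡0 = inj₁ a≡0
... | no  a≢0 = inj₂ (begin
  b                         ≡⟨ ℚₚ.*-identityˡ b ⟨
  ℚ.1ℚ ℚ.* b                ≡⟨ ≡.cong (ℚ._* b) (ℚₚ.*-inverseˡ a) ⟨
  ℚ.1/ a ℚ.* a ℚ.* b        ≡⟨ ℚₚ.*-assoc (ℚ.1/ a) a b ⟩
  ℚ.1/ a ℚ.* (a ℚ.* b)      ≡⟨ ≡.cong (ℚ.1/ a ℚ.*_) ab≡0 ⟩
  ℚ.1/ a ℚ.* ℚ.0ℚ           ≡⟨ ℚₚ.*-zeroʳ (ℚ.1/ a) ⟩
  ℚ.0ℚ                      ∎)
  where
  open ≡.≡-Reasoning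
  instance _ = ℚ.≢-nonZero a≢0

1ₚ≉0ₚ : ¬ ℚ[ν].1ₚ ℚ[ν].≈ₚ ℚ[ν].0ₚ
1ₚ≉0ₚ e with ℚ[ν].coeff-≈ e 0
... | ()

module ℚ⟨ν⟩ = Fractions ℚ[ν].commutativeRing (ℚ[ν].≈ₚ-dec ℚₚ._≟_) 1ₚ≉0ₚ
                        (ℚ[ν].*ₚ-noZeroDivisors ℚₚ._≟_ ℚ-noZeroDivisors)

ℚ⟨ν⟩-field : HeytingField 0ℓ 0ℓ 0ℓ
ℚ⟨ν⟩-field = ℚ⟨ν⟩.heytingField

module GenericPoint where

  ι : ℚ → ℚ⟨ν⟩.Fraction
  ι a = ℚ⟨ν⟩.fromDomain (ℚ[ν].constant a)

  ν : ℚ⟨ν⟩.Fraction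
  ν = ℚ⟨ν⟩.fromDomain ℚ[ν].X

  point : Point ℚ⟨ν⟩-field
  point = record
    { ι = ι
    ; ι-isRingHomomorphism = isRingHomomorphism ℚ⟨ν⟩.≈ᶠ-trans
        ℚ[ν].constant-isRingHomomorphism ℚ⟨ν⟩.fromDomain-isRingHomomorphism
    ; ν = ν
    }

  ν≉ι : ∀ a → ¬ ν ℚ⟨ν⟩.≈ᶠ ι a
  ν≉ι a e = ℚ[ν].X≉constant (λ ()) a (ℚ⟨ν⟩.fromDomain-injective e)

  open NonRationalPoint ℚ⟨ν⟩-field point ν≉ι

  ν∉ : FieldDefs.NotNegativeInteger ℚ⟨ν⟩-field ν
  ν∉ k = ν≉-fromℕ (suc k)

  2ν∉ : FieldDefs.NotNegativeInteger ℚ⟨ν⟩-field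
          (FieldDefs.fromℕ ℚ⟨ν⟩-field 2 ℚ⟨ν⟩.*ᶠ ν)
  2ν∉ k = 2ν≉-fromℕ (suc k)

  open Bessel ℚ⟨ν⟩-field point ν∉ public using (f)
  open ClosedForm ℚ⟨ν⟩-field point ν∉ 2ν∉ public using (closedForm)

module Specialisation {c ℓ₁ ℓ₂} (K : HeytingField c ℓ₁ ℓ₂) (p : Point K) where

  open HeytingField K
  open Point p

  evaluate : ℚ[ν].Poly → Carrier
  evaluate []      = 0#
  evaluate (a ∷ q) = ι a + ν * evaluate q

  -- Regularity is witnessed by some representation of the rational function
  -- as a quotient of polynomials, not necessarily the given one.
  record RegularAt (F : ℚ⟨ν⟩.Fraction) : Set ℓ₂ where
    field
      representative : ℚ⟨ν⟩.Fraction
      represents     : F ℚ⟨ν⟩.≈ᶠ representative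
      den#0          : evaluate (ℚ⟨ν⟩.den representative) # 0#

  valueAt : ∀ {F} → RegularAt F → Carrier
  valueAt r = evaluate (num representative) / evaluate (den representative) [ den#0 ]
    where
    open RegularAt r
    open ℚ⟨ν⟩ using (num; den)
    open FieldDefs K using (_/_[_])

{-# OPTIONS --safe #-}

-- Put a = 1/2, b = ν + 1/2, c = ν + 1, d = 2ν + 1.  The differential equation of cosb yields a
-- third order one for cosb², hence u_k := a_{2k} satisfies (c + k) (d + k) u_{k+1} =
-- -4 (a + k) (b + k) u_k, and a_{2k+1} = (2k + 1) u_k.  Up to factors depending only on the row i
-- or only on the column, the columns 2l and 2l + 1 of the matrix are therefore the values at t = i
-- of Q_l and (2t + 2l + 1) Q_l, where
-- Q_l = (t + a)_l (t + b)_l (t + c + l)_{N-1-l} (t + d + l)_{N-1-l}.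
-- The quotient Q_l : Q_{l+1} is one of quadratics whose resultant
-- (c - a) (c - b) (d - a) (d - b) does not depend on l, so column operations replace all pairs
-- (Q_l, t Q_l) but the last by those for N - 1 and (c + 1, d + 1); the last pair consists of monic
-- polynomials of degrees 2N - 2 and 2N - 1, above all others, and is removed by taking differences
-- along the rows.  Regularity holds because the entries only involve inverses of (ν + 1)_k, and
-- taking values at a point commutes with the formation of the determinant.

module Submission where

open import Defs
open import Algebra.Apartness.Bundles using (HeytingField)
import Algebra.Apartness.Properties.HeytingCommutativeRing as HeytingProperties
open import Algebra.Bundles using (CommutativeRing; Semiring)
import Algebra.Definitions.RawSemiring as RawSemiringDefs
open import Algebra.Morphism.Structures using (module RingMorphisms)
import Algebra.Properties.Ring as RingProperties
import Algebra.Properties.Semiring.Exp as SemiringExp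
import Algebra.Properties.Semiring.Mult as SemiringMult
import Algebra.Properties.Semiring.Mult.TCOptimised as OptimisedMult
import Algebra.Properties.Semiring.Sum as SemiringSum
import Algebra.Solver.Ring as RingSolver
open import Algebra.Solver.Ring.AlmostCommutativeRing
  using (fromCommutativeRing; _-Raw-AlmostCommutative⟶_)
open import Data.Fin.Base as Fin using (Fin; zero; suc; toℕ; punchIn)
import Data.Fin.Permutation as Permutation
import Data.Fin.Properties as Finₚ
open import Data.Integer.Base as ℤ using (ℤ; +_; -[1+_]; _⊖_)
import Data.Integer.Properties as ℤₚ
open import Data.List.Base using (List; []; _∷_; _++_; length; map; tabulate)
import Data.List.Properties as Listₚ
open import Data.List.Relation.Unary.All using (All; []; _∷_)
import Data.List.Relation.Unary.All.Properties as Allₚ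
open import Data.Maybe.Base using (Maybe; just; nothing)
open import Data.Nat.Base as ℕ using (ℕ; zero; suc; z≤n; s≤s; _∸_; _!)
open import Data.Nat.Combinatorics using (_C_; nC1≡n; nCk+nC[k+1]≡[n+1]C[k+1])
import Data.Nat.Properties as ℕₚ
open import Data.Nat.Solver using (module +-*-Solver)
open import Data.Product.Base using (∃; _,_; proj₁; proj₂)
open import Data.Rational.Base as ℚ using (ℚ; ½)
import Data.Rational.Properties as ℚₚ
open import Data.Rational.Unnormalised.Base as ℚᵘ using (mkℚᵘ; *≡*)
import Data.Rational.Unnormalised.Properties as ℚᵘₚ
open import Data.Sum.Base using (_⊎_; inj₁; inj₂)
open import Function.Base using (_∘_)
open import Level using (_⊔_) renaming (suc to lsuc)
open import Relation.Binary.PropositionalEquality as ≡ using (_≡_)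
import Relation.Binary.Reasoning.Setoid as SetoidReasoning
open import Relation.Nullary.Decidable using (yes; no)

-- The polynomial Q_l arises from u_k = (-4)^k (a)_k (b)_k / ((c)_k (d)_k) by clearing in row i the
-- denominator (c)_(N-1+i) (d)_(N-1+i) common to u_i, ..., u_(i+N-1). This brings (2ν + 1)_(N-1+i)
-- into the closed form and is the main obstacle: the factor has no inverse at certain ν where 2ν is
-- a negative integer, although u_k is defined unless ν itself is one. The determinant is therefore
-- evaluated over fields in which both ν and 2ν avoid the negative integers, and this is applied to
-- the variable of ℚ(ν). The points of other fields are reached by comparing values of rational
-- functions. Taking values is only a partial map on ℚ(ν), so it is treated as a relation compatible
-- with the field operations. The resultant enters as a determinant: modulo columns h and t h, where
-- h / g is a monic quadratic in t, the columns f and t f arise from g and t g by multiplication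
-- with a linear remainder e₁ t + e₀, and the determinant of this multiplication modulo the
-- quadratic is the resultant. To make column operations easy, a determinant is a function of a list
-- of sequences, built by contraction with one row after another.

open +-*-Solver using () renaming
  (solve to solveℕ; con to conℕ; _:+_ to _+ℕ_; _:*_ to _*ℕ_; _:=_ to _=ℕ_)

-- Ring identities with integer coefficients

module IntegerCoefficients {c ℓ} (R : CommutativeRing c ℓ) where

  open CommutativeRing R
  open RingProperties ring
  open OptimisedMult semiring using (_×_; 1+×; ×-homo-+; ×1-homo-*)
  open SetoidReasoning setoid

  -- The optimised multiples make `con (+ 1)` and `con -[1+ 0 ]` denote `1#` and `- 1#`
  -- definitionally, so that solved equations match goals containing these constants.
  fromℤ : ℤ → Carrier
  fromℤ (+ n)    = n × 1#
  fromℤ -[1+ n ] = - (suc n × 1#)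

  private
    cancel-1# : ∀ x y → (1# + x) - (1# + y) ≈ x - y
    cancel-1# x y = begin
      (1# + x) - (1# + y)      ≈⟨ +-cong (+-comm 1# x) (sym (-‿+-comm 1# y)) ⟩
      (x + 1#) + (- 1# + - y)  ≈⟨ +-assoc x 1# _ ⟩
      x + (1# + (- 1# + - y))  ≈⟨ +-congˡ (+-assoc 1# (- 1#) (- y)) ⟨
      x + ((1# - 1#) + - y)    ≈⟨ +-congˡ (+-congʳ (-‿inverseʳ 1#)) ⟩
      x + (0# + - y)           ≈⟨ +-congˡ (+-identityˡ (- y)) ⟩
      x - y                    ∎

    fromℤ-⊖ : ∀ m n → fromℤ (m ⊖ n) ≈ m × 1# - n × 1#
    fromℤ-⊖ zero    zero    = sym (-‿inverseʳ 0#)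
    fromℤ-⊖ zero    (suc n) = sym (+-identityˡ _)
    fromℤ-⊖ (suc m) zero    = sym (trans (+-congˡ -0#≈0#) (+-identityʳ _))
    fromℤ-⊖ (suc m) (suc n) = begin
      fromℤ (suc m ⊖ suc n)      ≡⟨ ≡.cong fromℤ (ℤₚ.[1+m]⊖[1+n]≡m⊖n m n) ⟩
      fromℤ (m ⊖ n)              ≈⟨ fromℤ-⊖ m n ⟩
      m × 1# - n × 1#            ≈⟨ cancel-1# _ _ ⟨
      (1# + m × 1#) - (1# + n × 1#)
        ≈⟨ +-cong (1+× m 1#) (-‿cong (1+× n 1#)) ⟨
      suc m × 1# - suc n × 1#    ∎

    fromℤ-neg : ∀ i → fromℤ (ℤ.- i) ≈ - fromℤ i
    fromℤ-neg (+ zero)  = sym -0#≈0#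
    fromℤ-neg (+ suc n) = refl
    fromℤ-neg -[1+ n ]  = sym (-‿involutive _)

    fromℤ-+ : ∀ i j → fromℤ (i ℤ.+ j) ≈ fromℤ i + fromℤ j
    fromℤ-+ (+ m)    (+ n)    = ×-homo-+ 1# m n
    fromℤ-+ (+ m)    -[1+ n ] = fromℤ-⊖ m (suc n)
    fromℤ-+ -[1+ m ] (+ n)    = trans (fromℤ-⊖ n (suc m)) (+-comm _ _)
    fromℤ-+ -[1+ m ] -[1+ n ] = begin
      - (suc (suc (m ℕ.+ n)) × 1#)       ≡⟨ ≡.cong (λ k → - (suc k × 1#)) (ℕₚ.+-suc m n) ⟨
      - ((suc m ℕ.+ suc n) × 1#)         ≈⟨ -‿cong (×-homo-+ 1# (suc m) (suc n)) ⟩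
      - (suc m × 1# + suc n × 1#)        ≈⟨ -‿+-comm _ _ ⟨
      - (suc m × 1#) + - (suc n × 1#)    ∎

    fromℤ-neg◃ : ∀ m n → fromℤ (ℤ.- (+ (m ℕ.* n))) ≈ - (m × 1# * (n × 1#))
    fromℤ-neg◃ m n = trans (fromℤ-neg (+ (m ℕ.* n))) (-‿cong (×1-homo-* m n))

    fromℤ-* : ∀ i j → fromℤ (i ℤ.* j) ≈ fromℤ i * fromℤ j
    fromℤ-* (+ m) (+ n) = begin
      fromℤ (+ m ℤ.* + n)    ≡⟨ ≡.cong fromℤ (ℤₚ.pos-* m n) ⟨
      (m ℕ.* n) × 1#         ≈⟨ ×1-homo-* m n ⟩
      m × 1# * (n × 1#)      ∎
    fromℤ-* (+ m) -[1+ n ] = begin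
      fromℤ (+ m ℤ.* -[1+ n ])         ≡⟨ ≡.cong fromℤ (ℤₚ.-◃n≡-n (m ℕ.* suc n)) ⟩
      fromℤ (ℤ.- (+ (m ℕ.* suc n)))    ≈⟨ fromℤ-neg◃ m (suc n) ⟩
      - (m × 1# * (suc n × 1#))        ≈⟨ -‿distribʳ-* _ _ ⟩
      m × 1# * - (suc n × 1#)          ∎
    fromℤ-* -[1+ m ] (+ n) = begin
      fromℤ (-[1+ m ] ℤ.* + n)         ≡⟨ ≡.cong fromℤ (ℤₚ.-◃n≡-n (suc m ℕ.* n)) ⟩
      fromℤ (ℤ.- (+ (suc m ℕ.* n)))    ≈⟨ fromℤ-neg◃ (suc m) n ⟩
      - (suc m × 1# * (n × 1#))        ≈⟨ -‿distribˡ-* _ _ ⟩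
      - (suc m × 1#) * (n × 1#)        ∎
    fromℤ-* -[1+ m ] -[1+ n ] = begin
      (suc m ℕ.* suc n) × 1#               ≈⟨ ×1-homo-* (suc m) (suc n) ⟩
      suc m × 1# * (suc n × 1#)            ≈⟨ -‿involutive _ ⟨
      - - (suc m × 1# * (suc n × 1#))      ≈⟨ -‿cong (-‿distribʳ-* _ _) ⟩
      - (suc m × 1# * - (suc n × 1#))      ≈⟨ -‿distribˡ-* _ _ ⟩
      - (suc m × 1#) * - (suc n × 1#)      ∎

    fromℤ-homomorphism : ℤ.+-*-rawRing -Raw-AlmostCommutative⟶ fromCommutativeRing R
    fromℤ-homomorphism = record
      { ⟦_⟧    = fromℤ
      ; +-homo = fromℤ-+
      ; *-homo = fromℤ-*
      ; -‿homo = fromℤ-neg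
      ; 0-homo = refl
      ; 1-homo = refl
      }

    fromℤ-≟ : ∀ i j → Maybe (fromℤ i ≈ fromℤ j)
    fromℤ-≟ i j with i ℤₚ.≟ j
    ... | yes i≡j = just (reflexive (≡.cong fromℤ i≡j))
    ... | no  _   = nothing

  open RingSolver ℤ.+-*-rawRing (fromCommutativeRing R) fromℤ-homomorphism fromℤ-≟
    public using (Polynomial; solve; con; _:+_; _:*_; _:-_; :-_; _:=_)

-- Alternating forms on lists of sequences

module Forms {c ℓ} (R : CommutativeRing c ℓ) where

  open CommutativeRing R hiding (zero)
  open RingProperties ring using (-0#≈0#)
  open IntegerCoefficients R
  open RawSemiringDefs (Semiring.rawSemiring semiring) using (_^_)
  open SetoidReasoning setoid

  Sequence : Set c
  Sequence = ℕ → Carrier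

  -- A determinant as a function of the list of its columns. A column is an infinite sequence and a
  -- row is a point of evaluation, so column operations become pointwise equations without finite
  -- indices.
  Form : Set c
  Form = List Sequence → Carrier

  infixr 5 _◁_
  _◁_ : Sequence → Form → Form
  (f ◁ X) fs = X (f ∷ fs)

  -- Expansion of a determinant along a row, whose entries are the values of φ on the columns.
  contract : (Sequence → Carrier) → Form → Form
  contract φ X []       = 0#
  contract φ X (f ∷ fs) = φ f * X fs - contract φ (f ◁ X) fs

  contract-linear : ∀ φ {a b X Y Z} → (∀ fs → X fs ≈ a * Y fs + b * Z fs) →
                    ∀ fs → contract φ X fs ≈ a * contract φ Y fs + b * contract φ Z fs
  contract-linear φ {a} {b} X≈ [] =
    solve 2 (λ a b → con (+ 0) := a :* con (+ 0) :+ b :* con (+ 0)) refl a b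
  contract-linear φ {a} {b} {X} {Y} {Z} X≈ (f ∷ fs) = begin
    φ f * X fs - contract φ (f ◁ X) fs
      ≈⟨ +-cong (*-congˡ (X≈ fs)) (-‿cong (contract-linear φ (X≈ ∘ (f ∷_)) fs)) ⟩
    φ f * (a * Y fs + b * Z fs) - (a * contract φ (f ◁ Y) fs + b * contract φ (f ◁ Z) fs)
      ≈⟨ solve 7 (λ p a b y z y′ z′ → p :* (a :* y :+ b :* z) :- (a :* y′ :+ b :* z′) :=
           a :* (p :* y :- y′) :+ b :* (p :* z :- z′)) refl (φ f) a b _ _ _ _ ⟩
    a * contract φ Y (f ∷ fs) + b * contract φ Z (f ∷ fs) ∎

  contract-cong : ∀ φ {X Y} → (∀ fs → X fs ≈ Y fs) → ∀ fs → contract φ X fs ≈ contract φ Y fs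
  contract-cong φ X≈Y []       = refl
  contract-cong φ X≈Y (f ∷ fs) =
    +-cong (*-congˡ (X≈Y fs)) (-‿cong (contract-cong φ (X≈Y ∘ (f ∷_)) fs))

  contract-zero : ∀ φ {X} → (∀ fs → X fs ≈ 0#) → ∀ fs → contract φ X fs ≈ 0#
  contract-zero φ X≈0 []       = refl
  contract-zero φ {X} X≈0 (f ∷ fs) = begin
    φ f * X fs - contract φ (f ◁ X) fs
      ≈⟨ +-cong (*-congˡ (X≈0 fs)) (-‿cong (contract-zero φ (X≈0 ∘ (f ∷_)) fs)) ⟩
    φ f * 0# - 0#    ≈⟨ solve 1 (λ p → p :* con (+ 0) :- con (+ 0) := con (+ 0)) refl (φ f) ⟩
    0#               ∎

  contract-- : ∀ {φ ψ χ} → (∀ f → φ f ≈ ψ f - χ f) → ∀ X fs →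
               contract φ X fs ≈ contract ψ X fs - contract χ X fs
  contract-- φ≈ X []       = sym (-‿inverseʳ 0#)
  contract-- {φ} {ψ} {χ} φ≈ X (f ∷ fs) = begin
    φ f * X fs - contract φ (f ◁ X) fs
      ≈⟨ +-cong (*-congʳ (φ≈ f)) (-‿cong (contract-- φ≈ (f ◁ X) fs)) ⟩
    (ψ f - χ f) * X fs - (contract ψ (f ◁ X) fs - contract χ (f ◁ X) fs)
      ≈⟨ solve 5 (λ p q x y z → (p :- q) :* x :- (y :- z) := (p :* x :- y) :- (q :* x :- z))
           refl _ _ _ _ _ ⟩
    contract ψ X (f ∷ fs) - contract χ X (f ∷ fs) ∎

  -- The column f is consumed by the outer contraction, by the inner one, or by neither; the last
  -- term is where the inductions below continue.
  contract-contract-∷ : ∀ φ ψ X f fs → contract φ (contract ψ X) (f ∷ fs) ≈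
    φ f * contract ψ X fs - (ψ f * contract φ X fs - contract φ (contract ψ (f ◁ X)) fs)
  contract-contract-∷ φ ψ X f fs = +-congˡ (-‿cong (begin
    contract φ (f ◁ contract ψ X) fs
      ≈⟨ contract-linear φ (λ gs → +-congˡ (minus _)) fs ⟩
    ψ f * contract φ X fs + - 1# * contract φ (contract ψ (f ◁ X)) fs
      ≈⟨ +-congˡ (minus _) ⟨
    ψ f * contract φ X fs - contract φ (contract ψ (f ◁ X)) fs ∎))
    where
    minus : ∀ x → - x ≈ - 1# * x
    minus x = sym (RingProperties.-1*x≈-x ring x)

  -- A determinant with two equal rows: the two terms that consume f coincide and have opposite
  -- signs.
  contract-twice : ∀ φ X fs → contract φ (contract φ X) fs ≈ 0#
  contract-twice φ X []       = refl
  contract-twice φ X (f ∷ fs) = begin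
    contract φ (contract φ X) (f ∷ fs)      ≈⟨ contract-contract-∷ φ φ X f fs ⟩
    y - (y - contract φ (contract φ (f ◁ X)) fs)
      ≈⟨ solve 2 (λ y z → y :- (y :- z) := z) refl y _ ⟩
    contract φ (contract φ (f ◁ X)) fs      ≈⟨ contract-twice φ (f ◁ X) fs ⟩
    0#                                      ∎
    where y = φ f * contract φ X fs

  -- Exchange of two adjacent rows. It lets a modified first row move past the next one, until two
  -- equal rows meet.
  contract-anticomm : ∀ φ ψ X fs →
    contract φ (contract ψ X) fs ≈ - contract ψ (contract φ X) fs
  contract-anticomm φ ψ X []       = sym -0#≈0#
  contract-anticomm φ ψ X (f ∷ fs) = begin
    contract φ (contract ψ X) (f ∷ fs)
      ≈⟨ contract-contract-∷ φ ψ X f fs ⟩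
    y - (z - contract φ (contract ψ (f ◁ X)) fs)
      ≈⟨ +-congˡ (-‿cong (+-congˡ (-‿cong (contract-anticomm φ ψ (f ◁ X) fs)))) ⟩
    y - (z - - contract ψ (contract φ (f ◁ X)) fs)
      ≈⟨ solve 3 (λ y z w → y :- (z :- :- w) := :- (z :- (y :- w))) refl y z _ ⟩
    - (z - (y - contract ψ (contract φ (f ◁ X)) fs))
      ≈⟨ -‿cong (contract-contract-∷ ψ φ X f fs) ⟨
    - contract ψ (contract φ X) (f ∷ fs) ∎
    where
    y = φ f * contract ψ X fs
    z = ψ f * contract φ X fs

  -- The row has a single nonzero entry, in the last column; the sign counts the columns passed on
  -- the way.
  contract-last : ∀ φ X fs g → All (λ f → φ f ≈ 0#) fs →
    contract φ X (fs ++ g ∷ []) ≈ (- 1#) ^ length fs * (φ g * X fs)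
  contract-last φ X []       g []          =
    solve 1 (λ x → x :- con (+ 0) := con (+ 1) :* x) refl (φ g * X [])
  contract-last φ X (f ∷ fs) g (φf≈0 ∷ φfs≈0) = begin
    φ f * X (fs ++ g ∷ []) - contract φ (f ◁ X) (fs ++ g ∷ [])
      ≈⟨ +-cong (*-congʳ φf≈0) (-‿cong (contract-last φ (f ◁ X) fs g φfs≈0)) ⟩
    0# * X (fs ++ g ∷ []) - (- 1#) ^ length fs * (φ g * X (f ∷ fs))
      ≈⟨ solve 3 (λ x s y → con (+ 0) :* x :- s :* y := con -[1+ 0 ] :* s :* y) refl _ _ _ ⟩
    (- 1#) ^ length (f ∷ fs) * (φ g * X (f ∷ fs)) ∎

  -- Linearity takes a pointwise equation and thereby contains the invariance of X under pointwise
  -- equality of columns. Only adjacent repetitions are required, as these are easy to verify along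
  -- `contract`; antisymmetry follows in `swap`.
  record IsAlternating (X : Form) : Set (c ⊔ ℓ) where
    field
      linear : ∀ fs {f g h} gs {a b} → (∀ i → f i ≈ a * g i + b * h i) →
               X (fs ++ f ∷ gs) ≈ a * X (fs ++ g ∷ gs) + b * X (fs ++ h ∷ gs)
      repeated : ∀ fs f gs → X (fs ++ f ∷ f ∷ gs) ≈ 0#

    -- Subtraction of a multiple of another column: that g occurs elsewhere in the list enters only
    -- through the vanishing of X.
    drop : ∀ fs {f g h} gs {b} → (∀ i → f i ≈ b * g i + h i) →
           X (fs ++ g ∷ gs) ≈ 0# → X (fs ++ f ∷ gs) ≈ X (fs ++ h ∷ gs)
    drop fs {f} {g} {h} gs {b} f≈ X≈0 = begin
      X (fs ++ f ∷ gs)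
        ≈⟨ linear fs gs (λ i → trans (f≈ i) (+-congˡ (sym (*-identityˡ (h i))))) ⟩
      b * X (fs ++ g ∷ gs) + 1# * X (fs ++ h ∷ gs)
        ≈⟨ +-congʳ (*-congˡ X≈0) ⟩
      b * 0# + 1# * X (fs ++ h ∷ gs)
        ≈⟨ solve 2 (λ b x → b :* con (+ 0) :+ con (+ 1) :* x := x) refl b _ ⟩
      X (fs ++ h ∷ gs) ∎

  open IsAlternating

  module _ {X : Form} (isAlternating : IsAlternating X) where

    ◁-isAlternating : ∀ f → IsAlternating (f ◁ X)
    ◁-isAlternating f = record
      { linear   = λ fs → linear isAlternating (f ∷ fs)
      ; repeated = λ fs → repeated isAlternating (f ∷ fs)
      }

    -- Polarisation: expand X at two adjacent columns equal to `f+g`.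
    swap : ∀ fs f g gs → X (fs ++ f ∷ g ∷ gs) ≈ - X (fs ++ g ∷ f ∷ gs)
    swap fs f g gs = begin
      fg                            ≈⟨ solve 2 (λ x y → x := (x :+ y) :- y) refl fg gf ⟩
      (fg + gf) - gf                ≈⟨ +-congʳ fg+gf≈0 ⟩
      0# - gf                       ≈⟨ +-identityˡ _ ⟩
      - gf                          ∎
      where
      fg = X (fs ++ f ∷ g ∷ gs)
      gf = X (fs ++ g ∷ f ∷ gs)
      f+g : Sequence
      f+g i = f i + g i
      f+g≈ : ∀ i → f+g i ≈ 1# * f i + 1# * g i
      f+g≈ i = +-cong (sym (*-identityˡ _)) (sym (*-identityˡ _))
      second : ∀ h → X (fs ++ h ∷ f+g ∷ gs) ≈
               1# * X (fs ++ h ∷ f ∷ gs) + 1# * X (fs ++ h ∷ g ∷ gs)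
      second h = ≡.subst₂ (λ x y → X x ≈ y) (assoc f+g)
        (≡.cong₂ (λ x y → 1# * X x + 1# * X y) (assoc f) (assoc g))
        (linear isAlternating (fs ++ h ∷ []) gs f+g≈)
        where
        assoc : ∀ k → (fs ++ h ∷ []) ++ k ∷ gs ≡ fs ++ h ∷ k ∷ gs
        assoc k = Listₚ.++-assoc fs (h ∷ []) (k ∷ gs)
      fg+gf≈0 : fg + gf ≈ 0#
      fg+gf≈0 = begin
        fg + gf
          ≈⟨ solve 2 (λ x y → x :+ y := con (+ 1) :* (con (+ 1) :* con (+ 0) :+ con (+ 1) :* x)
               :+ con (+ 1) :* (con (+ 1) :* y :+ con (+ 1) :* con (+ 0))) refl fg gf ⟩
        1# * (1# * 0# + 1# * fg) + 1# * (1# * gf + 1# * 0#)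
          ≈⟨ +-cong (*-congˡ (+-congʳ (*-congˡ (repeated isAlternating fs f gs))))
                    (*-congˡ (+-congˡ (*-congˡ (repeated isAlternating fs g gs)))) ⟨
        _ ≈⟨ +-cong (*-congˡ (second f)) (*-congˡ (second g)) ⟨
        1# * X (fs ++ f ∷ f+g ∷ gs) + 1# * X (fs ++ g ∷ f+g ∷ gs)
          ≈⟨ linear isAlternating fs (f+g ∷ gs) f+g≈ ⟨
        X (fs ++ f+g ∷ f+g ∷ gs)
          ≈⟨ repeated isAlternating fs f+g gs ⟩
        0# ∎

    repeated₂ : ∀ f g gs → X (f ∷ g ∷ f ∷ gs) ≈ 0#
    repeated₂ f g gs = begin
      X (f ∷ g ∷ f ∷ gs)      ≈⟨ swap [] f g (f ∷ gs) ⟩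
      - X (g ∷ f ∷ f ∷ gs)    ≈⟨ -‿cong (repeated isAlternating (g ∷ []) f gs) ⟩
      - 0#                    ≈⟨ -0#≈0# ⟩
      0#                      ∎

    -- Of the four terms of the expansion two have equal columns and the other two differ by a swap,
    -- which leaves the determinant of the change of columns.
    linear₂ : ∀ {f g f′ g′} gs a b a′ b′ →
      (∀ i → f′ i ≈ a * f i + b * g i) → (∀ i → g′ i ≈ a′ * f i + b′ * g i) →
      X (f′ ∷ g′ ∷ gs) ≈ (a * b′ - b * a′) * X (f ∷ g ∷ gs)
    linear₂ {f} {g} {f′} {g′} gs a b a′ b′ f′≈ g′≈ = begin
      X (f′ ∷ g′ ∷ gs)
        ≈⟨ linear isAlternating [] (g′ ∷ gs) f′≈ ⟩
      a * X (f ∷ g′ ∷ gs) + b * X (g ∷ g′ ∷ gs)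
        ≈⟨ +-cong (*-congˡ (linear isAlternating (f ∷ []) gs g′≈))
                  (*-congˡ (linear isAlternating (g ∷ []) gs g′≈)) ⟩
      a * (a′ * X (f ∷ f ∷ gs) + b′ * x) + b * (a′ * X (g ∷ f ∷ gs) + b′ * X (g ∷ g ∷ gs))
        ≈⟨ +-cong (*-congˡ (+-congʳ (*-congˡ (repeated isAlternating [] f gs))))
                  (*-congˡ (+-cong (*-congˡ (swap [] g f gs))
                                   (*-congˡ (repeated isAlternating [] g gs)))) ⟩
      a * (a′ * 0# + b′ * x) + b * (a′ * - x + b′ * 0#)
        ≈⟨ solve 5 (λ a b a′ b′ x → a :* (a′ :* con (+ 0) :+ b′ :* x) :+
             b :* (a′ :* :- x :+ b′ :* con (+ 0)) := (a :* b′ :- b :* a′) :* x)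
             refl a b a′ b′ x ⟩
      (a * b′ - b * a′) * x ∎
      where x = X (f ∷ g ∷ gs)

  -- When f is repeated, the two terms in which the new row consumes one of its copies cancel, and
  -- the remaining terms have both copies inside X.
  contract-isAlternating : ∀ {φ X} →
    (∀ {f g h a b} → (∀ i → f i ≈ a * g i + b * h i) → φ f ≈ a * φ g + b * φ h) →
    IsAlternating X → IsAlternating (contract φ X)
  contract-isAlternating {φ} φ-linear X-alt = record
    { linear   = contract-linear′ X-alt
    ; repeated = contract-repeated X-alt
    }
    where
    contract-linear′ : ∀ {X} → IsAlternating X → ∀ fs {f g h} gs {a b} →
      (∀ i → f i ≈ a * g i + b * h i) →
      contract φ X (fs ++ f ∷ gs) ≈
        a * contract φ X (fs ++ g ∷ gs) + b * contract φ X (fs ++ h ∷ gs)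
    contract-linear′ {X} alt [] {f} {g} {h} gs {a} {b} f≈ = begin
      φ f * X gs - contract φ (f ◁ X) gs
        ≈⟨ +-cong (*-congʳ (φ-linear f≈)) (-‿cong
             (contract-linear φ (λ fs → linear alt [] fs f≈) gs)) ⟩
      (a * φ g + b * φ h) * X gs - (a * contract φ (g ◁ X) gs + b * contract φ (h ◁ X) gs)
        ≈⟨ solve 7 (λ a b p q x u v → (a :* p :+ b :* q) :* x :- (a :* u :+ b :* v) :=
             a :* (p :* x :- u) :+ b :* (q :* x :- v)) refl a b _ _ _ _ _ ⟩
      a * contract φ X (g ∷ gs) + b * contract φ X (h ∷ gs) ∎
    contract-linear′ {X} alt (e ∷ fs) {f} {g} {h} gs {a} {b} f≈ = begin
      φ e * X (fs ++ f ∷ gs) - contract φ (e ◁ X) (fs ++ f ∷ gs)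
        ≈⟨ +-cong (*-congˡ (linear alt fs gs f≈))
             (-‿cong (contract-linear′ (◁-isAlternating alt e) fs gs f≈)) ⟩
      _ ≈⟨ solve 7 (λ a b p x y u v → p :* (a :* x :+ b :* y) :- (a :* u :+ b :* v) :=
             a :* (p :* x :- u) :+ b :* (p :* y :- v)) refl a b _ _ _ _ _ ⟩
      a * contract φ X (e ∷ fs ++ g ∷ gs) + b * contract φ X (e ∷ fs ++ h ∷ gs) ∎

    contract-repeated : ∀ {X} → IsAlternating X → ∀ fs f gs →
                        contract φ X (fs ++ f ∷ f ∷ gs) ≈ 0#
    contract-repeated {X} alt [] f gs = begin
      φ f * X (f ∷ gs) - (φ f * X (f ∷ gs) - contract φ (f ◁ f ◁ X) gs)
        ≈⟨ +-congˡ (-‿cong (+-congˡ (-‿cong (contract-zero φ (repeated alt [] f) gs)))) ⟩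
      φ f * X (f ∷ gs) - (φ f * X (f ∷ gs) - 0#)
        ≈⟨ solve 1 (λ x → x :- (x :- con (+ 0)) := con (+ 0)) refl _ ⟩
      0# ∎
    contract-repeated {X} alt (e ∷ fs) f gs = begin
      φ e * X (fs ++ f ∷ f ∷ gs) - contract φ (e ◁ X) (fs ++ f ∷ f ∷ gs)
        ≈⟨ +-cong (*-congˡ (repeated alt fs f gs))
             (-‿cong (contract-repeated (◁-isAlternating alt e) fs f gs)) ⟩
      φ e * 0# - 0#    ≈⟨ solve 1 (λ x → x :* con (+ 0) :- con (+ 0) := con (+ 0)) refl _ ⟩
      0#               ∎

  -- The determinant of size zero. Its vanishing on nonempty lists makes it alternating, so that no
  -- form below needs a hypothesis on the number of columns.
  unit : Form
  unit []      = 1#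
  unit (_ ∷ _) = 0#

  unit-isAlternating : IsAlternating unit
  unit-isAlternating = record
    { linear = λ where
        []      gs f≈ → zeros _ _
        (_ ∷ _) gs f≈ → zeros _ _
    ; repeated = λ where
        []      f gs → refl
        (_ ∷ _) f gs → refl
    }
    where
    zeros : ∀ a b → 0# ≈ a * 0# + b * 0#
    zeros = solve 2 (λ a b → con (+ 0) := a :* con (+ 0) :+ b :* con (+ 0)) refl

  -- The rows are the points x, ..., x + n - 1. The starting point varies because splitting off a
  -- column of top degree deletes the first row.
  evaluations : ℕ → ℕ → Form → Form
  evaluations zero    x X = X
  evaluations (suc n) x X = contract (λ f → f x) (evaluations n (suc x) X)

  evaluations-isAlternating : ∀ n x → IsAlternating (evaluations n x unit)
  evaluations-isAlternating zero    x = unit-isAlternating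
  evaluations-isAlternating (suc n) x =
    contract-isAlternating (λ f≈ → f≈ x) (evaluations-isAlternating n (suc x))

  difference : ℕ → ℕ → Sequence → Carrier
  difference zero    x f = f x
  difference (suc m) x f = difference m (suc x) f - difference m x f

  -- Row operations: the m-th difference at x is (-1)^m times the value at x plus a combination of
  -- the values at x + 1, ..., x + m, and by m ≤ k these are rows already present.
  contract-difference : ∀ {m k} → m ℕ.≤ k → ∀ x X fs →
    contract (difference m x) (evaluations k (suc x) X) fs ≈
    (- 1#) ^ m * evaluations (suc k) x X fs
  contract-difference z≤n x X fs = sym (*-identityˡ _)
  contract-difference {suc m} {suc k} (s≤s m≤k) x X fs = begin
    contract (difference (suc m) x) Y fs
      ≈⟨ contract-- (λ _ → refl) Y fs ⟩
    contract (difference m (suc x)) Y fs - contract (difference m x) Y fs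
      ≈⟨ +-cong first (-‿cong (contract-difference (ℕₚ.m≤n⇒m≤1+n m≤k) x X fs)) ⟩
    0# - (- 1#) ^ m * evaluations (suc (suc k)) x X fs
      ≈⟨ solve 2 (λ s y → con (+ 0) :- s :* y := con -[1+ 0 ] :* s :* y) refl _ _ ⟩
    (- 1#) ^ suc m * evaluations (suc (suc k)) x X fs ∎
    where
    Y Z : Form
    Y = evaluations (suc k) (suc x) X
    Z = evaluations k (suc (suc x)) X
    ev : Sequence → Carrier
    ev f = f (suc x)
    -- Moved past the row at `suc x`, the difference starting there turns by induction into a
    -- multiple of that same row, which then occurs twice.
    first : contract (difference m (suc x)) Y fs ≈ 0#
    first = begin
      contract (difference m (suc x)) (contract ev Z) fs
        ≈⟨ contract-anticomm (difference m (suc x)) ev Z fs ⟩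
      - contract ev (contract (difference m (suc x)) Z) fs
        -- Linearity is available for two summands; the second is filled up with coefficient zero.
        ≈⟨ -‿cong (contract-linear ev {(- 1#) ^ m} {0#} {Z = unit}
             (λ gs → trans (contract-difference m≤k (suc x) X gs) (add-zero _ _)) fs) ⟩
      - ((- 1#) ^ m * contract ev (contract ev Z) fs + 0# * contract ev unit fs)
        ≈⟨ -‿cong (+-congʳ (*-congˡ (contract-twice ev Z fs))) ⟩
      - ((- 1#) ^ m * 0# + 0# * contract ev unit fs)
        ≈⟨ solve 2 (λ s y → :- (s :* con (+ 0) :+ con (+ 0) :* y) := con (+ 0)) refl _ _ ⟩
      0# ∎
      where
      add-zero : ∀ x y → x ≈ x + 0# * y
      add-zero = solve 2 (λ x y → x := x :+ con (+ 0) :* y) refl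

  -1^-involutive : ∀ n → (- 1#) ^ n * (- 1#) ^ n ≈ 1#
  -1^-involutive zero    = *-identityˡ 1#
  -1^-involutive (suc n) = trans
    (solve 1 (λ s → (con -[1+ 0 ] :* s) :* (con -[1+ 0 ] :* s) := s :* s) refl _) (-1^-involutive n)

  -- The last sequence is a polynomial of degree n, the others have smaller degree.
  evaluations-last : ∀ {n} fs g x → length fs ≡ n → All (λ f → difference n x f ≈ 0#) fs →
    evaluations (suc n) x unit (fs ++ g ∷ []) ≈
    difference n x g * evaluations n (suc x) unit fs
  evaluations-last {n} fs g x length≡n fs≈0 = begin
    evaluations (suc n) x unit (fs ++ g ∷ [])
      -- The sign (-1)^n occurs twice, once for replacing the first row by a difference and once for
      -- expanding at the last column.
      ≈⟨ cancel _ ⟨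
    s * (s * evaluations (suc n) x unit (fs ++ g ∷ []))
      ≈⟨ *-congˡ (contract-difference {n} {n} ℕₚ.≤-refl x unit (fs ++ g ∷ [])) ⟨
    s * contract (difference n x) (evaluations n (suc x) unit) (fs ++ g ∷ [])
      ≈⟨ *-congˡ (contract-last (difference n x) _ fs g fs≈0) ⟩
    s * ((- 1#) ^ length fs * (difference n x g * evaluations n (suc x) unit fs))
      ≡⟨ ≡.cong (λ k → s * ((- 1#) ^ k * (difference n x g * evaluations n (suc x) unit fs)))
           length≡n ⟩
    s * (s * (difference n x g * evaluations n (suc x) unit fs))
      ≈⟨ cancel _ ⟩
    difference n x g * evaluations n (suc x) unit fs ∎
    where
    s = (- 1#) ^ n
    cancel : ∀ y → s * (s * y) ≈ y
    cancel y = trans (sym (*-assoc s s y)) (trans (*-congʳ (-1^-involutive n)) (*-identityˡ y))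

  -- With g₁ = t g₀, h₀ = (t² + β t + γ) g₀ and f₀ = h₀ + (e₁ t + e₀) g₀, the factor is the
  -- resultant of the quadratics h₀ / g₀ and f₀ / g₀ in t.
  eliminate : ∀ {X} → IsAlternating X → ∀ {f₀ f₁ g₀ g₁ h₀ h₁} fs β γ e₀ e₁ →
    (∀ i → f₀ i ≈ h₀ i + (e₁ * g₁ i + e₀ * g₀ i)) →
    (∀ i → f₁ i ≈ h₁ i + (e₁ * (h₀ i - β * g₁ i - γ * g₀ i) + e₀ * g₁ i)) →
    X (f₀ ∷ f₁ ∷ h₀ ∷ h₁ ∷ fs) ≈
    (e₀ * (e₀ - e₁ * β) + e₁ * e₁ * γ) * X (g₀ ∷ g₁ ∷ h₀ ∷ h₁ ∷ fs)
  eliminate {X} alt {f₀} {f₁} {g₀} {g₁} {h₀} {h₁} fs β γ e₀ e₁ f₀≈ f₁≈ = begin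
    X (f₀ ∷ f₁ ∷ h₀ ∷ h₁ ∷ fs)
      ≈⟨ drop alt [] (f₁ ∷ h₀ ∷ h₁ ∷ fs)
           (λ i → trans (f₀≈ i) (+-congʳ (sym (*-identityˡ _)))) (repeated₂ alt h₀ f₁ (h₁ ∷ fs)) ⟩
    X (u ∷ f₁ ∷ h₀ ∷ h₁ ∷ fs)
      ≈⟨ drop alt (u ∷ []) (h₀ ∷ h₁ ∷ fs)
           (λ i → trans (f₁≈ i) (+-congʳ (sym (*-identityˡ _))))
           (repeated₂ (◁-isAlternating alt u) h₁ h₀ fs) ⟩
    X (u ∷ v′ ∷ h₀ ∷ h₁ ∷ fs)
      ≈⟨ drop alt (u ∷ []) (h₀ ∷ h₁ ∷ fs) (λ i → solve 7 (λ β γ e₀ e₁ g₀ g₁ h₀ →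
             e₁ :* (h₀ :- β :* g₁ :- γ :* g₀) :+ e₀ :* g₁ :=
             e₁ :* h₀ :+ ((:- (e₁ :* γ)) :* g₀ :+ (e₀ :- e₁ :* β) :* g₁))
             refl β γ e₀ e₁ (g₀ i) (g₁ i) (h₀ i))
           (repeated (◁-isAlternating alt u) [] h₀ (h₁ ∷ fs)) ⟩
    X (u ∷ v ∷ h₀ ∷ h₁ ∷ fs)
      -- These are the coordinates of e₁ t + e₀ and of t (e₁ t + e₀) with respect to 1 and t, after
      -- reduction by t² = - β t - γ.
      ≈⟨ linear₂ alt (h₀ ∷ h₁ ∷ fs) e₀ e₁ (- (e₁ * γ)) (e₀ - e₁ * β)
           (λ i → +-comm _ _) (λ i → refl) ⟩
    (e₀ * (e₀ - e₁ * β) - e₁ * - (e₁ * γ)) * X (g₀ ∷ g₁ ∷ h₀ ∷ h₁ ∷ fs)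
      ≈⟨ *-congʳ (solve 4 (λ β γ e₀ e₁ → e₀ :* (e₀ :- e₁ :* β) :- e₁ :* (:- (e₁ :* γ)) :=
           e₀ :* (e₀ :- e₁ :* β) :+ e₁ :* e₁ :* γ) refl β γ e₀ e₁) ⟩
    (e₀ * (e₀ - e₁ * β) + e₁ * e₁ * γ) * X (g₀ ∷ g₁ ∷ h₀ ∷ h₁ ∷ fs) ∎
    where
    u v v′ : Sequence
    u i  = e₁ * g₁ i + e₀ * g₀ i
    v i  = (- (e₁ * γ)) * g₀ i + (e₀ - e₁ * β) * g₁ i
    v′ i = e₁ * (h₀ i - β * g₁ i - γ * g₀ i) + e₀ * g₁ i

-- Pochhammer symbols, finite differences and monic sequences

module PochhammerDeterminant {c ℓ₁ ℓ₂} (K : HeytingField c ℓ₁ ℓ₂) where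

  open FieldDefs K
  open CommutativeRing commutativeRing hiding (zero)
  open IntegerCoefficients commutativeRing
  open Forms commutativeRing
  open SemiringMult semiring using (×1-homo-*)
  open SetoidReasoning setoid

  ∏-cong : ∀ n {f g : ℕ → Carrier} → (∀ i → f i ≈ g i) → ∏< n f ≈ ∏< n g
  ∏-cong zero    f≈g = refl
  ∏-cong (suc n) f≈g = *-cong (f≈g 0) (∏-cong n (f≈g ∘ ℕ.suc))

  ∏-suc : ∀ n (f : ℕ → Carrier) → ∏< (suc n) f ≈ ∏< n f * f n
  ∏-suc zero    f = *-comm (f 0) 1#
  ∏-suc (suc n) f = trans (*-congˡ (∏-suc n (f ∘ ℕ.suc))) (sym (*-assoc _ _ _))

  ∏-scale : ∀ n r (f : ℕ → Carrier) → ∏[ i < n ] (r * f i) ≈ r ^ n * ∏< n f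
  ∏-scale zero    r f = sym (*-identityˡ 1#)
  ∏-scale (suc n) r f = trans (*-congˡ (∏-scale n r (f ∘ ℕ.suc)))
    (solve 4 (λ r x s p → r :* x :* (s :* p) := r :* s :* (x :* p)) refl r (f 0) _ _)

  pochhammer-cong : ∀ {γ δ} → γ ≈ δ → ∀ m → pochhammer γ m ≈ pochhammer δ m
  pochhammer-cong γ≈δ m = ∏-cong m λ i → +-congʳ {fromℕ i} γ≈δ

  pochhammer-last : ∀ γ m → pochhammer γ (suc m) ≈ (γ + fromℕ m) * pochhammer γ m
  pochhammer-last γ m = trans (∏-suc m (λ i → γ + fromℕ i)) (*-comm _ _)

  pochhammer-first : ∀ γ m → pochhammer γ (suc m) ≈ γ * pochhammer (γ + 1#) m
  pochhammer-first γ m = *-cong (+-identityʳ γ) (∏-cong m λ i → sym (+-assoc γ 1# (fromℕ i)))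

  difference-cong : ∀ m {f g} → (∀ i → f i ≈ g i) → ∀ x → difference m x f ≈ difference m x g
  difference-cong zero    f≈g x = f≈g x
  difference-cong (suc m) f≈g x =
    +-cong (difference-cong m f≈g (suc x)) (-‿cong (difference-cong m f≈g x))

  -- The Leibniz rule for differences has only two terms here, since the second difference of the
  -- linear factor vanishes.
  difference-leibniz : ∀ γ f m x →
    difference (suc m) x (λ i → (γ + fromℕ i) * f i) ≈
    (γ + fromℕ x + fromℕ (suc m)) * difference (suc m) x f + fromℕ (suc m) * difference m x f
  difference-leibniz γ f zero x = solve 4 (λ γ x f f′ →
    (γ :+ (con (+ 1) :+ x)) :* f′ :- (γ :+ x) :* f :=
    (γ :+ x :+ (con (+ 1) :+ con (+ 0))) :* (f′ :- f) :+ (con (+ 1) :+ con (+ 0)) :* f)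
    refl γ (fromℕ x) (f x) (f (suc x))
  difference-leibniz γ f (suc m) x = trans
    (+-cong (difference-leibniz γ f m (suc x)) (-‿cong (difference-leibniz γ f m x)))
    (solve 6 (λ γ x m d₀ d₁ d₂ →
      let m₁ = con (+ 1) :+ m in
      ((γ :+ (con (+ 1) :+ x) :+ m₁) :* (d₂ :- d₁) :+ m₁ :* d₁)
        :- ((γ :+ x :+ m₁) :* (d₁ :- d₀) :+ m₁ :* d₀) :=
      (γ :+ x :+ (con (+ 1) :+ m₁)) :* ((d₂ :- d₁) :- (d₁ :- d₀))
        :+ (con (+ 1) :+ m₁) :* (d₁ :- d₀))
      refl γ (fromℕ x) (fromℕ m) (difference m x f) (difference m (suc x) f)
        (difference m (suc (suc x)) f))

  -- Monic polynomials of degree n enter only through their constant n-th difference n!, so no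
  -- polynomial has to be attached to a sequence.
  record Monic (n : ℕ) (f : Sequence) : Set ℓ₁ where
    constructor monic
    field difference≈! : ∀ x → difference n x f ≈ fromℕ (n !)
  open Monic

  Monic-cong : ∀ {n f g} → (∀ i → f i ≈ g i) → Monic n f → Monic n g
  Monic-cong {n} f≈g f-monic =
    monic λ x → trans (sym (difference-cong n f≈g x)) (difference≈! f-monic x)

  difference-Monic : ∀ {m n f} → m ℕ.< n → Monic m f → ∀ x → difference n x f ≈ 0#
  difference-Monic {m} {suc n} {f} (s≤s m≤n) f-monic x with ℕₚ.m≤n⇒m<n∨m≡n m≤n
  ... | inj₁ m<n    = trans
    (+-cong (difference-Monic m<n f-monic (suc x)) (-‿cong (difference-Monic m<n f-monic x)))
    (-‿inverseʳ 0#)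
  ... | inj₂ ≡.refl = trans
    (+-cong (difference≈! f-monic (suc x)) (-‿cong (difference≈! f-monic x))) (-‿inverseʳ _)

  Monic-one : Monic 0 (λ _ → 1#)
  Monic-one = monic λ x → sym (+-identityʳ 1#)

  Monic-linear* : ∀ γ {n f} → Monic n f → Monic (suc n) (λ i → (γ + fromℕ i) * f i)
  Monic-linear* γ {n} {f} f-monic = monic λ x → let y = γ + fromℕ x + fromℕ (suc n) in begin
    difference (suc n) x (λ i → (γ + fromℕ i) * f i)
      ≈⟨ difference-leibniz γ f n x ⟩
    y * difference (suc n) x f + fromℕ (suc n) * difference n x f
      ≈⟨ +-cong (*-congˡ (difference-Monic ℕₚ.≤-refl f-monic x)) (*-congˡ (difference≈! f-monic x)) ⟩
    y * 0# + fromℕ (suc n) * fromℕ (n !)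
      ≈⟨ trans (+-congʳ (zeroʳ y)) (+-identityˡ _) ⟩
    fromℕ (suc n) * fromℕ (n !)
      ≈⟨ ×1-homo-* (suc n) (n !) ⟨
    fromℕ (suc n !) ∎

  Monic-pochhammer* : ∀ γ m {n f} → Monic n f →
                      Monic (m ℕ.+ n) (λ i → pochhammer (γ + fromℕ i) m * f i)
  Monic-pochhammer* γ zero    {n} f-monic = Monic-cong (λ i → sym (*-identityˡ _)) f-monic
  Monic-pochhammer* γ (suc m) {n} {f} f-monic = Monic-cong
    (λ i → begin
      (γ + fromℕ m + fromℕ i) * (pochhammer (γ + fromℕ i) m * f i)
        ≈⟨ solve 5 (λ γ m i p f → (γ :+ m :+ i) :* (p :* f) := (γ :+ i :+ m) :* p :* f)
             refl γ (fromℕ m) (fromℕ i) _ (f i) ⟩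
      (γ + fromℕ i + fromℕ m) * pochhammer (γ + fromℕ i) m * f i
        ≈⟨ *-congʳ (pochhammer-last (γ + fromℕ i) m) ⟨
      pochhammer (γ + fromℕ i) (suc m) * f i ∎)
    (Monic-linear* (γ + fromℕ m) (Monic-pochhammer* γ m f-monic))

  times-t : Sequence → Sequence
  times-t f i = fromℕ i * f i

  Monic-times-t : ∀ {n f} → Monic n f → Monic (suc n) (times-t f)
  Monic-times-t {n} f-monic =
    Monic-cong (λ i → *-congʳ (+-identityˡ _)) (Monic-linear* 0# f-monic)

  -- The columns Q_l, t Q_l and their determinant

  module Pairs (a b : Carrier) where

    -- The value Q_l(i), with m standing for N - 1 - l. The nesting to the right and the final `1#`
    -- fit the trailing factor in `Monic-pochhammer*`.
    block : Carrier → Carrier → ℕ → ℕ → Sequence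
    block c d l m i =
      pochhammer (a + fromℕ i) l * (pochhammer (b + fromℕ i) l *
        (pochhammer (c + fromℕ l + fromℕ i) m * (pochhammer (d + fromℕ l + fromℕ i) m * 1#)))

    Monic-block : ∀ c d l m → Monic (l ℕ.+ (l ℕ.+ (m ℕ.+ (m ℕ.+ 0)))) (block c d l m)
    Monic-block c d l m = Monic-pochhammer* a l (Monic-pochhammer* b l
      (Monic-pochhammer* (c + fromℕ l) m (Monic-pochhammer* (d + fromℕ l) m Monic-one)))

    -- The last argument counts the pairs still to come; its sum with l stays equal to N, so the
    -- block at l gets the length N - 1 - l.
    pairs : Carrier → Carrier → ℕ → ℕ → List Sequence
    pairs c d l zero    = []
    pairs c d l (suc m) = block c d l m ∷ times-t (block c d l m) ∷ pairs c d (suc l) m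

    resultant : Carrier → Carrier → Carrier
    resultant c d = (c - a) * (c - b) * ((d - a) * (d - b))

    -- Together with `block-sucˡ` this exhibits the common factor of Q_l and Q_(l+1). It is again a
    -- block, for c + 1, d + 1 and one pair fewer, which is what makes a recursion in c and d
    -- possible.
    block-sucʳ : ∀ c d l m i → block c d l (suc m) i ≈
      (c + fromℕ l + fromℕ i) * (d + fromℕ l + fromℕ i) * block (c + 1#) (d + 1#) l m i
    block-sucʳ c d l m i = begin
      _ ≈⟨ *-congˡ (*-congˡ (*-cong (shift c) (*-congʳ (shift d)))) ⟩
      _ ≈⟨ solve 6 (λ p q x y r s → p :* (q :* (x :* r :* (y :* s :* con (+ 1)))) :=
             x :* y :* (p :* (q :* (r :* (s :* con (+ 1)))))) refl _ _ _ _ _ _ ⟩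
      (c + fromℕ l + fromℕ i) * (d + fromℕ l + fromℕ i) * block (c + 1#) (d + 1#) l m i ∎
      where
      shift : ∀ γ → pochhammer (γ + fromℕ l + fromℕ i) (suc m) ≈
              (γ + fromℕ l + fromℕ i) * pochhammer (γ + 1# + fromℕ l + fromℕ i) m
      shift γ = trans (pochhammer-first _ m) (*-congˡ (pochhammer-cong
        (solve 3 (λ γ l i → γ :+ l :+ i :+ con (+ 1) := γ :+ con (+ 1) :+ l :+ i)
          refl γ (fromℕ l) (fromℕ i)) m))

    block-sucˡ : ∀ c d l m i → block c d (suc l) m i ≈
      (a + fromℕ i + fromℕ l) * (b + fromℕ i + fromℕ l) * block (c + 1#) (d + 1#) l m i
    block-sucˡ c d l m i = begin
      _ ≈⟨ *-cong (pochhammer-last _ l) (*-cong (pochhammer-last _ l)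
             (*-cong (shift c) (*-congʳ (shift d)))) ⟩
      _ ≈⟨ solve 6 (λ p q x y r s → x :* p :* (y :* q :* (r :* (s :* con (+ 1)))) :=
             x :* y :* (p :* (q :* (r :* (s :* con (+ 1)))))) refl _ _ _ _ _ _ ⟩
      (a + fromℕ i + fromℕ l) * (b + fromℕ i + fromℕ l) * block (c + 1#) (d + 1#) l m i ∎
      where
      shift : ∀ γ → pochhammer (γ + fromℕ (suc l) + fromℕ i) m ≈
              pochhammer (γ + 1# + fromℕ l + fromℕ i) m
      shift γ = pochhammer-cong (+-congʳ (sym (+-assoc γ 1# (fromℕ l)))) m

    pairs-step : ∀ {X} → IsAlternating X → ∀ c d l m fs →
      let f = block c d l (suc m) ; g = block (c + 1#) (d + 1#) l m ; h = block c d (suc l) m in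
      X (f ∷ times-t f ∷ h ∷ times-t h ∷ fs) ≈
      resultant c d * X (g ∷ times-t g ∷ h ∷ times-t h ∷ fs)
    pairs-step {X} alt c d l m fs = begin
      X (f ∷ times-t f ∷ h ∷ times-t h ∷ fs)
        ≈⟨ eliminate alt fs β γ e₀ e₁ f≈ tf≈ ⟩
      (e₀ * (e₀ - e₁ * β) + e₁ * e₁ * γ) * X (g ∷ times-t g ∷ h ∷ times-t h ∷ fs)
        ≈⟨ *-congʳ (solve 5 (λ a b c d l →
             let β  = a :+ l :+ (b :+ l)
                 γ  = (a :+ l) :* (b :+ l)
                 e₀ = (c :+ l) :* (d :+ l) :- γ
                 e₁ = c :+ l :+ (d :+ l) :- β in
             e₀ :* (e₀ :- e₁ :* β) :+ e₁ :* e₁ :* γ :=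
             (c :- a) :* (c :- b) :* ((d :- a) :* (d :- b))) refl a b c d (fromℕ l)) ⟩
      resultant c d * X (g ∷ times-t g ∷ h ∷ times-t h ∷ fs) ∎
      where
      f = block c d l (suc m)
      g = block (c + 1#) (d + 1#) l m
      h = block c d (suc l) m
      -- Here t² + β t + γ = (t + a + l) (t + b + l) is the quotient of h by g, and e₁ t + e₀ is
      -- what has to be added to reach (t + c + l) (t + d + l).
      β = a + fromℕ l + (b + fromℕ l)
      γ = (a + fromℕ l) * (b + fromℕ l)
      e₀ = (c + fromℕ l) * (d + fromℕ l) - γ
      e₁ = c + fromℕ l + (d + fromℕ l) - β
      f≈ : ∀ i → f i ≈ h i + (e₁ * times-t g i + e₀ * g i)
      f≈ i = begin
        f i ≈⟨ block-sucʳ c d l m i ⟩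
        _   ≈⟨ solve 7 (λ a b c d l i g →
                 let β  = a :+ l :+ (b :+ l)
                     γ  = (a :+ l) :* (b :+ l)
                     e₀ = (c :+ l) :* (d :+ l) :- γ
                     e₁ = c :+ l :+ (d :+ l) :- β in
                 (c :+ l :+ i) :* (d :+ l :+ i) :* g :=
                 (a :+ i :+ l) :* (b :+ i :+ l) :* g :+ (e₁ :* (i :* g) :+ e₀ :* g))
                 refl a b c d (fromℕ l) (fromℕ i) (g i) ⟩
        _   ≈⟨ +-congʳ (block-sucˡ c d l m i) ⟨
        h i + (e₁ * times-t g i + e₀ * g i) ∎
      tf≈ : ∀ i → times-t f i ≈
            times-t h i + (e₁ * (h i - β * times-t g i - γ * g i) + e₀ * times-t g i)
      tf≈ i = begin
        fromℕ i * f i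
          ≈⟨ *-congˡ (f≈ i) ⟩
        fromℕ i * (h i + (e₁ * times-t g i + e₀ * g i))
          ≈⟨ solve 5 (λ i h e₀ e₁ g → i :* (h :+ (e₁ :* (i :* g) :+ e₀ :* g)) :=
               i :* h :+ (e₁ :* (i :* i :* g) :+ e₀ :* (i :* g)))
               refl (fromℕ i) (h i) e₀ e₁ (g i) ⟩
        _ ≈⟨ +-congˡ (+-congʳ (*-congˡ square)) ⟩
        times-t h i + (e₁ * (h i - β * times-t g i - γ * g i) + e₀ * times-t g i) ∎
        where
        square : fromℕ i * fromℕ i * g i ≈ h i - β * times-t g i - γ * g i
        square = begin
          fromℕ i * fromℕ i * g i
            ≈⟨ solve 5 (λ a b l i g → i :* i :* g := (a :+ i :+ l) :* (b :+ i :+ l) :* g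
                 :- (a :+ l :+ (b :+ l)) :* (i :* g) :- (a :+ l) :* (b :+ l) :* g)
                 refl a b (fromℕ l) (fromℕ i) (g i) ⟩
          _ ≈⟨ +-congʳ (+-congʳ (block-sucˡ c d l m i)) ⟨
          h i - β * times-t g i - γ * g i ∎

    -- Each pair is reduced by means of its still unreduced successor, so the pass starts at the
    -- front, with finished columns absorbed into the form, and the last pair stays as it is.
    pairs-eliminate : ∀ {X} → IsAlternating X → ∀ c d l m →
      let f = block c d (l ℕ.+ m) 0 in
      X (pairs c d l (suc m)) ≈
      resultant c d ^ m * X (pairs (c + 1#) (d + 1#) l m ++ f ∷ times-t f ∷ [])
    pairs-eliminate alt c d l zero    rewrite ℕₚ.+-identityʳ l = sym (*-identityˡ _)
    pairs-eliminate {X} alt c d l (suc m) rewrite ℕₚ.+-suc l m = begin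
      X (pairs c d l (suc (suc m)))
        ≈⟨ pairs-step alt c d l m (pairs c d (suc (suc l)) m) ⟩
      resultant c d * X (g ∷ times-t g ∷ pairs c d (suc l) (suc m))
        ≈⟨ *-congˡ (pairs-eliminate (◁-isAlternating (◁-isAlternating alt g) (times-t g))
             c d (suc l) m) ⟩
      resultant c d * (resultant c d ^ m * _)
        ≈⟨ *-assoc _ _ _ ⟨
      resultant c d ^ suc m * _ ∎
      where g = block (c + 1#) (d + 1#) l m

    length-pairs : ∀ c d l m → length (pairs c d l m) ≡ m ℕ.+ m
    length-pairs c d l zero    = ≡.refl
    length-pairs c d l (suc m) rewrite ℕₚ.+-suc m m = ≡.cong (2 ℕ.+_) (length-pairs c d (suc l) m)

    difference-pairs : ∀ c d l m {n} → (l ℕ.+ m) ℕ.+ (l ℕ.+ m) ℕ.≤ n → ∀ x →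
                       All (λ f → difference n x f ≈ 0#) (pairs c d l m)
    difference-pairs c d l zero    bound x = []
    difference-pairs c d l (suc m) {n} bound x =
      difference-Monic (ℕₚ.<-trans ℕₚ.≤-refl degree<) (Monic-block c d l m) x ∷
      difference-Monic degree< (Monic-times-t (Monic-block c d l m)) x ∷
      difference-pairs c d (suc l) m
        (≡.subst (λ k → k ℕ.+ k ℕ.≤ n) (ℕₚ.+-suc l m) bound) x
      where
      degree< : suc (l ℕ.+ (l ℕ.+ (m ℕ.+ (m ℕ.+ 0)))) ℕ.< n
      degree< = ≡.subst (ℕ._≤ n) (solveℕ 2 (λ l m →
        (l +ℕ (conℕ 1 +ℕ m)) +ℕ (l +ℕ (conℕ 1 +ℕ m)) =ℕ
        conℕ 2 +ℕ (l +ℕ (l +ℕ (m +ℕ (m +ℕ conℕ 0))))) ≡.refl l m) bound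

    factor : Carrier → Carrier → ℕ → Carrier
    factor c d k = pochhammer (c - a) k * pochhammer (c - b) k *
                   (pochhammer (d - a) k * pochhammer (d - b) k)

    -- This product obeys the recursion of the determinant: the factor at 0 is 1, and each later one
    -- releases one resultant when c and d are raised by 1.
    ∏-factor : ∀ c d n →
      ∏< (suc n) (factor c d) ≈ resultant c d ^ n * ∏< n (factor (c + 1#) (d + 1#))
    ∏-factor c d n = begin
      1# * 1# * (1# * 1#) * ∏< n (factor c d ∘ ℕ.suc)
        ≈⟨ solve 1 (λ x → con (+ 1) :* con (+ 1) :* (con (+ 1) :* con (+ 1)) :* x := x) refl _ ⟩
      ∏< n (factor c d ∘ ℕ.suc)
        ≈⟨ ∏-cong n factor-suc ⟩
      ∏[ k < n ] (resultant c d * factor (c + 1#) (d + 1#) k)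
        ≈⟨ ∏-scale n (resultant c d) (factor (c + 1#) (d + 1#)) ⟩
      resultant c d ^ n * ∏< n (factor (c + 1#) (d + 1#)) ∎
      where
      shift : ∀ x y k → pochhammer (x - y) (suc k) ≈ (x - y) * pochhammer (x + 1# - y) k
      shift x y k = trans (pochhammer-first (x - y) k) (*-congˡ (pochhammer-cong
        (solve 2 (λ x y → x :- y :+ con (+ 1) := x :+ con (+ 1) :- y) refl x y) k))
      factor-suc : ∀ k → factor c d (suc k) ≈ resultant c d * factor (c + 1#) (d + 1#) k
      factor-suc k = trans
        (*-cong (*-cong (shift c a k) (shift c b k)) (*-cong (shift d a k) (shift d b k)))
        (solve 8 (λ p q r s w x y z → p :* w :* (q :* x) :* (r :* y :* (s :* z)) :=
          p :* q :* (r :* s) :* (w :* x :* (y :* z))) refl _ _ _ _ _ _ _ _)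

    -- Elimination raises c and d, and the two deleted rows raise x by 2; the induction therefore
    -- needs all three to be general. The top columns, of degrees 2n + 1 and 2n, contribute the two
    -- new factorials.
    evaluations-pairs : ∀ n c d x →
      evaluations (n ℕ.+ n) x unit (pairs c d 0 n) ≈
      (∏[ i < n ℕ.+ n ] fromℕ (i !)) * ∏< n (factor c d)
    evaluations-pairs zero    c d x = sym (*-identityˡ 1#)
    evaluations-pairs (suc n) c d x rewrite ℕₚ.+-suc n n = begin
      E (suc (suc n+n)) x (pairs c d 0 (suc n))
        ≈⟨ pairs-eliminate (evaluations-isAlternating (suc (suc n+n)) x) c d 0 n ⟩
      r * E (suc (suc n+n)) x (ps ++ f ∷ times-t f ∷ [])
        ≡⟨ ≡.cong (λ fs → r * E (suc (suc n+n)) x fs) (Listₚ.++-assoc ps (f ∷ []) (times-t f ∷ [])) ⟨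
      r * E (suc (suc n+n)) x ((ps ++ f ∷ []) ++ times-t f ∷ [])
        -- The columns in ps have degree at most 2n - 1 and f has degree 2n, so the difference of
        -- order 2n + 1 annihilates all but `times-t f`.
        ≈⟨ *-congˡ (evaluations-last (ps ++ f ∷ []) (times-t f) x length₁
             (Allₚ.++⁺ (difference-pairs (c + 1#) (d + 1#) 0 n (ℕₚ.n≤1+n n+n) x)
               (difference-Monic ℕₚ.≤-refl f-monic x ∷ []))) ⟩
      r * (difference (suc n+n) x (times-t f) * E (suc n+n) (suc x) (ps ++ f ∷ []))
        ≈⟨ *-congˡ (*-cong (difference≈! (Monic-times-t f-monic) x)
             (evaluations-last ps f (suc x) (length-pairs (c + 1#) (d + 1#) 0 n)
               (difference-pairs (c + 1#) (d + 1#) 0 n ℕₚ.≤-refl (suc x)))) ⟩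
      r * (fromℕ (suc n+n !) * (difference n+n (suc x) f * E n+n (suc (suc x)) ps))
        ≈⟨ *-congˡ (*-congˡ (*-cong (difference≈! f-monic (suc x))
             (evaluations-pairs n (c + 1#) (d + 1#) (suc (suc x))))) ⟩
      r * (fromℕ (suc n+n !) * (fromℕ (n+n !) * (∏< n+n (λ i → fromℕ (i !)) * ∏< n φ)))
        ≈⟨ solve 5 (λ r u v x y → r :* (u :* (v :* (x :* y))) := x :* v :* u :* (r :* y))
             refl r _ _ _ _ ⟩
      ∏< n+n (λ i → fromℕ (i !)) * fromℕ (n+n !) * fromℕ (suc n+n !) * (r * ∏< n φ)
        ≈⟨ *-cong (*-congʳ (∏-suc n+n (λ i → fromℕ (i !)))) (∏-factor c d n) ⟨
      ∏< (suc n+n) (λ i → fromℕ (i !)) * fromℕ (suc n+n !) * ∏< (suc n) (factor c d)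
        ≈⟨ *-congʳ (∏-suc (suc n+n) (λ i → fromℕ (i !))) ⟨
      ∏< (suc (suc n+n)) (λ i → fromℕ (i !)) * ∏< (suc n) (factor c d) ∎
      where
      n+n = n ℕ.+ n
      E : ℕ → ℕ → Form
      E k x = evaluations k x unit
      r = resultant c d ^ n
      φ = factor (c + 1#) (d + 1#)
      ps = pairs (c + 1#) (d + 1#) 0 n
      f = block c d n 0
      f-monic : Monic n+n f
      f-monic = ≡.subst (λ k → Monic k f) (≡.cong (n ℕ.+_) (ℕₚ.+-identityʳ n)) (Monic-block c d n 0)
      length₁ : length (ps ++ f ∷ []) ≡ suc n+n
      length₁ = ≡.trans (Listₚ.length-++ ps)
        (≡.trans (ℕₚ.+-comm _ 1) (≡.cong suc (length-pairs (c + 1#) (d + 1#) 0 n)))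

-- Laplace expansion as iterated contraction

module DeterminantExpansion {c ℓ₁ ℓ₂} (K : HeytingField c ℓ₁ ℓ₂) where

  open FieldDefs K
  open CommutativeRing commutativeRing hiding (zero)
  open IntegerCoefficients commutativeRing
  open Forms commutativeRing
  open SemiringSum semiring using (sum-cong-≋; *-distribˡ-sum)
  open SetoidReasoning setoid

  det-cong : ∀ {n} {M M′ : Matrix n} → (∀ i j → M i j ≈ M′ i j) → det M ≈ det M′
  det-cong {zero}  M≈M′ = refl
  det-cong {suc n} M≈M′ = sum-cong-≋ λ j → *-congˡ {(- 1#) ^ toℕ j}
    (*-cong (M≈M′ zero j) (det-cong λ i k → M≈M′ (suc i) (punchIn j k)))

  -- Each column that is passed over goes into the form and costs one subtraction; the nested
  -- subtractions are the powers of `- 1#`.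
  contract-tabulate : ∀ φ X {n} (f : Fin (suc n) → Sequence) →
    contract φ X (tabulate f) ≈
    sum λ j → (- 1#) ^ toℕ j * (φ (f j) * X (tabulate (f ∘ punchIn j)))
  contract-tabulate φ X {zero}  f =
    solve 1 (λ x → x :- con (+ 0) := con (+ 1) :* x :+ con (+ 0)) refl _
  contract-tabulate φ X {suc n} f = +-cong (sym (*-identityˡ _)) (begin
    - contract φ (f zero ◁ X) (tabulate (f ∘ suc))
      ≈⟨ -‿cong (contract-tabulate φ (f zero ◁ X) (f ∘ suc)) ⟩
    - sum t
      ≈⟨ solve 1 (λ x → :- x := con -[1+ 0 ] :* x) refl (sum t) ⟩
    - 1# * sum t
      ≈⟨ *-distribˡ-sum (- 1#) t ⟩
    sum (λ j → - 1# * t j)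
      ≈⟨ sum-cong-≋ {suc n} (λ j → sym (*-assoc (- 1#) ((- 1#) ^ toℕ j) (u j))) ⟩
    sum (λ j → (- 1#) ^ suc (toℕ j) * u j) ∎)
    where
    t u : Fin (suc n) → Carrier
    u j = φ (f (suc j)) * X (f zero ∷ tabulate (f ∘ suc ∘ punchIn j))
    t j = (- 1#) ^ toℕ j * u j

  det-evaluations : ∀ {n} x (f : Fin n → Sequence) →
    det (λ i j → f j (x ℕ.+ toℕ i)) ≈ evaluations n x unit (tabulate f)
  det-evaluations {zero}  x f = refl
  det-evaluations {suc n} x f = begin
    det (λ i j → f j (x ℕ.+ toℕ i))
      ≈⟨ sum-cong-≋ (λ j → *-congˡ {(- 1#) ^ toℕ j} (*-cong
           (reflexive (≡.cong (f j) (ℕₚ.+-identityʳ x)))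
           (trans (det-cong λ i k → reflexive (≡.cong (f (punchIn j k)) (ℕₚ.+-suc x (toℕ i))))
                  (det-evaluations (suc x) (f ∘ punchIn j))))) ⟩
    sum (λ j → (- 1#) ^ toℕ j * (f j x * evaluations n (suc x) unit (tabulate (f ∘ punchIn j))))
      ≈⟨ contract-tabulate (λ g → g x) (evaluations n (suc x) unit) f ⟨
    evaluations (suc n) x unit (tabulate f) ∎

  -- Numbering columns by naturals allows them to be split off two at a time, as in `columns≈pairs`.
  columns : (ℕ → Sequence) → ℕ → ℕ → List Sequence
  columns f k zero    = []
  columns f k (suc n) = f k ∷ columns f (suc k) n

  tabulate≡columns : ∀ f k {n} {g : Fin n → Sequence} →
    (∀ j → g j ≡ f (k ℕ.+ toℕ j)) → tabulate g ≡ columns f k n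
  tabulate≡columns f k {zero}  g≡ = ≡.refl
  tabulate≡columns f k {suc n} g≡ = ≡.cong₂ _∷_
    (≡.trans (g≡ zero) (≡.cong f (ℕₚ.+-identityʳ k)))
    (tabulate≡columns f (suc k) λ j → ≡.trans (g≡ (suc j)) (≡.cong f (ℕₚ.+-suc k (toℕ j))))

  infixr 7 _⊙_
  _⊙_ : Sequence → Sequence → Sequence
  (ρ ⊙ f) i = ρ i * f i

  contract-map : ∀ {φ r h X Y s} → (∀ f → φ (h f) ≈ r * φ f) → (∀ fs → X (map h fs) ≈ s * Y fs) →
    ∀ fs → contract φ X (map h fs) ≈ r * s * contract φ Y fs
  contract-map φh≈ Xh≈ [] = sym (zeroʳ _)
  contract-map {φ} {r} {h} {X} {Y} {s} φh≈ Xh≈ (f ∷ fs) = begin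
    φ (h f) * X (map h fs) - contract φ (h f ◁ X) (map h fs)
      ≈⟨ +-cong (*-cong (φh≈ f) (Xh≈ fs)) (-‿cong (contract-map φh≈ (Xh≈ ∘ (f ∷_)) fs)) ⟩
    r * φ f * (s * Y fs) - r * s * contract φ (f ◁ Y) fs
      ≈⟨ solve 5 (λ r s p y z → r :* p :* (s :* y) :- r :* s :* z := r :* s :* (p :* y :- z))
           refl r s (φ f) (Y fs) _ ⟩
    r * s * contract φ Y (f ∷ fs) ∎

  -- A factor common to all columns at a point is a factor of the row belonging to this point.
  evaluations-⊙ : ∀ ρ n x fs →
    evaluations n x unit (map (ρ ⊙_) fs) ≈ (∏[ i < n ] ρ (x ℕ.+ i)) * evaluations n x unit fs
  evaluations-⊙ ρ zero    x []       = sym (*-identityˡ 1#)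
  evaluations-⊙ ρ zero    x (f ∷ fs) = sym (zeroʳ 1#)
  evaluations-⊙ ρ (suc n) x fs = trans
    (contract-map {φ = λ f → f x} {r = ρ x} (λ f → refl) (evaluations-⊙ ρ n (suc x)) fs)
    (*-congʳ (*-cong (reflexive (≡.cong ρ (≡.sym (ℕₚ.+-identityʳ x))))
      (PochhammerDeterminant.∏-cong K n λ i → reflexive (≡.cong ρ (≡.sym (ℕₚ.+-suc x i))))))

-- Convolution of power series and the differential equation of a square

parity : ∀ n → (∃ λ k → n ≡ k ℕ.+ k) ⊎ (∃ λ k → n ≡ suc (k ℕ.+ k))
parity zero = inj₁ (0 , ≡.refl)
parity (suc n) with parity n
... | inj₁ (k , n≡) = inj₂ (k , ≡.cong suc n≡)
... | inj₂ (k , n≡) = inj₁ (suc k , ≡.cong suc (≡.trans n≡ (≡.sym (ℕₚ.+-suc k k))))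

module Convolution {c ℓ₁ ℓ₂} (K : HeytingField c ℓ₁ ℓ₂) where

  open FieldDefs K
  open CommutativeRing commutativeRing hiding (zero)
  open IntegerCoefficients commutativeRing
  open SemiringMult semiring using (×-homo-+)
  open SemiringSum semiring
    using (sum-cong-≋; *-distribˡ-sum; ∑-distrib-+; sum-replicate-zero; sum-permute)
  open SetoidReasoning setoid

  -- The Euler operator x d/dx; in terms of it the Bessel equation has constant coefficients apart
  -- from the factor x².
  θ : Series → Series
  θ f n = fromℕ n * f n

  x²· : Series → Series
  x²· f zero          = 0#
  x²· f (suc zero)    = 0#
  x²· f (suc (suc n)) = f n

  ⊛-linearˡ : ∀ {a b f g h} e → (∀ n → f n ≈ a * g n + b * h n) →
              ∀ n → (f ⊛ e) n ≈ a * (g ⊛ e) n + b * (h ⊛ e) n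
  ⊛-linearˡ {a} {b} {f} {g} {h} e f≈ n = begin
    (f ⊛ e) n
      ≈⟨ sum-cong-≋ {suc n} (λ i → trans (*-congʳ (f≈ (toℕ i)))
           (solve 5 (λ a b g h e → (a :* g :+ b :* h) :* e := a :* (g :* e) :+ b :* (h :* e))
             refl a b (g (toℕ i)) (h (toℕ i)) (e (n ∸ toℕ i)))) ⟩
    sum {suc n} (λ i → a * ge i + b * he i)
      ≈⟨ ∑-distrib-+ {suc n} (λ i → a * ge i) (λ i → b * he i) ⟩
    sum {suc n} (λ i → a * ge i) + sum {suc n} (λ i → b * he i)
      ≈⟨ +-cong (*-distribˡ-sum {suc n} a ge) (*-distribˡ-sum {suc n} b he) ⟨
    a * (g ⊛ e) n + b * (h ⊛ e) n ∎
    where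
    ge he : Fin (suc n) → Carrier
    ge i = g (toℕ i) * e (n ∸ toℕ i)
    he i = h (toℕ i) * e (n ∸ toℕ i)

  ⊛-comm : ∀ f g n → (f ⊛ g) n ≈ (g ⊛ f) n
  ⊛-comm f g n = begin
    (f ⊛ g) n
      ≈⟨ sum-permute {suc n} {suc n} (λ i → f (toℕ i) * g (n ∸ toℕ i)) Permutation.reverse ⟩
    sum {suc n} (λ i → f (toℕ (Fin.opposite i)) * g (n ∸ toℕ (Fin.opposite i)))
      ≈⟨ sum-cong-≋ {suc n} (λ i → trans
           (*-cong (reflexive (≡.cong f (Finₚ.opposite-prop i)))
                   (reflexive (≡.cong g (≡.trans (≡.cong (n ∸_) (Finₚ.opposite-prop i))
                     (ℕₚ.m∸[m∸n]≡n (ℕ.s≤s⁻¹ (Finₚ.toℕ<n i)))))))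
           (*-comm (f (n ∸ toℕ i)) (g (toℕ i)))) ⟩
    (g ⊛ f) n ∎

  θ-⊛ : ∀ f g n → fromℕ n * (f ⊛ g) n ≈ (θ f ⊛ g) n + (f ⊛ θ g) n
  θ-⊛ f g n = begin
    fromℕ n * (f ⊛ g) n
      ≈⟨ *-distribˡ-sum {suc n} (fromℕ n) (λ i → f (toℕ i) * g (n ∸ toℕ i)) ⟩
    sum {suc n} (λ i → fromℕ n * (f (toℕ i) * g (n ∸ toℕ i)))
      ≈⟨ sum-cong-≋ {suc n} (λ i → trans (*-congʳ (split i))
           (solve 4 (λ x y f g → (x :+ y) :* (f :* g) := x :* f :* g :+ f :* (y :* g))
             refl (fromℕ (toℕ i)) (fromℕ (n ∸ toℕ i)) (f (toℕ i)) (g (n ∸ toℕ i)))) ⟩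
    sum {suc n} (λ i → θ f (toℕ i) * g (n ∸ toℕ i) + f (toℕ i) * θ g (n ∸ toℕ i))
      ≈⟨ ∑-distrib-+ {suc n} (λ i → θ f (toℕ i) * g (n ∸ toℕ i))
           (λ i → f (toℕ i) * θ g (n ∸ toℕ i)) ⟩
    (θ f ⊛ g) n + (f ⊛ θ g) n ∎
    where
    split : ∀ (i : Fin (suc n)) → fromℕ n ≈ fromℕ (toℕ i) + fromℕ (n ∸ toℕ i)
    split i = trans
      (reflexive (≡.cong fromℕ (≡.sym (ℕₚ.m+[n∸m]≡n (ℕ.s≤s⁻¹ (Finₚ.toℕ<n i))))))
      (×-homo-+ 1# (toℕ i) (n ∸ toℕ i))

  x²·-⊛ : ∀ f g n → (x²· f ⊛ g) (suc (suc n)) ≈ (f ⊛ g) n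
  x²·-⊛ f g n = solve 3 (λ x y z → con (+ 0) :* x :+ (con (+ 0) :* y :+ z) := z) refl _ _ _

  Even : Series → Set ℓ₁
  Even f = ∀ k → f (suc (k ℕ.+ k)) ≈ 0#

  -- The first two products vanish, one through g and the other through f; the remaining sum is a
  -- convolution with f shifted by two places, which is even again.
  ⊛-even : ∀ f g → Even f → Even g → Even (f ⊛ g)
  ⊛-even f g f-even g-even zero = begin
    f 0 * g 1 + (f 1 * g 0 + 0#)
      ≈⟨ +-cong (*-congˡ (g-even 0)) (+-congʳ (*-congʳ (f-even 0))) ⟩
    f 0 * 0# + (0# * g 0 + 0#)
      ≈⟨ solve 2 (λ x y → x :* con (+ 0) :+ (con (+ 0) :* y :+ con (+ 0)) := con (+ 0)) refl _ _ ⟩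
    0# ∎
  ⊛-even f g f-even g-even (suc k) = begin
    (f ⊛ g) (suc (suc k ℕ.+ suc k))
      ≡⟨ ≡.cong (λ m → (f ⊛ g) (suc (suc m))) (ℕₚ.+-suc k k) ⟩
    f 0 * g (suc (suc (suc (k ℕ.+ k)))) +
      (f 1 * g (suc (suc (k ℕ.+ k))) + (f ∘ ℕ.suc ∘ ℕ.suc ⊛ g) (suc (k ℕ.+ k)))
      ≈⟨ +-cong (*-congˡ (shift g g-even k)) (+-cong (*-congʳ (f-even 0))
           (⊛-even (f ∘ ℕ.suc ∘ ℕ.suc) g (shift f f-even) g-even k)) ⟩
    f 0 * 0# + (0# * g (suc (suc (k ℕ.+ k))) + 0#)
      ≈⟨ solve 2 (λ x y → x :* con (+ 0) :+ (con (+ 0) :* y :+ con (+ 0)) := con (+ 0)) refl _ _ ⟩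
    0# ∎
    where
    shift : ∀ h → Even h → Even (h ∘ ℕ.suc ∘ ℕ.suc)
    shift h h-even k = trans
      (reflexive (≡.cong (h ∘ ℕ.suc ∘ ℕ.suc) (≡.sym (ℕₚ.+-suc k k)))) (h-even (suc k))

  1+x-⊛-suc : ∀ f n → (1+x ⊛ f) (suc n) ≈ f (suc n) + f n
  1+x-⊛-suc f n = begin
    1# * f (suc n) + (1# * f n + sum {n} (λ i → 0# * f (n ∸ suc (toℕ i))))
      ≈⟨ +-congˡ (+-congˡ (trans
           (sum-cong-≋ {n} (λ i → zeroˡ (f (n ∸ suc (toℕ i))))) (sum-replicate-zero n))) ⟩
    1# * f (suc n) + (1# * f n + 0#)
      ≈⟨ solve 2 (λ x y → con (+ 1) :* x :+ (con (+ 1) :* y :+ con (+ 0)) := x :+ y) refl _ _ ⟩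
    f (suc n) + f n ∎

  atSquare-even : ∀ g k → atSquare g (k ℕ.+ k) ≡ g k
  atSquare-even g zero    = ≡.refl
  atSquare-even g (suc k) rewrite ℕₚ.+-suc k k = atSquare-even (g ∘ suc) k

  atSquare-odd : ∀ g k → atSquare g (suc (k ℕ.+ k)) ≡ 0#
  atSquare-odd g zero    = ≡.refl
  atSquare-odd g (suc k) rewrite ℕₚ.+-suc k k = atSquare-odd (g ∘ suc) k

  -- For A = y², B = y θy and D = (θy)² the equation of y gives θA = 2 B, (θ + 2ν) B = D - x² A and
  -- (θ + 4ν) D = - 2 x² B. Eliminating B and D leaves a third order equation for A, read off here
  -- at degree n + 2; primes mark coefficients two degrees lower.
  ⊛-square-equation : ∀ ν y →
    (∀ n → θ (θ y) n ≈ - (fromℕ 2 * ν) * θ y n + - 1# * x²· y n) →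
    ∀ n → let N = fromℕ (suc (suc n)) ; A = y ⊛ y in
    N * (N + fromℕ 2 * ν) * (N + fromℕ 4 * ν) * A (suc (suc n)) ≈
    - (fromℕ 4 * (fromℕ (suc n) + fromℕ 2 * ν)) * A n
  ⊛-square-equation ν y ode n = begin
    N * (N + ν₂) * (N + fromℕ 4 * ν) * A
      ≈⟨ solve 3 (λ n v a → n :* (n :+ two :* v) :* (n :+ four :* v) :* a :=
           (n :+ four :* v) :* ((n :+ two :* v) :* (n :* a))) refl N ν A ⟩
    (N + fromℕ 4 * ν) * ((N + ν₂) * (N * A))
      ≈⟨ *-congˡ (*-congˡ NA≈) ⟩
    (N + fromℕ 4 * ν) * ((N + ν₂) * (B + B))
      ≈⟨ solve 3 (λ n v b → (n :+ four :* v) :* ((n :+ two :* v) :* (b :+ b)) :=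
           (n :+ four :* v) :* ((n :* b :+ n :* b) :+ two :* v :* (b :+ b))) refl N ν B ⟩
    (N + fromℕ 4 * ν) * ((N * B + N * B) + ν₂ * (B + B))
      ≈⟨ *-congˡ (+-congʳ (+-cong NB≈ NB≈)) ⟩
    (N + fromℕ 4 * ν) * ((D + (- ν₂ * B + - 1# * A′) + (D + (- ν₂ * B + - 1# * A′))) + ν₂ * (B + B))
      ≈⟨ solve 5 (λ n v c b a → (n :+ four :* v) :*
             ((c :+ (:- (two :* v) :* b :+ con -[1+ 0 ] :* a) :+
               (c :+ (:- (two :* v) :* b :+ con -[1+ 0 ] :* a))) :+ two :* v :* (b :+ b)) :=
           (n :* c :+ n :* c) :+ two :* (four :* v :* c) :- (n :+ four :* v) :* (two :* a))
           refl N ν D B A′ ⟩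
    (N * D + N * D) + fromℕ 2 * (fromℕ 4 * ν * D) - (N + fromℕ 4 * ν) * (fromℕ 2 * A′)
      ≈⟨ +-congʳ (+-congʳ (+-cong ND≈ ND≈)) ⟩
    (E + E + (E + E)) + fromℕ 2 * (fromℕ 4 * ν * D) - (N + fromℕ 4 * ν) * (fromℕ 2 * A′)
      ≈⟨ solve 5 (λ n v c b a → let e = :- (two :* v) :* c :+ con -[1+ 0 ] :* b in
           (e :+ e :+ (e :+ e)) :+ two :* (four :* v :* c) :- (n :+ four :* v) :* (two :* a) :=
           :- (two :* (b :+ b)) :- (n :+ four :* v) :* (two :* a)) refl N ν D B′ A′ ⟩
    - (fromℕ 2 * (B′ + B′)) - (N + fromℕ 4 * ν) * (fromℕ 2 * A′)
      -- The relation θA = 2 B is used a second time, now at degree n, to get rid of B′.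
      ≈⟨ +-congʳ (-‿cong (*-congˡ MA′≈)) ⟨
    - (fromℕ 2 * (M * A′)) - (N + fromℕ 4 * ν) * (fromℕ 2 * A′)
      ≈⟨ solve 3 (λ m v a → :- (two :* (m :* a)) :-
             (con (+ 1) :+ (con (+ 1) :+ m) :+ four :* v) :* (two :* a) :=
           :- (four :* (con (+ 1) :+ m :+ two :* v)) :* a) refl M ν A′ ⟩
    - (fromℕ 4 * (fromℕ (suc n) + ν₂)) * A′ ∎
    where
    -- Spelled out because `fromℕ 2` unfolds to 1 + (1 + 0), which `con (+ 2)` does not match.
    two four : ∀ {n} → Polynomial n
    two = con (+ 1) :+ (con (+ 1) :+ con (+ 0))
    four = con (+ 1) :+ (con (+ 1) :+ two)
    ν₂ = fromℕ 2 * ν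
    N = fromℕ (suc (suc n))
    M = fromℕ n
    A = (y ⊛ y) (suc (suc n))
    B = (θ y ⊛ y) (suc (suc n))
    D = (θ y ⊛ θ y) (suc (suc n))
    A′ = (y ⊛ y) n
    B′ = (θ y ⊛ y) n
    E = - ν₂ * D + - 1# * B′

    derivative : ∀ f n → fromℕ n * (f ⊛ f) n ≈ (θ f ⊛ f) n + (θ f ⊛ f) n
    derivative f n = trans (θ-⊛ f f n) (+-congˡ (⊛-comm f (θ f) n))

    θθ-⊛ : ∀ e → (θ (θ y) ⊛ e) (suc (suc n)) ≈ - ν₂ * (θ y ⊛ e) (suc (suc n)) + - 1# * (y ⊛ e) n
    θθ-⊛ e = trans (⊛-linearˡ e ode (suc (suc n))) (+-congˡ (*-congˡ (x²·-⊛ y e n)))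

    NA≈ : N * A ≈ B + B
    NA≈ = derivative y (suc (suc n))
    MA′≈ : M * A′ ≈ B′ + B′
    MA′≈ = derivative y n
    NB≈ : N * B ≈ D + (- ν₂ * B + - 1# * A′)
    NB≈ = trans (θ-⊛ (θ y) y (suc (suc n))) (trans (+-comm _ _) (+-congˡ (θθ-⊛ y)))
    ND≈ : N * D ≈ E + E
    ND≈ = trans (derivative (θ y) (suc (suc n))) (+-cong θθy-⊛-θy θθy-⊛-θy)
      where
      θθy-⊛-θy : (θ (θ y) ⊛ θ y) (suc (suc n)) ≈ E
      θθy-⊛-θy = trans (θθ-⊛ (θ y)) (+-congˡ (*-congˡ (⊛-comm y (θ y) n)))

-- Rational scalars and inverses in a field

-- Division in ℚ reduces by a greatest common divisor and does not compute for variables, so the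
-- equation is checked on unnormalised fractions.
/-clear : ∀ i d .{{_ : ℕ.NonZero d}} → (i ℚ./ d) ℚ.* (+ d ℚ./ 1) ≡ i ℚ./ 1
/-clear i (suc d) = ℚₚ.toℚᵘ-injective (begin
  ℚ.toℚᵘ ((i ℚ./ suc d) ℚ.* (+ suc d ℚ./ 1))
    ≈⟨ ℚₚ.toℚᵘ-homo-* (i ℚ./ suc d) (+ suc d ℚ./ 1) ⟩
  ℚ.toℚᵘ (i ℚ./ suc d) ℚᵘ.* ℚ.toℚᵘ (+ suc d ℚ./ 1)
    ≈⟨ ℚᵘₚ.*-cong (ℚₚ.toℚᵘ-fromℚᵘ (mkℚᵘ i d)) (ℚₚ.toℚᵘ-fromℚᵘ (mkℚᵘ (+ suc d) 0)) ⟩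
  mkℚᵘ i d ℚᵘ.* mkℚᵘ (+ suc d) 0
    ≈⟨ *≡* (ℤₚ.*-assoc i (+ suc d) (+ 1)) ⟩
  mkℚᵘ i 0
    ≈⟨ ℚₚ.toℚᵘ-fromℚᵘ (mkℚᵘ i 0) ⟨
  ℚ.toℚᵘ (i ℚ./ 1) ∎)
  where open SetoidReasoning ℚᵘₚ.≃-setoid

suc/1 : ∀ n → + suc n ℚ./ 1 ≡ ℚ.1ℚ ℚ.+ (+ n ℚ./ 1)
suc/1 n = ℚₚ.toℚᵘ-injective (begin
  ℚ.toℚᵘ (+ suc n ℚ./ 1)
    ≈⟨ ℚₚ.toℚᵘ-fromℚᵘ (mkℚᵘ (+ suc n) 0) ⟩
  mkℚᵘ (+ suc n) 0
    ≈⟨ *≡* (≡.cong (ℤ._* + 1) (≡.cong (ℤ._+_ (+ 1)) (≡.sym (ℤₚ.*-identityʳ (+ n))))) ⟩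
  ℚᵘ.1ℚᵘ ℚᵘ.+ mkℚᵘ (+ n) 0
    ≈⟨ ℚᵘₚ.+-congʳ ℚᵘ.1ℚᵘ (ℚₚ.toℚᵘ-fromℚᵘ (mkℚᵘ (+ n) 0)) ⟨
  ℚᵘ.1ℚᵘ ℚᵘ.+ ℚ.toℚᵘ (+ n ℚ./ 1)
    ≈⟨ ℚₚ.toℚᵘ-homo-+ ℚ.1ℚ (+ n ℚ./ 1) ⟨
  ℚ.toℚᵘ (ℚ.1ℚ ℚ.+ (+ n ℚ./ 1)) ∎)
  where open SetoidReasoning ℚᵘₚ.≃-setoid

neg/1 : ∀ i → (ℤ.- i) ℚ./ 1 ≡ ℚ.- (i ℚ./ 1)
neg/1 (+ zero)  = ≡.refl
neg/1 (+ suc n) = ≡.refl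
neg/1 -[1+ n ]  = ≡.sym (RingProperties.-‿involutive ℚₚ.+-*-ring (+ suc n ℚ./ 1))

module FieldProperties {c ℓ₁ ℓ₂} (K : HeytingField c ℓ₁ ℓ₂) where

  open HeytingField K using (_#_; #⇒invertible; heytingCommutativeRing)
  open FieldDefs K
  open CommutativeRing commutativeRing hiding (zero)
  open SetoidReasoning setoid

  inverse : ∀ {y} → y # 0# → Carrier
  inverse y#0 = proj₁ (#⇒invertible y#0)

  -- Apartness yields an inverse of the difference `y - 0#`, which has to be identified with y
  -- first.
  *-inverse : ∀ {y} (y#0 : y # 0#) → y * inverse y#0 ≈ 1#
  *-inverse {y} y#0 =
    trans (*-congʳ (sym (x-0≈x y))) (proj₂ (proj₂ (#⇒invertible y#0)))

  *-cancelʳ : ∀ {x y z} → z # 0# → x * z ≈ y * z → x ≈ y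
  *-cancelʳ {x} {y} {z} z#0 xz≈yz = begin
    x                      ≈⟨ divide x ⟨
    x * z * inverse z#0    ≈⟨ *-congʳ xz≈yz ⟩
    y * z * inverse z#0    ≈⟨ divide y ⟩
    y                      ∎
    where
    divide : ∀ x → x * z * inverse z#0 ≈ x
    divide x = trans (*-assoc x z _) (trans (*-congˡ (*-inverse z#0)) (*-identityʳ x))

  /-* : ∀ x {y} (y#0 : y # 0#) → x / y [ y#0 ] * y ≈ x
  /-* x {y} y#0 = trans (*-assoc x _ y)
    (trans (*-congˡ (trans (*-comm _ y) (*-inverse y#0))) (*-identityʳ x))

  *≈1⇒# : ∀ {x y} → x * y ≈ 1# → y # 0#
  *≈1⇒# {x} xy≈1 = HeytingProperties.invertibleˡ⇒# heytingCommutativeRing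
    (x , trans (*-congˡ (x-0≈x _)) xy≈1)

module RationalPoint {c ℓ₁ ℓ₂} (K : HeytingField c ℓ₁ ℓ₂) (p : Point K) where

  open HeytingField K using (_#_)
  open FieldDefs K
  open CommutativeRing commutativeRing hiding (zero)
  open FieldProperties K
  open Point p
  open RingMorphisms.IsRingHomomorphism ι-isRingHomomorphism
  open SetoidReasoning setoid

  ι-natural : ∀ n → ι (+ n ℚ./ 1) ≈ fromℕ n
  ι-natural zero    = 0#-homo
  ι-natural (suc n) = begin
    ι (+ suc n ℚ./ 1)            ≡⟨ ≡.cong ι (suc/1 n) ⟩
    ι (ℚ.1ℚ ℚ.+ (+ n ℚ./ 1))     ≈⟨ +-homo ℚ.1ℚ (+ n ℚ./ 1) ⟩
    ι ℚ.1ℚ + ι (+ n ℚ./ 1)       ≈⟨ +-cong 1#-homo (ι-natural n) ⟩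
    fromℕ (suc n)                ∎

  ι-/-* : ∀ i d .{{_ : ℕ.NonZero d}} → ι (i ℚ./ d) * fromℕ d ≈ ι (i ℚ./ 1)
  ι-/-* i d = begin
    ι (i ℚ./ d) * fromℕ d            ≈⟨ *-congˡ (ι-natural d) ⟨
    ι (i ℚ./ d) * ι (+ d ℚ./ 1)      ≈⟨ *-homo (i ℚ./ d) (+ d ℚ./ 1) ⟨
    ι ((i ℚ./ d) ℚ.* (+ d ℚ./ 1))    ≡⟨ ≡.cong ι (/-clear i d) ⟩
    ι (i ℚ./ 1)                      ∎

  -- Apartness, and not mere inequality, is obtained because the image of 1/d is an explicit
  -- inverse.
  fromℕ#0 : ∀ d .{{_ : ℕ.NonZero d}} → fromℕ d # 0#
  fromℕ#0 d = *≈1⇒# (trans (ι-/-* (+ 1) d) 1#-homo)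

  ½+½≈1 : ι ½ + ι ½ ≈ 1#
  ½+½≈1 = trans (sym (+-homo ½ ½)) 1#-homo

-- Recurrences for the normalised Bessel function and its square

module BesselSquare {c ℓ₁ ℓ₂} (K : HeytingField c ℓ₁ ℓ₂) (p : Point K)
  (ν∉ : FieldDefs.NotNegativeInteger K (Point.ν p)) where

  open FieldDefs K
  open CommutativeRing commutativeRing hiding (zero)
  open IntegerCoefficients commutativeRing
  open FieldProperties K
  open RationalPoint K p
  open PochhammerDeterminant K using (pochhammer-last)
  open Convolution K
  open SemiringMult semiring using (×-homo-+; ×1-homo-*)
  open Point p
  open RingMorphisms.IsRingHomomorphism ι-isRingHomomorphism using (-‿homo; 1#-homo)
  open Bessel K p ν∉
  open SetoidReasoning setoid

  private
    denominator : ℕ → ℕ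
    denominator k = 4 ℕ.^ k ℕ.* k !

    denominator≢0 : ∀ k → ℕ.NonZero (denominator k)
    denominator≢0 k = ℕₚ.m*n≢0 _ _ {{ℕₚ.m^n≢0 4 k}} {{k ℕₚ.!≢0}}

    numerator : ℕ → Carrier
    numerator k = ι (((ℤ.-1ℤ ℤ.^ k) ℚ./ denominator k) {{denominator≢0 k}})

    -- Spelled as in `cosb`, which is therefore `atSquare coefficient` by definition.
    coefficient : ℕ → Carrier
    coefficient k = numerator k / pochhammer (ν + 1#) k [ pochhammer-#0 ν∉ k ]

    numerator-suc : ∀ k → fromℕ 4 * fromℕ (suc k) * numerator (suc k) ≈ - numerator k
    numerator-suc k = *-cancelʳ (fromℕ#0 (denominator k) {{denominator≢0 k}}) (begin
      fromℕ 4 * fromℕ (suc k) * numerator (suc k) * fromℕ (denominator k)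
        ≈⟨ solve 4 (λ x y n d → x :* y :* n :* d := n :* (x :* y :* d)) refl _ _ _ _ ⟩
      numerator (suc k) * (fromℕ 4 * fromℕ (suc k) * fromℕ (denominator k))
        ≈⟨ *-congˡ (trans (×1-homo-* (4 ℕ.* suc k) (denominator k))
             (*-congʳ (×1-homo-* 4 (suc k)))) ⟨
      numerator (suc k) * fromℕ (4 ℕ.* suc k ℕ.* denominator k)
        ≡⟨ ≡.cong (λ d → numerator (suc k) * fromℕ d) (solveℕ 3 (λ k x y →
             conℕ 4 *ℕ (conℕ 1 +ℕ k) *ℕ (x *ℕ y) =ℕ conℕ 4 *ℕ x *ℕ ((conℕ 1 +ℕ k) *ℕ y))
             ≡.refl k (4 ℕ.^ k) (k !)) ⟩
      numerator (suc k) * fromℕ (denominator (suc k))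
        ≈⟨ ι-/-* (ℤ.-1ℤ ℤ.^ suc k) (denominator (suc k)) {{denominator≢0 (suc k)}} ⟩
      ι ((ℤ.-1ℤ ℤ.^ suc k) ℚ./ 1)
        ≡⟨ ≡.cong ι (≡.trans (≡.cong (ℚ._/ 1) (ℤₚ.-1*i≡-i (ℤ.-1ℤ ℤ.^ k))) (neg/1 (ℤ.-1ℤ ℤ.^ k))) ⟩
      ι (ℚ.- ((ℤ.-1ℤ ℤ.^ k) ℚ./ 1))
        ≈⟨ -‿homo ((ℤ.-1ℤ ℤ.^ k) ℚ./ 1) ⟩
      - ι ((ℤ.-1ℤ ℤ.^ k) ℚ./ 1)
        ≈⟨ -‿cong (ι-/-* (ℤ.-1ℤ ℤ.^ k) (denominator k) {{denominator≢0 k}}) ⟨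
      - (numerator k * fromℕ (denominator k))
        ≈⟨ solve 2 (λ x y → :- (x :* y) := :- x :* y) refl _ _ ⟩
      - numerator k * fromℕ (denominator k) ∎)

    coefficient-suc : ∀ k → fromℕ 4 * fromℕ (suc k) * (ν + fromℕ (suc k)) * coefficient (suc k) ≈
                      - coefficient k
    coefficient-suc k = *-cancelʳ (pochhammer-#0 ν∉ k) (begin
      fromℕ 4 * fromℕ (suc k) * (ν + fromℕ (suc k)) * coefficient (suc k) * pochhammer (ν + 1#) k
        ≈⟨ solve 6 (λ x y ν k c q →
             x :* y :* (ν :+ (con (+ 1) :+ k)) :* c :* q :=
             x :* y :* (c :* ((ν :+ con (+ 1) :+ k) :* q)))
             refl _ _ _ _ _ _ ⟩
      fromℕ 4 * fromℕ (suc k) * (coefficient (suc k) * ((ν + 1# + fromℕ k) * pochhammer (ν + 1#) k))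
        ≈⟨ *-congˡ (*-congˡ (pochhammer-last (ν + 1#) k)) ⟨
      fromℕ 4 * fromℕ (suc k) * (coefficient (suc k) * pochhammer (ν + 1#) (suc k))
        ≈⟨ *-congˡ (/-* _ (pochhammer-#0 ν∉ (suc k))) ⟩
      fromℕ 4 * fromℕ (suc k) * numerator (suc k)
        ≈⟨ numerator-suc k ⟩
      - numerator k
        ≈⟨ -‿cong (/-* _ (pochhammer-#0 ν∉ k)) ⟨
      - (coefficient k * pochhammer (ν + 1#) k)
        ≈⟨ solve 2 (λ x y → :- (x :* y) := :- x :* y) refl _ _ ⟩
      - coefficient k * pochhammer (ν + 1#) k ∎)

  fromℕ-double : ∀ k → fromℕ (k ℕ.+ k) ≈ fromℕ k + fromℕ k
  fromℕ-double k = ×-homo-+ 1# k k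

  fromℕ-! : ∀ n → fromℕ (suc n !) ≈ fromℕ (suc n) * fromℕ (n !)
  fromℕ-! n = ×1-homo-* (suc n) (n !)

  cosb-even : Even cosb
  cosb-even k = reflexive (atSquare-odd coefficient k)

  private
    cosb-equation-even : ∀ k → let n = suc (suc (k ℕ.+ k)) in
      fromℕ n * (fromℕ n * cosb n) ≈
      - (fromℕ 2 * ν) * (fromℕ n * cosb n) + - 1# * cosb (k ℕ.+ k)
    cosb-equation-even k = begin
      N * (N * y₁)
        ≈⟨ *-cong N≈ (*-congʳ N≈) ⟩
      (fromℕ 2 * k₁) * ((fromℕ 2 * k₁) * y₁)
        ≈⟨ solve 3 (λ k v c → let two = con (+ 1) :+ (con (+ 1) :+ con (+ 0)) in
             (two :* k) :* ((two :* k) :* c) :=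
             :- (two :* v) :* (two :* k :* c) :+
             (con (+ 1) :+ (con (+ 1) :+ two)) :* k :* (v :+ k) :* c) refl k₁ ν y₁ ⟩
      - (fromℕ 2 * ν) * (fromℕ 2 * k₁ * y₁) + fromℕ 4 * k₁ * (ν + k₁) * y₁
        ≈⟨ +-cong (*-congˡ (*-congʳ N≈)) last ⟨
      - (fromℕ 2 * ν) * (N * y₁) + - 1# * cosb (k ℕ.+ k) ∎
      where
      N = fromℕ (suc (suc (k ℕ.+ k)))
      k₁ = fromℕ (suc k)
      y₁ = cosb (suc (suc (k ℕ.+ k)))
      N≈ : N ≈ fromℕ 2 * k₁
      N≈ = trans (+-congˡ (+-congˡ (fromℕ-double k))) (solve 1 (λ k →
        con (+ 1) :+ (con (+ 1) :+ (k :+ k)) :=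
        (con (+ 1) :+ (con (+ 1) :+ con (+ 0))) :* (con (+ 1) :+ k)) refl (fromℕ k))
      last : - 1# * cosb (k ℕ.+ k) ≈ fromℕ 4 * k₁ * (ν + k₁) * y₁
      last = begin
        - 1# * cosb (k ℕ.+ k)
          ≡⟨ ≡.cong (- 1# *_) (atSquare-even coefficient k) ⟩
        - 1# * coefficient k
          ≈⟨ solve 1 (λ x → con -[1+ 0 ] :* x := :- x) refl (coefficient k) ⟩
        - coefficient k
          ≈⟨ coefficient-suc k ⟨
        fromℕ 4 * k₁ * (ν + k₁) * coefficient (suc k)
          ≡⟨ ≡.cong (fromℕ 4 * k₁ * (ν + k₁) *_) (atSquare-even (coefficient ∘ ℕ.suc) k) ⟨
        fromℕ 4 * k₁ * (ν + k₁) * y₁ ∎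

    cosb-equation-odd : ∀ n {y y′} → y ≈ 0# → y′ ≈ 0# →
      fromℕ n * (fromℕ n * y) ≈ - (fromℕ 2 * ν) * (fromℕ n * y) + - 1# * y′
    cosb-equation-odd n {y} {y′} y≈0 y′≈0 = begin
      N * (N * y)
        ≈⟨ *-congˡ (*-congˡ y≈0) ⟩
      N * (N * 0#)
        ≈⟨ solve 2 (λ n v → n :* (n :* con (+ 0)) :=
             v :* (n :* con (+ 0)) :+ con -[1+ 0 ] :* con (+ 0)) refl N (- (fromℕ 2 * ν)) ⟩
      - (fromℕ 2 * ν) * (N * 0#) + - 1# * 0#
        ≈⟨ +-cong (*-congˡ (*-congˡ y≈0)) (*-congˡ y′≈0) ⟨
      - (fromℕ 2 * ν) * (N * y) + - 1# * y′ ∎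
      where N = fromℕ n

  -- The Bessel equation. At n = 2k + 2 it is `coefficient-suc`, since n (n + 2ν) = 4 (k + 1) (ν + k
  -- + 1); at n = 0 the operator θ annihilates the coefficient, and at odd n all terms vanish.
  cosb-equation : ∀ n →
    θ (θ cosb) n ≈ - (fromℕ 2 * ν) * θ cosb n + - 1# * x²· cosb n
  cosb-equation n with parity n
  ... | inj₁ (zero , ≡.refl) = solve 2 (λ x y → con (+ 0) :* (con (+ 0) :* x) :=
    y :* (con (+ 0) :* x) :+ con -[1+ 0 ] :* con (+ 0)) refl (cosb 0) (- (fromℕ 2 * ν))
  ... | inj₁ (suc k , ≡.refl) = ≡.subst
    (λ n → θ (θ cosb) n ≈ - (fromℕ 2 * ν) * θ cosb n + - 1# * x²· cosb n)
    (≡.cong suc (≡.sym (ℕₚ.+-suc k k))) (cosb-equation-even k)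
  ... | inj₂ (k , ≡.refl) = cosb-equation-odd (suc (k ℕ.+ k)) (cosb-even k) (x²·-even k)
    where
    x²·-even : ∀ k → x²· cosb (suc (k ℕ.+ k)) ≈ 0#
    x²·-even zero    = refl
    x²·-even (suc k) = trans (reflexive (≡.cong cosb (ℕₚ.+-suc k k))) (cosb-even k)

  cosb² : Series
  cosb² = cosb ⊛ cosb

  cosb²-suc : ∀ k → let k+1 = fromℕ (suc k) ; k+½ = ι ½ + fromℕ k in
    k+1 * (ν + k+1) * (fromℕ 2 * ν + k+1) * cosb² (suc (suc (k ℕ.+ k))) ≈
    - (ν + k+½) * cosb² (k ℕ.+ k)
  -- At n = 2k each of the three factors on the left is even; on the right 4 (2k + 1 + 2ν) is 8 (ν +
  -- 1/2 + k).
  cosb²-suc k = *-cancelʳ (fromℕ#0 8) (begin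
    k₁ * (ν + k₁) * (fromℕ 2 * ν + k₁) * A₂ * fromℕ 8
      ≈⟨ solve 3 (λ k ν a → k₁′ k :* (ν :+ k₁′ k) :* (two :* ν :+ k₁′ k) :* a :* eight :=
           n k :* (n k :+ two :* ν) :* (n k :+ four :* ν) :* a) refl (fromℕ k) ν A₂ ⟩
    _ ≈⟨ *-congʳ (*-cong (*-cong (N≈) (+-congʳ N≈)) (+-congʳ N≈)) ⟨
    N * (N + fromℕ 2 * ν) * (N + fromℕ 4 * ν) * A₂
      ≈⟨ ⊛-square-equation ν cosb cosb-equation (k ℕ.+ k) ⟩
    - (fromℕ 4 * (fromℕ (suc (k ℕ.+ k)) + fromℕ 2 * ν)) * A₀
      ≈⟨ *-congʳ (-‿cong (*-congˡ (+-congʳ (+-cong (sym ½+½≈1) (fromℕ-double k))))) ⟩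
    - (fromℕ 4 * (ι ½ + ι ½ + (fromℕ k + fromℕ k) + fromℕ 2 * ν)) * A₀
      ≈⟨ solve 4 (λ h k ν a → :- (four :* (h :+ h :+ (k :+ k) :+ two :* ν)) :* a :=
           :- (ν :+ (h :+ k)) :* a :* eight) refl (ι ½) (fromℕ k) ν A₀ ⟩
    - (ν + (ι ½ + fromℕ k)) * A₀ * fromℕ 8 ∎)
    where
    two four eight : ∀ {n} → Polynomial n
    two = con (+ 1) :+ (con (+ 1) :+ con (+ 0))
    four = con (+ 1) :+ (con (+ 1) :+ two)
    eight = con (+ 1) :+ (con (+ 1) :+ (con (+ 1) :+ (con (+ 1) :+ four)))
    k₁′ n : ∀ {m} → Polynomial m → Polynomial m
    k₁′ k = con (+ 1) :+ k
    n k = con (+ 1) :+ (con (+ 1) :+ (k :+ k))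
    N = fromℕ (suc (suc (k ℕ.+ k)))
    k₁ = fromℕ (suc k)
    A₀ = cosb² (k ℕ.+ k)
    A₂ = cosb² (suc (suc (k ℕ.+ k)))
    N≈ : N ≈ 1# + (1# + (fromℕ k + fromℕ k))
    N≈ = +-congˡ (+-congˡ (fromℕ-double k))

  private
    cosb²-even : Even cosb²
    cosb²-even = ⊛-even cosb cosb cosb-even cosb-even

  -- As `cosb²` is even, multiplication by 1 + x keeps its even coefficients and copies each of them
  -- to the next odd place.
  f-even : ∀ k → f (k ℕ.+ k) ≈ cosb² (k ℕ.+ k)
  f-even zero    = trans (+-identityʳ _) (*-identityˡ (cosb² 0))
  f-even (suc k) = ≡.subst (λ n → f (suc n) ≈ cosb² (suc n)) (≡.sym (ℕₚ.+-suc k k)) (begin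
    f (suc (suc (k ℕ.+ k)))                          ≈⟨ 1+x-⊛-suc cosb² (suc (k ℕ.+ k)) ⟩
    cosb² (suc (suc (k ℕ.+ k))) + cosb² (suc (k ℕ.+ k))  ≈⟨ +-congˡ (cosb²-even k) ⟩
    cosb² (suc (suc (k ℕ.+ k))) + 0#                 ≈⟨ +-identityʳ _ ⟩
    cosb² (suc (suc (k ℕ.+ k)))                      ∎)

  f-odd : ∀ k → f (suc (k ℕ.+ k)) ≈ cosb² (k ℕ.+ k)
  f-odd k = begin
    f (suc (k ℕ.+ k))                            ≈⟨ 1+x-⊛-suc cosb² (k ℕ.+ k) ⟩
    cosb² (suc (k ℕ.+ k)) + cosb² (k ℕ.+ k)      ≈⟨ +-congʳ (cosb²-even k) ⟩
    0# + cosb² (k ℕ.+ k)                         ≈⟨ +-identityˡ _ ⟩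
    cosb² (k ℕ.+ k)                              ∎

  a : ℕ → Carrier
  a = egfCoefficient f

  a-zero : a 0 ≈ 1#
  a-zero = begin
    (1# + 0#) * (1# * (cosb 0 * cosb 0 + 0#) + 0#)
      ≈⟨ solve 1 (λ y → (con (+ 1) :+ con (+ 0)) :*
             (con (+ 1) :* (y :* y :+ con (+ 0)) :+ con (+ 0)) := y :* y)
           refl (cosb 0) ⟩
    cosb 0 * cosb 0    ≈⟨ *-cong cosb-zero cosb-zero ⟩
    1# * 1#            ≈⟨ *-identityˡ 1# ⟩
    1#                 ∎
    where
    cosb-zero : cosb 0 ≈ 1#
    cosb-zero = begin
      coefficient 0         ≈⟨ *-identityʳ _ ⟨
      coefficient 0 * 1#    ≈⟨ /-* (numerator 0) (pochhammer-#0 ν∉ 0) ⟩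
      ι ℚ.1ℚ                ≈⟨ 1#-homo ⟩
      1#                    ∎

  a-odd : ∀ k → a (suc (k ℕ.+ k)) ≈ (1# + (fromℕ k + fromℕ k)) * a (k ℕ.+ k)
  a-odd k = begin
    fromℕ (suc (k ℕ.+ k) !) * f (suc (k ℕ.+ k))
      ≈⟨ *-cong (fromℕ-! (k ℕ.+ k)) (trans (f-odd k) (sym (f-even k))) ⟩
    (1# + fromℕ (k ℕ.+ k)) * fromℕ ((k ℕ.+ k) !) * f (k ℕ.+ k)
      ≈⟨ trans (*-assoc _ _ _) (*-congʳ (+-congˡ (fromℕ-double k))) ⟩
    (1# + (fromℕ k + fromℕ k)) * a (k ℕ.+ k) ∎

  -- The factorials contribute (2k + 2) (2k + 1) = 4 (k + 1) (k + 1/2). The factor k + 1 is used up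
  -- by `cosb²-suc`, and k + 1/2 is the origin of the parameter 1/2.
  a-suc : ∀ k → (ν + 1# + fromℕ k) * (fromℕ 2 * ν + 1# + fromℕ k) * a (suc (suc (k ℕ.+ k))) ≈
          - fromℕ 4 * ((ι ½ + fromℕ k) * (ν + ι ½ + fromℕ k)) * a (k ℕ.+ k)
  a-suc k = begin
    x * y * (fromℕ (suc (suc n) !) * f (suc (suc n)))
      ≈⟨ *-congˡ (*-cong factorial f≈) ⟩
    x * y * ((1# + (1# + (κ + κ))) * ((h + h + (κ + κ)) * n!) * A₂)
      ≈⟨ solve 5 (λ ν k h n a →
           (ν :+ con (+ 1) :+ k) :* (two :* ν :+ con (+ 1) :+ k) :*
             ((con (+ 1) :+ (con (+ 1) :+ (k :+ k))) :* ((h :+ h :+ (k :+ k)) :* n) :* a) :=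
           four :* (h :+ k) :* n :*
             ((con (+ 1) :+ k) :* (ν :+ (con (+ 1) :+ k)) :* (two :* ν :+ (con (+ 1) :+ k)) :* a))
           refl ν κ h n! A₂ ⟩
    fromℕ 4 * (h + κ) * n! *
      (fromℕ (suc k) * (ν + fromℕ (suc k)) * (fromℕ 2 * ν + fromℕ (suc k)) * A₂)
      ≈⟨ *-congˡ (trans (cosb²-suc k) (*-congˡ (sym (f-even k)))) ⟩
    fromℕ 4 * (h + κ) * n! * (- (ν + (h + κ)) * f n)
      ≈⟨ solve 5 (λ ν k h n a → four :* (h :+ k) :* n :* (:- (ν :+ (h :+ k)) :* a) :=
           :- four :* ((h :+ k) :* (ν :+ h :+ k)) :* (n :* a)) refl ν κ h n! (f n) ⟩
    - fromℕ 4 * ((h + κ) * (ν + h + κ)) * (n! * f n) ∎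
    where
    two four : ∀ {n} → Polynomial n
    two = con (+ 1) :+ (con (+ 1) :+ con (+ 0))
    four = con (+ 1) :+ (con (+ 1) :+ two)
    x = ν + 1# + fromℕ k
    y = fromℕ 2 * ν + 1# + fromℕ k
    n = k ℕ.+ k
    n! = fromℕ (n !)
    κ = fromℕ k
    h = ι ½
    A₂ = cosb² (suc (suc n))
    f≈ : f (suc (suc n)) ≈ A₂
    f≈ = ≡.subst (λ n → f (suc n) ≈ cosb² (suc n)) (ℕₚ.+-suc k k) (f-even (suc k))
    factorial : fromℕ (suc (suc n) !) ≈ (1# + (1# + (κ + κ))) * ((h + h + (κ + κ)) * n!)
    factorial = begin
      fromℕ (suc (suc n) !)
        ≈⟨ fromℕ-! (suc n) ⟩
      fromℕ (suc (suc n)) * fromℕ (suc n !)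
        ≈⟨ *-congˡ (fromℕ-! n) ⟩
      (1# + (1# + fromℕ n)) * ((1# + fromℕ n) * n!)
        ≈⟨ *-cong (+-congˡ (+-congˡ (fromℕ-double k)))
                  (*-congʳ (+-cong (sym ½+½≈1) (fromℕ-double k))) ⟩
      (1# + (1# + (κ + κ))) * ((h + h + (κ + κ)) * n!) ∎

-- Determinants of hypergeometric sequences

module Hypergeometric {c ℓ₁ ℓ₂} (K : HeytingField c ℓ₁ ℓ₂) where

  open FieldDefs K
  open CommutativeRing commutativeRing hiding (zero)
  open IntegerCoefficients commutativeRing
  open Forms commutativeRing
  open IsAlternating
  open PochhammerDeterminant K
  open DeterminantExpansion K
  open SemiringMult semiring using (×-homo-+)
  open SemiringExp semiring using (^-homo-*)
  open SetoidReasoning setoid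

  pochhammer-+ : ∀ γ m n → pochhammer γ (m ℕ.+ n) ≈ pochhammer γ m * pochhammer (γ + fromℕ m) n
  pochhammer-+ γ zero    n = sym (trans (*-identityˡ _) (pochhammer-cong (+-identityʳ γ) n))
  pochhammer-+ γ (suc m) n = begin
    pochhammer γ (suc m ℕ.+ n)
      ≈⟨ pochhammer-first γ (m ℕ.+ n) ⟩
    γ * pochhammer (γ + 1#) (m ℕ.+ n)
      ≈⟨ *-congˡ (pochhammer-+ (γ + 1#) m n) ⟩
    γ * (pochhammer (γ + 1#) m * pochhammer (γ + 1# + fromℕ m) n)
      ≈⟨ *-assoc _ _ _ ⟨
    γ * pochhammer (γ + 1#) m * pochhammer (γ + 1# + fromℕ m) n
      ≈⟨ *-cong (sym (pochhammer-first γ m)) (pochhammer-cong (+-assoc γ 1# (fromℕ m)) n) ⟩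
    pochhammer γ (suc m) * pochhammer (γ + fromℕ (suc m)) n ∎

  module _ (a b c d κ : Carrier) (u : ℕ → Carrier) (u-zero : u 0 ≈ 1#)
    (u-suc : ∀ k → (c + fromℕ k) * (d + fromℕ k) * u (suc k) ≈
                   κ * ((a + fromℕ k) * (b + fromℕ k)) * u k)
    where

    u-pochhammer : ∀ k → u k * (pochhammer c k * pochhammer d k) ≈
                         κ ^ k * (pochhammer a k * pochhammer b k)
    u-pochhammer zero    = *-congʳ u-zero
    u-pochhammer (suc k) = begin
      u (suc k) * (pochhammer c (suc k) * pochhammer d (suc k))
        ≈⟨ *-congˡ (*-cong (pochhammer-last c k) (pochhammer-last d k)) ⟩
      u (suc k) * ((c + fromℕ k) * pochhammer c k * ((d + fromℕ k) * pochhammer d k))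
        ≈⟨ solve 5 (λ u c d p q → u :* (c :* p :* (d :* q)) := c :* d :* u :* (p :* q))
             refl _ _ _ _ _ ⟩
      (c + fromℕ k) * (d + fromℕ k) * u (suc k) * (pochhammer c k * pochhammer d k)
        ≈⟨ *-congʳ (u-suc k) ⟩
      κ * ((a + fromℕ k) * (b + fromℕ k)) * u k * (pochhammer c k * pochhammer d k)
        ≈⟨ *-assoc _ _ _ ⟩
      κ * ((a + fromℕ k) * (b + fromℕ k)) * (u k * (pochhammer c k * pochhammer d k))
        ≈⟨ *-congˡ (u-pochhammer k) ⟩
      κ * ((a + fromℕ k) * (b + fromℕ k)) * (κ ^ k * (pochhammer a k * pochhammer b k))
        ≈⟨ solve 6 (λ κ a b s p q → κ :* (a :* b) :* (s :* (p :* q)) :=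
             κ :* s :* (a :* p :* (b :* q)))
             refl _ _ _ _ _ _ ⟩
      κ ^ suc k * ((a + fromℕ k) * pochhammer a k * ((b + fromℕ k) * pochhammer b k))
        ≈⟨ *-congˡ (*-cong (pochhammer-last a k) (pochhammer-last b k)) ⟨
      κ ^ suc k * (pochhammer a (suc k) * pochhammer b (suc k)) ∎

    module _ (n : ℕ) (r : ℕ → Carrier)
      (r-inverse : ∀ i → pochhammer c (n ℕ.+ i) * pochhammer d (n ℕ.+ i) * r i ≈ 1#)
      where

      open Pairs a b

      -- With n = N - 1, row i involves u i, ..., u (i + n). The inverse r i of their common
      -- denominator is taken out together with the part of the numerator common to them.
      rowFactor : ℕ → Carrier
      rowFactor i = κ ^ i * (pochhammer a i * (pochhammer b i * r i))

      -- Split (a)_(i+l) = (a)_i (a+i)_l in the numerator and (c)_(n+i) = (c)_(i+l) (c+l+i)_m in the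
      -- denominator, and likewise for b and d.
      u-block : ∀ l m → l ℕ.+ m ≡ n → ∀ i → u (i ℕ.+ l) ≈ κ ^ l * (rowFactor ⊙ block c d l m) i
      u-block l m l+m≡n i = begin
        u (i ℕ.+ l)
          ≈⟨ trans (*-congˡ (r-inverse i)) (*-identityʳ _) ⟨
        u (i ℕ.+ l) * (pochhammer c (n ℕ.+ i) * pochhammer d (n ℕ.+ i) * r i)
          ≈⟨ *-congˡ (*-congʳ (*-cong (split c) (split d))) ⟩
        u (i ℕ.+ l) * (pochhammer c (i ℕ.+ l) * x * (pochhammer d (i ℕ.+ l) * y) * r i)
          ≈⟨ solve 6 (λ u p q x y r → u :* (p :* x :* (q :* y) :* r) :=
               u :* (p :* q) :* (x :* (y :* r)))
               refl _ _ _ _ _ _ ⟩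
        u (i ℕ.+ l) * (pochhammer c (i ℕ.+ l) * pochhammer d (i ℕ.+ l)) * (x * (y * r i))
          ≈⟨ *-congʳ (u-pochhammer (i ℕ.+ l)) ⟩
        κ ^ (i ℕ.+ l) * (pochhammer a (i ℕ.+ l) * pochhammer b (i ℕ.+ l)) * (x * (y * r i))
          ≈⟨ *-congʳ (*-cong (^-homo-* κ i l) (*-cong (pochhammer-+ a i l) (pochhammer-+ b i l))) ⟩
        _ ≈⟨ solve 9 (λ s t p v q w x y r →
               s :* t :* (p :* v :* (q :* w)) :* (x :* (y :* r)) :=
               t :* (s :* (p :* (q :* r)) :* (v :* (w :* (x :* (y :* con (+ 1)))))))
               refl (κ ^ i) (κ ^ l) (pochhammer a i) (pochhammer (a + fromℕ i) l)
                 (pochhammer b i) (pochhammer (b + fromℕ i) l) x y (r i) ⟩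
        κ ^ l * (rowFactor ⊙ block c d l m) i ∎
        where
        x = pochhammer (c + fromℕ l + fromℕ i) m
        y = pochhammer (d + fromℕ l + fromℕ i) m
        n+i : n ℕ.+ i ≡ (i ℕ.+ l) ℕ.+ m
        n+i = ≡.trans (≡.cong (ℕ._+ i) (≡.sym l+m≡n))
          (solveℕ 3 (λ l m i → l +ℕ m +ℕ i =ℕ i +ℕ l +ℕ m) ≡.refl l m i)
        split : ∀ γ → pochhammer γ (n ℕ.+ i) ≈
                pochhammer γ (i ℕ.+ l) * pochhammer (γ + fromℕ l + fromℕ i) m
        split γ = begin
          pochhammer γ (n ℕ.+ i)
            ≡⟨ ≡.cong (pochhammer γ) n+i ⟩
          pochhammer γ (i ℕ.+ l ℕ.+ m)
            ≈⟨ pochhammer-+ γ (i ℕ.+ l) m ⟩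
          pochhammer γ (i ℕ.+ l) * pochhammer (γ + fromℕ (i ℕ.+ l)) m
            ≈⟨ *-congˡ (pochhammer-cong (trans (+-congˡ (trans (×-homo-+ 1# i l) (+-comm _ _)))
                 (sym (+-assoc γ _ _))) m) ⟩
          pochhammer γ (i ℕ.+ l) * pochhammer (γ + fromℕ l + fromℕ i) m ∎

      module _ (f : ℕ → Sequence) (f-even : ∀ l i → f (l ℕ.+ l) i ≈ u (i ℕ.+ l))
        (f-odd : ∀ l i → f (suc (l ℕ.+ l)) i ≈
                 (1# + (fromℕ (i ℕ.+ l) + fromℕ (i ℕ.+ l))) * u (i ℕ.+ l))
        where

        -- One power of κ for each column of the pair, and 2 for the leading coefficient of 2t + 2l
        -- + 1.
        columnFactor : ℕ → Carrier
        columnFactor l = fromℕ 2 * (κ ^ l * κ ^ l)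

        columns≈pairs : ∀ {X} → IsAlternating X → ∀ l m → l ℕ.+ m ≡ suc n →
          X (columns f (l ℕ.+ l) (m ℕ.+ m)) ≈
          (∏[ k < m ] columnFactor (l ℕ.+ k)) * X (map (rowFactor ⊙_) (pairs c d l m))
        columns≈pairs X-alt l zero    l+m≡N = sym (*-identityˡ _)
        columns≈pairs {X} X-alt l (suc m) l+m≡N rewrite ℕₚ.+-suc m m = begin
          X (f (l ℕ.+ l) ∷ f (suc (l ℕ.+ l)) ∷ columns f (suc (suc (l ℕ.+ l))) (m ℕ.+ m))
            -- In terms of Q_l and t Q_l the two columns are triangular, because 2 (i + l) + 1 is
            -- (2l + 1) + 2 i.
            ≈⟨ linear₂ X-alt _ s 0# (t * s) (fromℕ 2 * s) f-even′ f-odd′ ⟩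
          (s * (fromℕ 2 * s) - 0# * (t * s)) * X (g ∷ h ∷ columns f (suc (suc (l ℕ.+ l))) (m ℕ.+ m))
            ≈⟨ *-cong (trans (solve 3 (λ s t v → s :* (v :* s) :- con (+ 0) :* (t :* s) :=
                   v :* (s :* s))
                 refl s t (fromℕ 2)) (reflexive (≡.cong columnFactor (≡.sym (ℕₚ.+-identityʳ l)))))
               (reflexive (≡.cong (λ k → X (g ∷ h ∷ columns f (suc k) (m ℕ.+ m)))
                 (≡.sym (ℕₚ.+-suc l l)))) ⟩
          columnFactor (l ℕ.+ 0) * X (g ∷ h ∷ columns f (suc l ℕ.+ suc l) (m ℕ.+ m))
            ≈⟨ *-congˡ (columns≈pairs (◁-isAlternating (◁-isAlternating X-alt g) h) (suc l) m
                 (≡.trans (≡.sym (ℕₚ.+-suc l m)) l+m≡N)) ⟩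
          columnFactor (l ℕ.+ 0) * (∏< m (λ k → columnFactor (suc l ℕ.+ k)) *
            X (g ∷ h ∷ map (rowFactor ⊙_) (pairs c d (suc l) m)))
            ≈⟨ *-assoc _ _ _ ⟨
          columnFactor (l ℕ.+ 0) * ∏< m (λ k → columnFactor (suc l ℕ.+ k)) *
            X (g ∷ h ∷ map (rowFactor ⊙_) (pairs c d (suc l) m))
            ≈⟨ *-congʳ (*-congˡ (∏-cong m λ k →
                 reflexive (≡.cong columnFactor (≡.sym (ℕₚ.+-suc l k))))) ⟩
          (∏[ k < suc m ] columnFactor (l ℕ.+ k)) *
            X (g ∷ h ∷ map (rowFactor ⊙_) (pairs c d (suc l) m)) ∎
          where
          s = κ ^ l
          t = 1# + (fromℕ l + fromℕ l)
          g h : Sequence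
          g = rowFactor ⊙ block c d l m
          h = rowFactor ⊙ times-t (block c d l m)
          l+m≡n : l ℕ.+ m ≡ n
          l+m≡n = ℕₚ.suc-injective (≡.trans (≡.sym (ℕₚ.+-suc l m)) l+m≡N)
          f-even′ : ∀ i → f (l ℕ.+ l) i ≈ s * g i + 0# * h i
          f-even′ i = trans (f-even l i) (trans (u-block l m l+m≡n i)
            (solve 3 (λ s g h → s :* g := s :* g :+ con (+ 0) :* h) refl s (g i) (h i)))
          f-odd′ : ∀ i → f (suc (l ℕ.+ l)) i ≈ (t * s) * g i + (fromℕ 2 * s) * h i
          f-odd′ i = begin
            f (suc (l ℕ.+ l)) i
              ≈⟨ f-odd l i ⟩
            (1# + (fromℕ (i ℕ.+ l) + fromℕ (i ℕ.+ l))) * u (i ℕ.+ l)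
              ≈⟨ *-cong (+-congˡ (+-cong (×-homo-+ 1# i l) (×-homo-+ 1# i l)))
                   (u-block l m l+m≡n i) ⟩
            (1# + ((fromℕ i + fromℕ l) + (fromℕ i + fromℕ l))) *
              (s * (rowFactor i * block c d l m i))
              ≈⟨ solve 5 (λ i l s r q →
                   (con (+ 1) :+ ((i :+ l) :+ (i :+ l))) :* (s :* (r :* q)) :=
                   (con (+ 1) :+ (l :+ l)) :* s :* (r :* q) :+
                   (con (+ 1) :+ (con (+ 1) :+ con (+ 0))) :* s :* (r :* (i :* q)))
                   refl (fromℕ i) (fromℕ l) s (rowFactor i) (block c d l m i) ⟩
            (t * s) * g i + (fromℕ 2 * s) * h i ∎

        evaluations-columns : let N = suc n in
          evaluations (N ℕ.+ N) 0 unit (columns f 0 (N ℕ.+ N)) ≈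
          ∏< N columnFactor * (∏< (N ℕ.+ N) rowFactor *
            (∏< (N ℕ.+ N) (λ i → fromℕ (i !)) * ∏< N (factor c d)))
        evaluations-columns = begin
          evaluations N+N 0 unit (columns f 0 N+N)
            ≈⟨ columns≈pairs (evaluations-isAlternating N+N 0) 0 N ≡.refl ⟩
          ∏< N columnFactor * evaluations N+N 0 unit (map (rowFactor ⊙_) (pairs c d 0 N))
            ≈⟨ *-congˡ (evaluations-⊙ rowFactor N+N 0 (pairs c d 0 N)) ⟩
          ∏< N columnFactor * (∏< N+N rowFactor * evaluations N+N 0 unit (pairs c d 0 N))
            ≈⟨ *-congˡ (*-congˡ (evaluations-pairs N c d 0)) ⟩
          ∏< N columnFactor * (∏< N+N rowFactor *
            (∏< N+N (λ i → fromℕ (i !)) * ∏< N (factor c d))) ∎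
          where
          N   = suc n
          N+N = N ℕ.+ N

[2+n]C2 : ∀ n → suc (suc n) C 2 ≡ suc n ℕ.+ n ℕ.+ n C 2
[2+n]C2 n = begin
  suc (suc n) C 2                   ≡⟨ nCk+nC[k+1]≡[n+1]C[k+1] (suc n) 1 ⟨
  suc n C 1 ℕ.+ suc n C 2           ≡⟨ ≡.cong₂ ℕ._+_ (nC1≡n (suc n))
                                         (≡.sym (nCk+nC[k+1]≡[n+1]C[k+1] n 1)) ⟩
  suc n ℕ.+ (n C 1 ℕ.+ n C 2)       ≡⟨ ≡.cong (λ m → suc n ℕ.+ (m ℕ.+ n C 2)) (nC1≡n n) ⟩
  suc n ℕ.+ (n ℕ.+ n C 2)           ≡⟨ ℕₚ.+-assoc (suc n) n (n C 2) ⟨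
  suc n ℕ.+ n ℕ.+ n C 2             ∎
  where open ≡.≡-Reasoning

-- Assembling the closed form

module BesselHankel {c ℓ₁ ℓ₂} (K : HeytingField c ℓ₁ ℓ₂) (p : Point K)
  (ν∉  : FieldDefs.NotNegativeInteger K (Point.ν p))
  (2ν∉ : FieldDefs.NotNegativeInteger K
           (HeytingField._*_ K (FieldDefs.fromℕ K 2) (Point.ν p)))
  where

  open HeytingField K using (_#_)
  open FieldDefs K
  open CommutativeRing commutativeRing hiding (zero)
  open IntegerCoefficients commutativeRing
  open Forms commutativeRing
  open PochhammerDeterminant K
  open DeterminantExpansion K
  open FieldProperties K
  open RationalPoint K p
  open BesselSquare K p ν∉
  open SemiringMult semiring using (×1-homo-*)
  open Point p
  open Bessel K p ν∉
  open ClosedForm K p ν∉ 2ν∉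
  open SetoidReasoning setoid

  private
    h b c′ d′ κ : Carrier
    h  = ι ½
    b  = ν + ι ½
    c′ = ν + 1#
    d′ = 2ν + 1#
    κ  = - fromℕ 4

  open Hypergeometric K
  open Pairs h b using (factor)

  ∏-* : ∀ n (f g : ℕ → Carrier) → ∏[ i < n ] (f i * g i) ≈ ∏< n f * ∏< n g
  ∏-* zero    f g = sym (*-identityˡ 1#)
  ∏-* (suc n) f g = trans (*-congˡ (∏-* n (f ∘ ℕ.suc) (g ∘ ℕ.suc)))
    (solve 4 (λ x y p q → x :* y :* (p :* q) := x :* p :* (y :* q)) refl (f 0) (g 0) _ _)

  -- The duplication formula for (2i)!. It merges two parts of the row factor with the factorial
  -- from `evaluations-pairs`.
  [-4]^i*½ᵢ*i! : ∀ i → κ ^ i * (pochhammer h i * fromℕ (i !)) ≈ (- 1#) ^ i * fromℕ ((2 ℕ.* i) !)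
  [-4]^i*½ᵢ*i! zero    = *-congˡ (*-identityˡ _)
  [-4]^i*½ᵢ*i! (suc i) = begin
    κ * κ ^ i * (pochhammer h (suc i) * fromℕ (suc i !))
      ≈⟨ *-congˡ (*-cong (pochhammer-last h i) (fromℕ-! i)) ⟩
    κ * κ ^ i * ((h + fromℕ i) * pochhammer h i * ((1# + fromℕ i) * fromℕ (i !)))
      ≈⟨ solve 5 (λ s h i q f → :- four :* s :* ((h :+ i) :* q :* ((con (+ 1) :+ i) :* f)) :=
           :- ((con (+ 1) :+ (con (+ 1) :+ (i :+ i))) :* ((h :+ h) :+ (i :+ i))) :* (s :* (q :* f)))
           refl (κ ^ i) h (fromℕ i) (pochhammer h i) (fromℕ (i !)) ⟩
    - ((1# + (1# + (fromℕ i + fromℕ i))) * ((h + h) + (fromℕ i + fromℕ i))) * _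
      ≈⟨ *-cong (-‿cong (*-congˡ (+-congʳ ½+½≈1))) ([-4]^i*½ᵢ*i! i) ⟩
    - ((1# + (1# + (fromℕ i + fromℕ i))) * (1# + (fromℕ i + fromℕ i))) *
      ((- 1#) ^ i * fromℕ ((2 ℕ.* i) !))
      ≈⟨ *-congʳ (-‿cong (*-cong (+-congˡ (+-congˡ 2i)) (+-congˡ 2i))) ⟨
    - ((1# + (1# + fromℕ (2 ℕ.* i))) * (1# + fromℕ (2 ℕ.* i))) *
      ((- 1#) ^ i * fromℕ ((2 ℕ.* i) !))
      ≈⟨ solve 4 (λ x y s f → :- (x :* y) :* (s :* f) := con -[1+ 0 ] :* s :* (x :* (y :* f)))
           refl _ _ _ _ ⟩
    (- 1#) ^ suc i * (fromℕ (suc (suc (2 ℕ.* i))) * (fromℕ (suc (2 ℕ.* i)) * fromℕ ((2 ℕ.* i) !)))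
      ≈⟨ *-congˡ (trans (fromℕ-! (suc (2 ℕ.* i))) (*-congˡ (fromℕ-! (2 ℕ.* i)))) ⟨
    (- 1#) ^ suc i * fromℕ (suc (suc (2 ℕ.* i)) !)
      ≡⟨ ≡.cong (λ n → (- 1#) ^ suc i * fromℕ (n !)) (ℕₚ.*-suc 2 i) ⟨
    (- 1#) ^ suc i * fromℕ ((2 ℕ.* suc i) !) ∎
    where
    four : ∀ {n} → Polynomial n
    four = con (+ 1) :+ (con (+ 1) :+ (con (+ 1) :+ (con (+ 1) :+ con (+ 0))))
    2i : fromℕ (2 ℕ.* i) ≈ fromℕ i + fromℕ i
    2i = trans (reflexive (≡.cong (λ n → fromℕ (i ℕ.+ n)) (ℕₚ.+-identityʳ i))) (fromℕ-double i)

  -- The signs at 2k and 2k + 1 multiply to -1.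
  ∏-signs : ∀ n → ∏[ i < n ℕ.+ n ] ((- 1#) ^ i) ≈ (- 1#) ^ n
  ∏-signs zero    = refl
  ∏-signs (suc n) = begin
    ∏< (suc (n ℕ.+ suc n)) sign
      ≡⟨ ≡.cong (λ m → ∏< (suc m) sign) (ℕₚ.+-suc n n) ⟩
    ∏< (suc (suc (n ℕ.+ n))) sign
      ≈⟨ trans (∏-suc (suc (n ℕ.+ n)) sign) (*-congʳ (∏-suc (n ℕ.+ n) sign)) ⟩
    ∏< (n ℕ.+ n) sign * sign (n ℕ.+ n) * (- 1# * sign (n ℕ.+ n))
      ≈⟨ solve 2 (λ x s → x :* s :* (con -[1+ 0 ] :* s) := con -[1+ 0 ] :* x :* (s :* s)) refl _ _ ⟩
    - 1# * ∏< (n ℕ.+ n) sign * (sign (n ℕ.+ n) * sign (n ℕ.+ n))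
      ≈⟨ *-cong (*-congˡ (∏-signs n)) (-1^-involutive (n ℕ.+ n)) ⟩
    (- 1#) ^ suc n * 1#
      ≈⟨ *-identityʳ _ ⟩
    (- 1#) ^ suc n ∎
    where
    sign : ℕ → Carrier
    sign i = (- 1#) ^ i

  -- `columnFactor` for κ = -4, that is 2 times 16^k. The exponent 4k + 1 is kept as a sum below, in
  -- the shape in which `[2+n]C2` supplies it.
  G : ℕ → Carrier
  G k = fromℕ 2 * (κ ^ k * κ ^ k)

  G≈2^ : ∀ k → G k ≈ fromℕ (2 ℕ.^ (suc (k ℕ.+ k) ℕ.+ (k ℕ.+ k)))
  G≈2^ zero    = trans (*-congˡ (*-identityˡ 1#)) (*-identityʳ _)
  G≈2^ (suc k) = begin
    fromℕ 2 * (κ * κ ^ k * (κ * κ ^ k))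
      ≈⟨ solve 3 (λ t f s → t :* ((:- f) :* s :* ((:- f) :* s)) := f :* f :* (t :* (s :* s)))
           refl (fromℕ 2) (fromℕ 4) (κ ^ k) ⟩
    fromℕ 4 * fromℕ 4 * G k
      ≈⟨ *-cong (sym (×1-homo-* 4 4)) (G≈2^ k) ⟩
    fromℕ 16 * fromℕ (2 ℕ.^ (suc (k ℕ.+ k) ℕ.+ (k ℕ.+ k)))
      ≈⟨ ×1-homo-* 16 (2 ℕ.^ (suc (k ℕ.+ k) ℕ.+ (k ℕ.+ k))) ⟨
    fromℕ (16 ℕ.* 2 ℕ.^ (suc (k ℕ.+ k) ℕ.+ (k ℕ.+ k)))
      ≡⟨ ≡.cong fromℕ (ℕₚ.^-distribˡ-+-* 2 4 (suc (k ℕ.+ k) ℕ.+ (k ℕ.+ k))) ⟨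
    fromℕ (2 ℕ.^ (4 ℕ.+ (suc (k ℕ.+ k) ℕ.+ (k ℕ.+ k))))
      ≡⟨ ≡.cong (λ e → fromℕ (2 ℕ.^ e)) (solveℕ 1 (λ k →
           conℕ 4 +ℕ ((conℕ 1 +ℕ (k +ℕ k)) +ℕ (k +ℕ k)) =ℕ
           (conℕ 1 +ℕ ((conℕ 1 +ℕ k) +ℕ (conℕ 1 +ℕ k))) +ℕ ((conℕ 1 +ℕ k) +ℕ (conℕ 1 +ℕ k)))
           ≡.refl k) ⟩
    fromℕ (2 ℕ.^ (suc (suc k ℕ.+ suc k) ℕ.+ (suc k ℕ.+ suc k))) ∎

  -- The exponent 4n + 1 of `G n` is the increment of the binomial coefficient when 2n grows to 2n +
  -- 2.
  ∏-G : ∀ n → ∏< n G ≈ fromℕ (2 ℕ.^ ((n ℕ.+ n) C 2))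
  ∏-G zero    = sym (+-identityʳ 1#)
  ∏-G (suc n) = begin
    ∏< (suc n) G
      ≈⟨ trans (∏-suc n G) (*-comm _ _) ⟩
    G n * ∏< n G
      ≈⟨ *-cong (G≈2^ n) (∏-G n) ⟩
    fromℕ (2 ℕ.^ e) * fromℕ (2 ℕ.^ ((n ℕ.+ n) C 2))
      ≈⟨ ×1-homo-* (2 ℕ.^ e) _ ⟨
    fromℕ (2 ℕ.^ e ℕ.* 2 ℕ.^ ((n ℕ.+ n) C 2))
      ≡⟨ ≡.cong fromℕ (ℕₚ.^-distribˡ-+-* 2 e ((n ℕ.+ n) C 2)) ⟨
    fromℕ (2 ℕ.^ (e ℕ.+ (n ℕ.+ n) C 2))
      ≡⟨ ≡.cong (λ e → fromℕ (2 ℕ.^ e))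
           (≡.trans (≡.cong (λ m → suc m C 2) (ℕₚ.+-suc n n)) ([2+n]C2 (n ℕ.+ n))) ⟨
    fromℕ (2 ℕ.^ ((suc n ℕ.+ suc n) C 2)) ∎
    where e = suc (n ℕ.+ n) ℕ.+ (n ℕ.+ n)

  -- The square appears because c - a and d - b are both ν + 1/2; the other differences are c - b =
  -- 1/2 and d - a = 2ν + 1/2.
  factor≈ : ∀ k → factor c′ d′ k ≈
    pochhammer h k * pochhammer (ν + h) k ^ 2 * pochhammer (2ν + h) k
  factor≈ k = begin
    pochhammer (c′ - h) k * pochhammer (c′ - b) k * (pochhammer (d′ - h) k * pochhammer (d′ - b) k)
      ≈⟨ *-cong (*-cong (pochhammer-cong c-h k) (pochhammer-cong c-b k))
                (*-cong (pochhammer-cong d-h k) (pochhammer-cong d-b k)) ⟩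
    pochhammer (ν + h) k * pochhammer h k * (pochhammer (2ν + h) k * pochhammer (ν + h) k)
      ≈⟨ solve 3 (λ x y z → y :* x :* (z :* y) := x :* (y :* (y :* con (+ 1))) :* z) refl _ _ _ ⟩
    pochhammer h k * pochhammer (ν + h) k ^ 2 * pochhammer (2ν + h) k ∎
    where
    two : ∀ {n} → Polynomial n
    two = con (+ 1) :+ (con (+ 1) :+ con (+ 0))
    c-h : c′ - h ≈ ν + h
    c-h = trans (+-congʳ (+-congˡ (sym ½+½≈1)))
      (solve 2 (λ ν h → ν :+ (h :+ h) :- h := ν :+ h) refl ν h)
    c-b : c′ - b ≈ h
    c-b = trans (+-congʳ (+-congˡ (sym ½+½≈1)))
      (solve 2 (λ ν h → ν :+ (h :+ h) :- (ν :+ h) := h) refl ν h)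
    d-h : d′ - h ≈ 2ν + h
    d-h = trans (+-congʳ (+-congˡ (sym ½+½≈1)))
      (solve 2 (λ ν h → two :* ν :+ (h :+ h) :- h := two :* ν :+ h) refl ν h)
    d-b : d′ - b ≈ ν + h
    d-b = trans (+-congʳ (+-congˡ (sym ½+½≈1)))
      (solve 2 (λ ν h → two :* ν :+ (h :+ h) :- (ν :+ h) := ν :+ h) refl ν h)

  private
    u : ℕ → Carrier
    u k = a (k ℕ.+ k)

    column : ℕ → Sequence
    column j i = a (2 ℕ.* i ℕ.+ j)

    u-suc : ∀ k → (c′ + fromℕ k) * (d′ + fromℕ k) * u (suc k) ≈
                  κ * ((h + fromℕ k) * (b + fromℕ k)) * u k
    u-suc k = trans
      (*-congˡ (reflexive (≡.cong (λ n → a (suc n)) (ℕₚ.+-suc k k)))) (a-suc k)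

    column-even : ∀ l i → column (l ℕ.+ l) i ≈ u (i ℕ.+ l)
    column-even l i = reflexive (≡.cong a (solveℕ 2 (λ i l →
      conℕ 2 *ℕ i +ℕ (l +ℕ l) =ℕ (i +ℕ l) +ℕ (i +ℕ l)) ≡.refl i l))

    column-odd : ∀ l i → column (suc (l ℕ.+ l)) i ≈
                 (1# + (fromℕ (i ℕ.+ l) + fromℕ (i ℕ.+ l))) * u (i ℕ.+ l)
    column-odd l i = trans (reflexive (≡.cong a (solveℕ 2 (λ i l →
      conℕ 2 *ℕ i +ℕ (conℕ 1 +ℕ (l +ℕ l)) =ℕ conℕ 1 +ℕ ((i +ℕ l) +ℕ (i +ℕ l))) ≡.refl i l)))
      (a-odd (i ℕ.+ l))

    denominator#0 : ∀ m → pochhammer c′ m * pochhammer d′ m # 0#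
    denominator#0 m = x#0y#0→xy#0 (pochhammer-#0 ν∉ m) (pochhammer-#0 2ν∉ m)

    quotient : ℕ → ℕ → Carrier
    quotient n i = pochhammer b i
      / (pochhammer c′ (n ℕ.+ i) * pochhammer d′ (n ℕ.+ i)) [ denominator#0 (n ℕ.+ i) ]

    -- This is `rowFactor` by definition, since `quotient` unfolds to a product with the inverse
    -- that is passed for r.
    row : ℕ → ℕ → Carrier
    row n i = κ ^ i * (pochhammer h i * quotient n i)

    ∏-row : ∀ n m → ∏< (m ℕ.+ m) (row n) * ∏< (m ℕ.+ m) (λ i → fromℕ (i !)) ≈
      (- 1#) ^ m * ∏< (m ℕ.+ m) (λ i → fromℕ ((2 ℕ.* i) !)) * ∏< (m ℕ.+ m) (quotient n)
    ∏-row n m = begin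
      ∏< M (row n) * ∏< M (λ i → fromℕ (i !))
        ≈⟨ ∏-* M (row n) (λ i → fromℕ (i !)) ⟨
      ∏[ i < M ] (row n i * fromℕ (i !))
        ≈⟨ ∏-cong M (λ i → trans (solve 4 (λ s q x f → s :* (q :* x) :* f := s :* (q :* f) :* x)
             refl (κ ^ i) (pochhammer h i) (quotient n i) (fromℕ (i !)))
             (*-congʳ ([-4]^i*½ᵢ*i! i))) ⟩
      ∏[ i < M ] ((- 1#) ^ i * fromℕ ((2 ℕ.* i) !) * quotient n i)
        ≈⟨ ∏-* M (λ i → (- 1#) ^ i * fromℕ ((2 ℕ.* i) !)) (quotient n) ⟩
      ∏< M (λ i → (- 1#) ^ i * fromℕ ((2 ℕ.* i) !)) * ∏< M (quotient n)
        ≈⟨ *-congʳ (∏-* M (λ i → (- 1#) ^ i) (λ i → fromℕ ((2 ℕ.* i) !))) ⟩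
      ∏< M (λ i → (- 1#) ^ i) * ∏< M (λ i → fromℕ ((2 ℕ.* i) !)) * ∏< M (quotient n)
        ≈⟨ *-congʳ (*-congʳ (∏-signs m)) ⟩
      (- 1#) ^ m * ∏< M (λ i → fromℕ ((2 ℕ.* i) !)) * ∏< M (quotient n) ∎
      where M = m ℕ.+ m

    -- The size M is separated from n so that one substitution passes from N + N to 2 * N; for N =
    -- suc n the index N ∸ 1 computes to n.
    closedForm′ : ℕ → ℕ → Carrier
    closedForm′ n M =
        (- 1#) ^ suc n
      * fromℕ (2 ℕ.^ (M C 2))
      * ∏< M (λ i → fromℕ ((2 ℕ.* i) !))
      * ∏< (suc n) (λ k → pochhammer h k * pochhammer (ν + h) k ^ 2 * pochhammer (2ν + h) k)
      * ∏< M (quotient n)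

    Ḧ≈closedForm′ : ∀ n → Ḧ (suc n ℕ.+ suc n) f ≈ closedForm′ n (suc n ℕ.+ suc n)
    Ḧ≈closedForm′ n = begin
      Ḧ M f
        ≈⟨ det-evaluations {M} 0 (λ j → column (toℕ j)) ⟩
      evaluations M 0 unit (tabulate {n = M} (λ j → column (toℕ j)))
        ≡⟨ ≡.cong (evaluations M 0 unit) (tabulate≡columns column 0 {M} (λ j → ≡.refl)) ⟩
      evaluations M 0 unit (columns column 0 M)
        ≈⟨ evaluations-columns h b c′ d′ κ u a-zero u-suc n
             (λ i → inverse (denominator#0 (n ℕ.+ i))) (λ i → *-inverse (denominator#0 (n ℕ.+ i)))
             column column-even column-odd ⟩
      ∏< (suc n) G * (∏< M (row n) * (∏< M (λ i → fromℕ (i !)) * ∏< (suc n) (factor c′ d′)))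
        ≈⟨ *-cong (∏-G (suc n)) (trans (sym (*-assoc _ _ _))
             (*-cong (∏-row n (suc n)) (∏-cong (suc n) factor≈))) ⟩
      fromℕ (2 ℕ.^ (M C 2)) *
        ((- 1#) ^ suc n * ∏< M (λ i → fromℕ ((2 ℕ.* i) !)) * ∏< M (quotient n) *
        ∏< (suc n) (λ k → pochhammer h k * pochhammer (ν + h) k ^ 2 * pochhammer (2ν + h) k))
        ≈⟨ solve 5 (λ g s x q y → g :* (s :* x :* q :* y) := s :* g :* x :* y :* q) refl _ _ _ _ _ ⟩
      closedForm′ n M ∎
      where M = suc n ℕ.+ suc n

  Ḧ≈closedForm : ∀ N → 1 ℕ.≤ N → Ḧ (2 ℕ.* N) f ≈ closedForm N
  Ḧ≈closedForm (suc n) _ = ≡.subst (λ M → Ḧ M f ≈ closedForm′ n M)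
    (≡.cong (suc n ℕ.+_) (≡.sym (ℕₚ.+-identityʳ (suc n)))) (Ḧ≈closedForm′ n)

-- Transfer of determinants along a relation of fields

-- A homomorphism would be too much to ask, as a rational function may have a pole at the point;
-- inverses correspond only if both elements are apart from zero.
record FieldRelation {a ℓ₁ ℓ₂ b m₁ m₂} (K : HeytingField a ℓ₁ ℓ₂) (L : HeytingField b m₁ m₂) r :
       Set (a ⊔ ℓ₁ ⊔ ℓ₂ ⊔ b ⊔ m₁ ⊔ m₂ ⊔ lsuc r) where
  private
    module K = HeytingField K
    module L = HeytingField L
  infix 4 _⇝_
  field
    _⇝_       : K.Carrier → L.Carrier → Set r
    +-⇝       : ∀ {x y x′ y′} → x ⇝ x′ → y ⇝ y′ → x K.+ y ⇝ x′ L.+ y′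
    *-⇝       : ∀ {x y x′ y′} → x ⇝ x′ → y ⇝ y′ → x K.* y ⇝ x′ L.* y′
    -‿⇝       : ∀ {x x′} → x ⇝ x′ → K.- x ⇝ L.- x′
    0#-⇝      : K.0# ⇝ L.0#
    1#-⇝      : K.1# ⇝ L.1#
    inverse-⇝ : ∀ {x x′} → x ⇝ x′ → (x#0 : x K.# K.0#) (x′#0 : x′ L.# L.0#) →
                FieldProperties.inverse K x#0 ⇝ FieldProperties.inverse L x′#0

module Parametricity {a ℓ₁ ℓ₂ b m₁ m₂ r} {K : HeytingField a ℓ₁ ℓ₂} {L : HeytingField b m₁ m₂}
  (R : FieldRelation K L r) where

  open FieldRelation R
  private
    module K where
      open HeytingField K public
      open FieldDefs K public
    module L where
      open HeytingField L public
      open FieldDefs L public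

  fromℕ-⇝ : ∀ n → K.fromℕ n ⇝ L.fromℕ n
  fromℕ-⇝ zero    = 0#-⇝
  fromℕ-⇝ (suc n) = +-⇝ 1#-⇝ (fromℕ-⇝ n)

  ^-⇝ : ∀ {x x′} n → x ⇝ x′ → x K.^ n ⇝ x′ L.^ n
  ^-⇝ zero    x⇝ = 1#-⇝
  ^-⇝ (suc n) x⇝ = *-⇝ x⇝ (^-⇝ n x⇝)

  sum-⇝ : ∀ {n} {f : Fin n → K.Carrier} {g} → (∀ i → f i ⇝ g i) → K.sum f ⇝ L.sum g
  sum-⇝ {zero}  f⇝g = 0#-⇝
  sum-⇝ {suc n} f⇝g = +-⇝ (f⇝g zero) (sum-⇝ (f⇝g ∘ suc))

  product-⇝ : ∀ {n} {f : Fin n → K.Carrier} {g} → (∀ i → f i ⇝ g i) → K.product f ⇝ L.product g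
  product-⇝ {zero}  f⇝g = 1#-⇝
  product-⇝ {suc n} f⇝g = *-⇝ (f⇝g zero) (product-⇝ (f⇝g ∘ suc))

  det-⇝ : ∀ {n} {M : K.Matrix n} {M′} → (∀ i j → M i j ⇝ M′ i j) → K.det M ⇝ L.det M′
  det-⇝ {zero}  M⇝ = 1#-⇝
  det-⇝ {suc n} M⇝ = sum-⇝ λ j → *-⇝ (^-⇝ (toℕ j) (-‿⇝ 1#-⇝))
    (*-⇝ (M⇝ zero j) (det-⇝ λ i k → M⇝ (suc i) (punchIn j k)))

  atSquare-⇝ : ∀ {f g} → (∀ n → f n ⇝ g n) → ∀ n → K.atSquare f n ⇝ L.atSquare g n
  atSquare-⇝ f⇝g zero          = f⇝g 0
  atSquare-⇝ f⇝g (suc zero)    = 0#-⇝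
  atSquare-⇝ f⇝g (suc (suc n)) = atSquare-⇝ (f⇝g ∘ ℕ.suc) n

  1+x-⇝ : ∀ n → K.1+x n ⇝ L.1+x n
  1+x-⇝ zero          = 1#-⇝
  1+x-⇝ (suc zero)    = 1#-⇝
  1+x-⇝ (suc (suc n)) = 0#-⇝

  ⊛-⇝ : ∀ {f g f′ g′} → (∀ n → f n ⇝ f′ n) → (∀ n → g n ⇝ g′ n) →
        ∀ n → (f K.⊛ g) n ⇝ (f′ L.⊛ g′) n
  ⊛-⇝ f⇝ g⇝ n = sum-⇝ {ℕ.suc n} λ i → *-⇝ (f⇝ (toℕ i)) (g⇝ (n ∸ toℕ i))

  module _ (p : Point K) (q : Point L)
    (ι⇝ : ∀ x → Point.ι p x ⇝ Point.ι q x) (ν⇝ : Point.ν p ⇝ Point.ν q)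
    (p∉ : K.NotNegativeInteger (Point.ν p)) (q∉ : L.NotNegativeInteger (Point.ν q)) where

    cosb-⇝ : ∀ n → Bessel.cosb K p p∉ n ⇝ Bessel.cosb L q q∉ n
    cosb-⇝ = atSquare-⇝ λ k → *-⇝ (ι⇝ _)
      (inverse-⇝ (product-⇝ {k} λ i → +-⇝ (+-⇝ ν⇝ 1#-⇝) (fromℕ-⇝ (toℕ i)))
        (K.pochhammer-#0 p∉ k) (L.pochhammer-#0 q∉ k))

    f-⇝ : ∀ n → Bessel.f K p p∉ n ⇝ Bessel.f L q q∉ n
    f-⇝ = ⊛-⇝ 1+x-⇝ (⊛-⇝ cosb-⇝ cosb-⇝)

    Ḧ-⇝ : ∀ n → K.Ḧ n (Bessel.f K p p∉) ⇝ L.Ḧ n (Bessel.f L q q∉)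
    Ḧ-⇝ n = det-⇝ {n} λ i j → let k = 2 ℕ.* toℕ i ℕ.+ toℕ j in *-⇝ (fromℕ-⇝ (k !)) (f-⇝ k)

-- Values of rational functions at a point

module Evaluation {c ℓ₁ ℓ₂} (K : HeytingField c ℓ₁ ℓ₂) (p : Point K) where

  open HeytingField K using (_#_; #-irrefl)
  open FieldDefs K hiding (_/_[_])
  open CommutativeRing commutativeRing hiding (zero)
  open IntegerCoefficients commutativeRing
  open FieldProperties K
  open Point p
  open RingMorphisms.IsRingHomomorphism ι-isRingHomomorphism
  open Specialisation K p
  open ℚ[ν] using (_≈ₚ_; coeffwise; coeff-≈; _+ₚ_; _*ₚ_; -ₚ_; _·_; 0ₚ; 1ₚ)
  open ℚ⟨ν⟩ using (Fraction; _/_[_]; num; den; _≈ᶠ_; cross; cross-≈; _+ᶠ_; _*ᶠ_; -ᶠ_)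
  open SetoidReasoning setoid
  private
    module ℚν = CommutativeRing ℚ⟨ν⟩.commutativeRing

  evaluate-0 : ∀ q → q ≈ₚ 0ₚ → evaluate q ≈ 0#
  evaluate-0 []      q≈0 = refl
  evaluate-0 (a ∷ q) q≈0 = begin
    ι a + ν * evaluate q
      ≈⟨ +-cong (trans (reflexive (≡.cong ι (coeff-≈ q≈0 0))) 0#-homo)
                (*-congˡ (evaluate-0 q (coeffwise λ n → coeff-≈ q≈0 (suc n)))) ⟩
    0# + ν * 0#    ≈⟨ solve 1 (λ v → con (+ 0) :+ v :* con (+ 0) := con (+ 0)) refl ν ⟩
    0#             ∎

  evaluate-cong : ∀ {q q′} → q ≈ₚ q′ → evaluate q ≈ evaluate q′
  evaluate-cong {[]}    {q′}     q≈ = sym (evaluate-0 q′ (ℚ[ν].≈ₚ-sym q≈))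
  evaluate-cong {a ∷ q} {[]}     q≈ = evaluate-0 (a ∷ q) q≈
  evaluate-cong {a ∷ q} {b ∷ q′} q≈ = +-cong (reflexive (≡.cong ι (coeff-≈ q≈ 0)))
    (*-congˡ (evaluate-cong {q} {q′} (coeffwise λ n → coeff-≈ q≈ (suc n))))

  evaluate-+ : ∀ q r → evaluate (q +ₚ r) ≈ evaluate q + evaluate r
  evaluate-+ []      r       = sym (+-identityˡ _)
  evaluate-+ (a ∷ q) []      = sym (+-identityʳ _)
  evaluate-+ (a ∷ q) (b ∷ r) = trans
    (+-cong (+-homo a b) (*-congˡ (evaluate-+ q r)))
    (solve 5 (λ a b v x y → a :+ b :+ v :* (x :+ y) := (a :+ v :* x) :+ (b :+ v :* y))
      refl (ι a) (ι b) ν (evaluate q) (evaluate r))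

  evaluate-neg : ∀ q → evaluate (-ₚ q) ≈ - evaluate q
  evaluate-neg []      = solve 0 (con (+ 0) := :- con (+ 0)) refl
  evaluate-neg (a ∷ q) = trans
    (+-cong (-‿homo a) (*-congˡ (evaluate-neg q)))
    (solve 3 (λ a v x → :- a :+ v :* :- x := :- (a :+ v :* x)) refl (ι a) ν (evaluate q))

  evaluate-· : ∀ a q → evaluate (a · q) ≈ ι a * evaluate q
  evaluate-· a []      = sym (zeroʳ (ι a))
  evaluate-· a (b ∷ q) = trans
    (+-cong (*-homo a b) (*-congˡ (evaluate-· a q)))
    (solve 4 (λ a b v x → a :* b :+ v :* (a :* x) := a :* (b :+ v :* x))
      refl (ι a) (ι b) ν (evaluate q))

  evaluate-* : ∀ q r → evaluate (q *ₚ r) ≈ evaluate q * evaluate r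
  evaluate-* []      r = sym (zeroˡ (evaluate r))
  evaluate-* (a ∷ q) r = begin
    evaluate (a · r +ₚ (ℚ.0ℚ ∷ q *ₚ r))
      ≈⟨ evaluate-+ (a · r) (ℚ.0ℚ ∷ q *ₚ r) ⟩
    evaluate (a · r) + (ι ℚ.0ℚ + ν * evaluate (q *ₚ r))
      ≈⟨ +-cong (evaluate-· a r) (+-cong 0#-homo (*-congˡ (evaluate-* q r))) ⟩
    ι a * evaluate r + (0# + ν * (evaluate q * evaluate r))
      ≈⟨ solve 4 (λ a v x y → a :* y :+ (con (+ 0) :+ v :* (x :* y)) := (a :+ v :* x) :* y)
           refl (ι a) ν (evaluate q) (evaluate r) ⟩
    evaluate (a ∷ q) * evaluate r ∎

  evaluate-constant : ∀ a → evaluate (a ∷ []) ≈ ι a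
  evaluate-constant a = trans (+-congˡ (zeroʳ ν)) (+-identityʳ (ι a))

  -- F is regular at the given point, with value v.
  infix 4 _↦_
  record _↦_ (F : Fraction) (v : Carrier) : Set (ℓ₁ ⊔ ℓ₂) where
    constructor mapsto
    field
      regular : RegularAt F
    open RegularAt regular public
    field
      -- Without division the rules for sums and products are polynomial identities.
      num≈ : evaluate (num representative) ≈ v * evaluate (den representative)

  ↦-fromDomain : ∀ q {v} → evaluate q ≈ v → ℚ⟨ν⟩.fromDomain q ↦ v
  ↦-fromDomain q q≈v = mapsto
    (record { representative = ℚ⟨ν⟩.fromDomain q ; represents = ℚ⟨ν⟩.≈ᶠ-refl
            ; den#0 = #-congʳ (sym 1≈) 1#0 })
    (trans q≈v (trans (sym (*-identityʳ _)) (*-congˡ (sym 1≈))))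
    where
    1≈ : evaluate 1ₚ ≈ 1#
    1≈ = trans (evaluate-constant ℚ.1ℚ) 1#-homo

  ι-↦ : ∀ a → GenericPoint.ι a ↦ ι a
  ι-↦ a = ↦-fromDomain _ (evaluate-constant a)

  ν-↦ : GenericPoint.ν ↦ ν
  ν-↦ = ↦-fromDomain ℚ[ν].X (begin
    ι ℚ.0ℚ + ν * evaluate 1ₚ
      ≈⟨ +-cong 0#-homo (*-congˡ (trans (evaluate-constant ℚ.1ℚ) 1#-homo)) ⟩
    0# + ν * 1#    ≈⟨ solve 1 (λ v → con (+ 0) :+ v :* con (+ 1) := v) refl ν ⟩
    ν              ∎)

  +-↦ : ∀ {F G v w} → F ↦ v → G ↦ w → F +ᶠ G ↦ v + w
  +-↦ {v = v} {w} (mapsto F-regular n≈) (mapsto G-regular m≈) = mapsto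
    (record { representative = x +ᶠ y
            ; represents = ℚ⟨ν⟩.+ᶠ-cong (F.represents) (G.represents)
            ; den#0 = #-congʳ (sym (evaluate-* (den x) (den y))) (x#0y#0→xy#0 F.den#0 G.den#0) })
    (begin
      evaluate (num x *ₚ den y +ₚ num y *ₚ den x)
        ≈⟨ trans (evaluate-+ (num x *ₚ den y) _)
             (+-cong (evaluate-* (num x) (den y)) (evaluate-* (num y) (den x))) ⟩
      evaluate (num x) * evaluate (den y) + evaluate (num y) * evaluate (den x)
        ≈⟨ +-cong (*-congʳ n≈) (*-congʳ m≈) ⟩
      v * evaluate (den x) * evaluate (den y) + w * evaluate (den y) * evaluate (den x)
        ≈⟨ solve 4 (λ v w x y → v :* x :* y :+ w :* y :* x := (v :+ w) :* (x :* y)) refl v w _ _ ⟩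
      (v + w) * (evaluate (den x) * evaluate (den y))
        ≈⟨ *-congˡ (evaluate-* (den x) (den y)) ⟨
      (v + w) * evaluate (den x *ₚ den y) ∎)
    where
    module F = RegularAt F-regular
    module G = RegularAt G-regular
    x = F.representative
    y = G.representative

  *-↦ : ∀ {F G v w} → F ↦ v → G ↦ w → F *ᶠ G ↦ v * w
  *-↦ {v = v} {w} (mapsto F-regular n≈) (mapsto G-regular m≈) = mapsto
    (record { representative = x *ᶠ y
            ; represents = ℚ⟨ν⟩.*ᶠ-cong (F.represents) (G.represents)
            ; den#0 = #-congʳ (sym (evaluate-* (den x) (den y))) (x#0y#0→xy#0 F.den#0 G.den#0) })
    (begin
      evaluate (num x *ₚ num y)
        ≈⟨ evaluate-* (num x) (num y) ⟩
      evaluate (num x) * evaluate (num y)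
        ≈⟨ *-cong n≈ m≈ ⟩
      v * evaluate (den x) * (w * evaluate (den y))
        ≈⟨ solve 4 (λ v w x y → v :* x :* (w :* y) := v :* w :* (x :* y)) refl v w _ _ ⟩
      v * w * (evaluate (den x) * evaluate (den y))
        ≈⟨ *-congˡ (evaluate-* (den x) (den y)) ⟨
      v * w * evaluate (den x *ₚ den y) ∎)
    where
    module F = RegularAt F-regular
    module G = RegularAt G-regular
    x = F.representative
    y = G.representative

  -‿↦ : ∀ {F v} → F ↦ v → -ᶠ F ↦ - v
  -‿↦ {v = v} (mapsto F-regular n≈) = mapsto
    (record { representative = -ᶠ x
            ; represents = ℚ⟨ν⟩.-ᶠ-cong F.represents
            ; den#0 = F.den#0 })
    (begin
      evaluate (-ₚ num x)           ≈⟨ evaluate-neg (num x) ⟩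
      - evaluate (num x)            ≈⟨ -‿cong n≈ ⟩
      - (v * evaluate (den x))      ≈⟨ solve 2 (λ v x → :- (v :* x) := :- v :* x) refl v _ ⟩
      - v * evaluate (den x)        ∎)
    where
    module F = RegularAt F-regular
    x = F.representative

  -- Exchange numerator and denominator of the representative: the value of the numerator is v times
  -- that of the denominator, hence apart from zero.
  inverse-↦ : ∀ {F v} → F ↦ v → (F#0 : HeytingField._#_ ℚ⟨ν⟩-field F ℚν.0#) (v#0 : v # 0#) →
              FieldProperties.inverse ℚ⟨ν⟩-field F#0 ↦ inverse v#0
  inverse-↦ {F} {v} (mapsto F-regular n≈) F#0 v#0 = mapsto
    (record { representative = y ; represents = F⁻¹≈y ; den#0 = num#0 })
    (begin
      evaluate (den x)
        ≈⟨ trans (*-congʳ (*-inverse v#0)) (*-identityˡ _) ⟨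
      v * inverse v#0 * evaluate (den x)
        ≈⟨ solve 3 (λ v w x → v :* w :* x := w :* (v :* x)) refl v _ _ ⟩
      inverse v#0 * (v * evaluate (den x))
        ≈⟨ *-congˡ n≈ ⟨
      inverse v#0 * evaluate (num x) ∎)
    where
    module R = RegularAt F-regular
    x = R.representative
    num#0 : evaluate (num x) # 0#
    num#0 = #-congʳ (sym n≈) (x#0y#0→xy#0 v#0 R.den#0)
    y : Fraction
    -- A polynomial whose value is apart from zero is not the zero polynomial.
    y = den x / num x [ (λ num≈0 → #-irrefl (evaluate-0 (num x) num≈0) num#0) ]
    F⁻¹ = FieldProperties.inverse ℚ⟨ν⟩-field F#0
    yx≈1 : y *ᶠ x ≈ᶠ ℚν.1#
    yx≈1 = cross (ℚP.trans (ℚP.*-identityʳ _)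
      (ℚP.trans (ℚP.*-comm (den x) (num x)) (ℚP.sym (ℚP.*-identityˡ _))))
      where module ℚP = CommutativeRing ℚ[ν].commutativeRing
    F⁻¹≈y : F⁻¹ ≈ᶠ y
    -- The inverse in ℚ(ν) is formed from the given fraction and not from its representative; the
    -- two agree because both are inverse to F.
    F⁻¹≈y = FieldProperties.*-cancelʳ ℚ⟨ν⟩-field {F⁻¹} {y} {F} F#0
      (ℚν.trans {F⁻¹ *ᶠ F} {ℚν.1#} {y *ᶠ F}
        (ℚν.trans {F⁻¹ *ᶠ F} {F *ᶠ F⁻¹} {ℚν.1#} (ℚν.*-comm F⁻¹ F)
          (FieldProperties.*-inverse ℚ⟨ν⟩-field F#0))
        (ℚν.sym {y *ᶠ F} {ℚν.1#}
          (ℚν.trans {y *ᶠ F} {y *ᶠ x} {ℚν.1#} (ℚν.*-congˡ {y} {F} {x} R.represents) yx≈1)))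

  ↦-fieldRelation : FieldRelation ℚ⟨ν⟩-field K (ℓ₁ ⊔ ℓ₂)
  ↦-fieldRelation = record
    { _⇝_       = _↦_
    ; +-⇝       = +-↦
    ; *-⇝       = *-↦
    ; -‿⇝       = -‿↦
    ; 0#-⇝      = ↦-fromDomain 0ₚ refl
    ; 1#-⇝      = ↦-fromDomain 1ₚ (trans (evaluate-constant ℚ.1ℚ) 1#-homo)
    ; inverse-⇝ = inverse-↦
    }

  -- A value does not depend on the representative: evaluate the cross-multiplied equation and
  -- cancel the denominators, whose values are apart from zero.
  ↦-valueAt : ∀ {F G v} → F ↦ v → F ≈ᶠ G → (G-regular : RegularAt G) → v ≈ valueAt G-regular
  ↦-valueAt {F} {G} {v} (mapsto F-regular n≈) F≈G G-regular = begin
    v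
      ≈⟨ trans (*-assoc v _ _) (trans (*-congˡ (*-inverse G.den#0)) (*-identityʳ v)) ⟨
    v * evaluate (den y) * inverse G.den#0
      ≈⟨ *-congʳ (*-cancelʳ F.den#0 numerators) ⟩
    evaluate (num y) * inverse G.den#0 ∎
    where
    module F = RegularAt F-regular
    module G = RegularAt G-regular
    x = F.representative
    y = G.representative
    x≈y : x ≈ᶠ y
    x≈y = ℚ⟨ν⟩.≈ᶠ-trans (ℚ⟨ν⟩.≈ᶠ-sym F.represents) (ℚ⟨ν⟩.≈ᶠ-trans F≈G G.represents)
    numerators : v * evaluate (den y) * evaluate (den x) ≈ evaluate (num y) * evaluate (den x)
    numerators = begin
      v * evaluate (den y) * evaluate (den x)
        ≈⟨ solve 3 (λ v y x → v :* y :* x := v :* x :* y) refl v _ _ ⟩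
      v * evaluate (den x) * evaluate (den y)
        ≈⟨ *-congʳ n≈ ⟨
      evaluate (num x) * evaluate (den y)
        ≈⟨ evaluate-* (num x) (den y) ⟨
      evaluate (num x *ₚ den y)
        ≈⟨ evaluate-cong (cross-≈ x≈y) ⟩
      evaluate (num y *ₚ den x)
        ≈⟨ evaluate-* (num y) (den x) ⟩
      evaluate (num y) * evaluate (den x) ∎

open import Data.Nat.Base using (_≤_; _*_)
open import Data.Product.Base using (_×_)

theorem25p4 : ∀ {c ℓ₁ ℓ₂} (N : ℕ) → 1 ≤ N →
    let Ḧ[f] = FieldDefs.Ḧ ℚ⟨ν⟩-field (2 * N) GenericPoint.f
        rhs  = GenericPoint.closedForm N
    in
    (Ḧ[f] ℚ⟨ν⟩.≈ᶠ rhs)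
    ×
    ((K : HeytingField c ℓ₁ ℓ₂) (ν₀ : Point K) (ν₀∉ : FieldDefs.NotNegativeInteger K (Point.ν ν₀)) →
      Specialisation.RegularAt K ν₀ Ḧ[f]
      ×
      ((regular : Specialisation.RegularAt K ν₀ rhs) →
        HeytingField._≈_ K (FieldDefs.Ḧ K (2 * N) (Bessel.f K ν₀ ν₀∉))
                           (Specialisation.valueAt K ν₀ regular)))
theorem25p4 N 1≤N = identity , λ K ν₀ ν₀∉ →
  -- At ν₀ the double of ν₀ may be a negative integer, where `BesselHankel` does not apply over K.
  -- The determinant over ℚ(ν) is related to the one over K instead, and the generic identity
  -- identifies its value.
  let open Evaluation K ν₀
      Ḧ[f]↦ = Parametricity.Ḧ-⇝ ↦-fieldRelation
        GenericPoint.point ν₀ ι-↦ ν-↦ GenericPoint.ν∉ ν₀∉ (2 * N)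
  in _↦_.regular Ḧ[f]↦ , λ regular → ↦-valueAt Ḧ[f]↦ identity regular
  where
  identity : FieldDefs.Ḧ ℚ⟨ν⟩-field (2 * N) GenericPoint.f ℚ⟨ν⟩.≈ᶠ GenericPoint.closedForm N
  identity = BesselHankel.Ḧ≈closedForm ℚ⟨ν⟩-field GenericPoint.point
    GenericPoint.ν∉ GenericPoint.2ν∉ N 1≤N
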